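{- Let $p$ be a prime, and let $n\in\mathbb N$ and $n^*=\{ -n\}_{p-1}$. Then $$(-1)^nF_p(n,0)\equiv\bar S(n^*+\{n\}_p,\{n\}_p)\equiv\frac{B_{n^*}^{(m)}}{n^*!}\pmod p,$$ where $m$ is any nonnegative integer with $m+n\equiv0\pmod p$. Also, $$(-1)^nF_p(pn+p-1,r)\equiv\frac{B_{n^*}(-r)}{n^*!}\equiv-(p-1-n^*)!\,B_{n^*}(r+1)\pmod p$$ for all $r\in\mathbb Z$, and in particular $$\binom{2p-1}{p+r}+(-1)^p\binom{2p-1}r\equiv(-1)^rp^2B_{p-2}(-r)\pmod{p^3}$$ for every $r=0,\ldots,p-1$.
   Context: $\mathbb N=\{0,1,2,\ldots\}$. For $a\in\mathbb Z$ and a positive integer $m$, $\{a\}_m$ denotes the least nonnegative residue of $a$ modulo $m$. For a prime $p$, $n\in\mathbb N$ and $r\in\mathbb Z$, put $C_p(n,r)=\sum_{0\le k\le n,\ k\equiv r\,(\mathrm{mod}\ p)}\binom nk(-1)^k$. The Fleck quotient is $$F_p(n,r)=(-p)^{ -\lfloor(n-1)/(p-1)\rfloor}C_p(n,r)+[\![n=0]\!],$$ where $[\![A]\!]$ is $1$ if the assertion $A$ holds and $0$ otherwise; it is an integer (Fleck). Let $(x)_0=1$ and $(x)_k=x(x-1)\cdots(x-k+1)$ for $k\ge1$. The Stirling numbers of the second kind $S(n,k)$ ($n,k\in\mathbb N$) are given by $x^n=\sum_{k\in\mathbb N}S(n,k)(x)_k$, and $\bar S(n,k)=\frac{k!}{n!}S(n,k)$.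 For $m\in\mathbb N$ the $m$-th order Bernoulli polynomials $B_n^{(m)}(t)$ are defined by $$\frac{x^me^{tx}}{(e^x-1)^m}=\sum_{n=0}^\infty B_n^{(m)}(t)\frac{x^n}{n!},$$ and $B_n^{(m)}=B_n^{(m)}(0)$; the usual Bernoulli polynomials are $B_n(t)=B_n^{(1)}(t)$. Congruences between rational numbers modulo a power $p^b$ are understood in the ring $\mathbb Z_p$ of $p$-adic integers, i.e. $x\equiv y\pmod{p^b}$ means $x-y\in p^b\mathbb Z_p$. -}

module Defs where

open import Algebra.Bundles using (CommutativeRing)
import Algebra.Construct.Pointwise as Pointwise
import Algebra.Properties.CommutativeMonoid.Mult as Mult
import Algebra.Properties.Semiring.Exp as Exp
import Algebra.Properties.Semiring.Sum as Sum
open import Data.Bool.Base using (if_then_else_)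
open import Data.Fin.Base using (toℕ)
open import Data.Integer.Base as ℤ using (ℤ; +_; -[1+_]; 0ℤ; 1ℤ; -1ℤ)
import Data.Integer.Properties as ℤ
open import Data.Integer.Divisibility.Signed using (_∣?_)
open import Data.Integer.DivMod using (_/ℕ_; _%ℕ_)
open import Data.Integer.Solver using (module +-*-Solver)
open import Data.Nat.Base as ℕ using (ℕ; zero; suc; _∸_; _!; NonZero; z≤n; s≤s)
import Data.Nat.Properties as ℕ
open import Data.Nat.Combinatorics using (_C_)
open import Data.Nat.Divisibility using (_∣_)
import Data.Nat.Solver as ℕSolver
open import Data.Nat.Primality using (Prime; prime⇒nonZero; prime⇒nonTrivial)
open import Data.Product.Base using (Σ; ∃; _×_; _,_; proj₁; proj₂)
open import Data.Rational.Base as ℚ using (ℚ; mkℚ; 0ℚ; 1ℚ; _/_; 1/_; ↧ₙ_)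
import Data.Rational.Properties as ℚ
import Data.Rational.Unnormalised.Base as ℚᵘ
import Data.Rational.Unnormalised.Properties as ℚᵘ
open import Function.Base using (_∘_)
open import Relation.Binary.PropositionalEquality
  using (_≡_; refl; sym; trans; cong; cong₂; module ≡-Reasoning)
import Relation.Binary.Reasoning.Setoid as SetoidReasoning
open import Relation.Nullary using (¬_; Dec; does)

private
  module ℤΣ = Sum (CommutativeRing.semiring ℤ.+-*-commutativeRing)
  module ℚΣ = Sum (CommutativeRing.semiring ℚ.+-*-commutativeRing)
  module ℚ^ = Exp (CommutativeRing.semiring ℚ.+-*-commutativeRing)

ι : ℤ → ℚ
ι z = z / 1

infixr 8 _^_ _^ᶻ_

_^_ : ℚ → ℕ → ℚ
_^_ = ℚ^._^_

_^ᶻ_ : (q : ℚ) .{{_ : ℚ.NonZero q}} → ℤ → ℚ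
q ^ᶻ (+ n)    = q ^ n
q ^ᶻ -[1+ n ] = (1/ q) ^ suc n

infixl 7 _/!_

_/!_ : ℚ → ℕ → ℚ
q /! n = q ℚ.* (_/_ 1ℤ (n !) {{n ℕ.!≢0}})

⟦_⟧ : {A : Set} → Dec A → ℤ
⟦ A? ⟧ = if does A? then 1ℤ else 0ℤ

-- Both sums run over 0 ≤ k < n.
∑ℤ : ℕ → (ℕ → ℤ) → ℤ
∑ℤ n f = ℤΣ.sum {n} (f ∘ toℕ)

∑ℚ : ℕ → (ℕ → ℚ) → ℚ
∑ℚ n f = ℚΣ.sum {n} (f ∘ toℕ)

-- A rational number lies in ℤₚ iff p does not divide its reduced denominator
-- (↧ₙ is the reduced denominator), and x - y ∈ pᵇℤₚ means that
-- x - y = pᵇz for some (necessarily rational) z ∈ ℤₚ.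
_∈ℤ₍_₎ : ℚ → ℕ → Set
q ∈ℤ₍ p ₎ = ¬ (p ∣ ↧ₙ q)

infix 4 _≡_[mod_^_]

_≡_[mod_^_] : ℚ → ℚ → ℕ → ℕ → Set
x ≡ y [mod p ^ b ] = Σ ℚ λ z → z ∈ℤ₍ p ₎ × x ℚ.- y ≡ ι (+ p) ^ b ℚ.* z

falling : ℤ → ℕ → ℤ
falling x zero    = 1ℤ
falling x (suc k) = falling x k ℤ.* (x ℤ.- + k)

-- xⁿ = ∑ₖ S(n,k)(x)ₖ is an identity of polynomials, so each row S(n,-) is
-- finitely supported; ℤ being infinite, it is enough that it holds at all
-- integers x. This determines S.
IsStirling₂ : (ℕ → ℕ → ℕ) → Set
IsStirling₂ S = ∀ n → ∃ λ N →
  (∀ k → N ℕ.≤ k → S n k ≡ 0) ×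
  (∀ x → x ℤ.^ n ≡ ∑ℤ N λ k → + S n k ℤ.* falling x k)

private
  ∑ℤ-cong : ∀ n (f g : ℕ → ℤ) → (∀ k → f k ≡ g k) → ∑ℤ n f ≡ ∑ℤ n g
  ∑ℤ-cong n f g f≡g = ℤΣ.sum-cong-≋ {n} (f≡g ∘ toℕ)

  ∑ℤ-last : ∀ n (f : ℕ → ℤ) → ∑ℤ (suc n) f ≡ ∑ℤ n f ℤ.+ f n
  ∑ℤ-last zero    f = ℤ.+-comm (f 0) 0ℤ
  ∑ℤ-last (suc n) f = trans (cong (λ s → f 0 ℤ.+ s) (∑ℤ-last n (f ∘ suc)))
    (sym (ℤ.+-assoc (f 0) (∑ℤ n (f ∘ suc)) (f (suc n))))

  ∑ℤ-+ : ∀ n (f g : ℕ → ℤ) → ∑ℤ n (λ k → f k ℤ.+ g k) ≡ ∑ℤ n f ℤ.+ ∑ℤ n g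
  ∑ℤ-+ n f g = ℤΣ.∑-distrib-+ {n} (f ∘ toℕ) (g ∘ toℕ)

  rec₂ : ℕ → ℕ → ℕ
  rec₂ zero    zero    = 1
  rec₂ zero    (suc k) = 0
  rec₂ (suc n) zero    = 0
  rec₂ (suc n) (suc k) = rec₂ n k ℕ.+ suc k ℕ.* rec₂ n (suc k)

  rec₂-vanishes : ∀ n k → n ℕ.< k → rec₂ n k ≡ 0
  rec₂-vanishes zero    (suc k) _ = refl
  rec₂-vanishes (suc n) (suc k) (s≤s n<k)
    rewrite rec₂-vanishes n k n<k | rec₂-vanishes n (suc k) (ℕ.m≤n⇒m≤1+n n<k) = ℕ.*-zeroʳ k

  rec₂-expansion : ∀ n x → x ℤ.^ n ≡ ∑ℤ (suc n) λ k → + rec₂ n k ℤ.* falling x k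
  rec₂-expansion zero    x = refl
  rec₂-expansion (suc n) x = begin
    x ℤ.* x ℤ.^ n
      ≡⟨ cong (x ℤ.*_) (rec₂-expansion n x) ⟩
    x ℤ.* ∑ℤ (suc n) h
      ≡⟨ ℤΣ.*-distribˡ-sum {suc n} x (h ∘ toℕ) ⟩
    ∑ℤ (suc n) (λ k → x ℤ.* h k)
      ≡⟨ ∑ℤ-cong (suc n) (λ k → x ℤ.* h k) (λ k → f k ℤ.+ g k) (λ k → split (s k) x (falling x k) (+ k)) ⟩
    ∑ℤ (suc n) (λ k → f k ℤ.+ g k)
      ≡⟨ ∑ℤ-+ (suc n) f g ⟩
    ∑ℤ (suc n) f ℤ.+ ∑ℤ (suc n) g
      ≡⟨ cong (λ w → ∑ℤ (suc n) f ℤ.+ w) shift ⟩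
    ∑ℤ (suc n) f ℤ.+ ∑ℤ (suc n) (g ∘ suc)
      ≡⟨ ∑ℤ-+ (suc n) f (g ∘ suc) ⟨
    ∑ℤ (suc n) (λ k → f k ℤ.+ g (suc k))
      ≡⟨ ∑ℤ-cong (suc n) (λ k → f k ℤ.+ g (suc k)) h′ merge ⟩
    ∑ℤ (suc n) h′
      ≡⟨ ℤ.+-identityˡ (∑ℤ (suc n) h′) ⟨
    ∑ℤ (suc (suc n)) (λ k → + rec₂ (suc n) k ℤ.* falling x k) ∎
    where
    open ≡-Reasoning
    s h h′ f g : ℕ → ℤ
    s k = + rec₂ n k
    h k = s k ℤ.* falling x k
    h′ k = + rec₂ (suc n) (suc k) ℤ.* falling x (suc k)
    f k = s k ℤ.* falling x (suc k)
    g k = + k ℤ.* s k ℤ.* falling x k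

    split : ∀ a y z c → y ℤ.* (a ℤ.* z) ≡ a ℤ.* (z ℤ.* (y ℤ.- c)) ℤ.+ c ℤ.* a ℤ.* z
    split = solve 4 (λ a y z c → y :* (a :* z) := a :* (z :* (y :- c)) :+ c :* a :* z) refl
      where open +-*-Solver

    shift : ∑ℤ (suc n) g ≡ ∑ℤ (suc n) (g ∘ suc)
    shift = begin
      ∑ℤ (suc n) g                       ≡⟨ ℤ.+-identityʳ (∑ℤ (suc n) g) ⟨
      ∑ℤ (suc n) g ℤ.+ 0ℤ                ≡⟨ cong (λ w → ∑ℤ (suc n) g ℤ.+ w) gₙ₊₁ ⟨
      ∑ℤ (suc n) g ℤ.+ g (suc n)         ≡⟨ ∑ℤ-last (suc n) g ⟨
      g 0 ℤ.+ ∑ℤ (suc n) (g ∘ suc)       ≡⟨ ℤ.+-identityˡ (∑ℤ (suc n) (g ∘ suc)) ⟩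
      ∑ℤ (suc n) (g ∘ suc)               ∎
      where
      gₙ₊₁ : g (suc n) ≡ 0ℤ
      gₙ₊₁ rewrite rec₂-vanishes n (suc n) ℕ.≤-refl | ℕ.*-zeroʳ n = refl

    merge : ∀ k → f k ℤ.+ g (suc k) ≡ + rec₂ (suc n) (suc k) ℤ.* falling x (suc k)
    merge k = begin
      s k ℤ.* z ℤ.+ + suc k ℤ.* s (suc k) ℤ.* z   ≡⟨ ℤ.*-distribʳ-+ z (s k) (+ suc k ℤ.* s (suc k)) ⟨
      (s k ℤ.+ + suc k ℤ.* s (suc k)) ℤ.* z       ≡⟨ cong (λ w → (s k ℤ.+ w) ℤ.* z) (ℤ.pos-* (suc k) (rec₂ n (suc k))) ⟨
      (s k ℤ.+ + (suc k ℕ.* rec₂ n (suc k))) ℤ.* z ∎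
      where z = falling x (suc k)

stirling₂ : Σ (ℕ → ℕ → ℕ) IsStirling₂
stirling₂ = rec₂ , λ n → suc n , rec₂-vanishes n , rec₂-expansion n

S : ℕ → ℕ → ℕ
S = proj₁ stirling₂

S̄ : ℕ → ℕ → ℚ
S̄ n k = ι (+ (k !)) /! n ℚ.* ι (+ S n k)

-- A power series is its sequence of coefficients.
Series : Set
Series = ℕ → ℚ

infixl 7 _⊛_

_⊛_ : Series → Series → Series
(f ⊛ g) n = ∑ℚ (suc n) λ k → f k ℚ.* g (n ∸ k)

one : Series
one zero    = 1ℚ
one (suc n) = 0ℚ

private
  infix 4 _≗_
  _≗_ : Series → Series → Set
  f ≗ g = ∀ n → f n ≡ g n

  _⊕_ : Series → Series → Series
  (f ⊕ g) n = f n ℚ.+ g n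

  _⊙_ : ℚ → Series → Series
  (c ⊙ f) n = c ℚ.* f n

  ⊛-cong-≤ : ∀ f f′ g g′ n → f ≗ f′ → (∀ k → k ℕ.≤ n → g k ≡ g′ k) →
             (f ⊛ g) n ≡ (f′ ⊛ g′) n
  ⊛-cong-≤ f f′ g g′ zero    f≗ g≗ = cong (ℚ._+ 0ℚ) (cong₂ ℚ._*_ (f≗ 0) (g≗ 0 z≤n))
  ⊛-cong-≤ f f′ g g′ (suc n) f≗ g≗ = cong₂ ℚ._+_ (cong₂ ℚ._*_ (f≗ 0) (g≗ (suc n) ℕ.≤-refl))
    (⊛-cong-≤ (f ∘ suc) (f′ ∘ suc) g g′ n (f≗ ∘ suc) (λ k k≤n → g≗ k (ℕ.m≤n⇒m≤1+n k≤n)))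

  ⊛-cong : ∀ {f f′ g g′} → f ≗ f′ → g ≗ g′ → f ⊛ g ≗ f′ ⊛ g′
  ⊛-cong {f} {f′} {g} {g′} f≗ g≗ n = ⊛-cong-≤ f f′ g g′ n f≗ (λ k _ → g≗ k)

  ⊛-distribʳ : ∀ h f g → (f ⊕ g) ⊛ h ≗ (f ⊛ h) ⊕ (g ⊛ h)
  ⊛-distribʳ h f g n = trans
    (ℚΣ.sum-cong-≋ {suc n} (λ k → ℚ.*-distribʳ-+ (h (n ∸ toℕ k)) (f (toℕ k)) (g (toℕ k))))
    (ℚΣ.∑-distrib-+ {suc n} (λ k → f (toℕ k) ℚ.* h (n ∸ toℕ k)) (λ k → g (toℕ k) ℚ.* h (n ∸ toℕ k)))

  ⊛-scale : ∀ c f g → (c ⊙ f) ⊛ g ≗ c ⊙ (f ⊛ g)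
  ⊛-scale c f g n = trans
    (ℚΣ.sum-cong-≋ {suc n} (λ k → ℚ.*-assoc c (f (toℕ k)) (g (n ∸ toℕ k))))
    (sym (ℚΣ.*-distribˡ-sum {suc n} c (λ k → f (toℕ k) ℚ.* g (n ∸ toℕ k))))

  ⊛-assoc : ∀ f g h → (f ⊛ g) ⊛ h ≗ f ⊛ (g ⊛ h)
  ⊛-assoc f g h zero = cong (ℚ._+ 0ℚ) (begin
    (f 0 ℚ.* g 0 ℚ.+ 0ℚ) ℚ.* h 0   ≡⟨ cong (ℚ._* h 0) (ℚ.+-identityʳ (f 0 ℚ.* g 0)) ⟩
    (f 0 ℚ.* g 0) ℚ.* h 0          ≡⟨ ℚ.*-assoc (f 0) (g 0) (h 0) ⟩
    f 0 ℚ.* (g 0 ℚ.* h 0)          ≡⟨ cong (f 0 ℚ.*_) (ℚ.+-identityʳ (g 0 ℚ.* h 0)) ⟨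
    f 0 ℚ.* (g 0 ℚ.* h 0 ℚ.+ 0ℚ)   ∎)
    where open ≡-Reasoning
  ⊛-assoc f g h (suc n) = begin
    (f 0 ℚ.* g 0 ℚ.+ 0ℚ) ℚ.* h (suc n) ℚ.+ (((f 0 ⊙ g′) ⊕ (f′ ⊛ g)) ⊛ h) n
      ≡⟨ cong₂ ℚ._+_ (trans (cong (ℚ._* h (suc n)) (ℚ.+-identityʳ (f 0 ℚ.* g 0))) (ℚ.*-assoc (f 0) (g 0) (h (suc n))))
           (trans (⊛-distribʳ h (f 0 ⊙ g′) (f′ ⊛ g) n)
             (cong₂ ℚ._+_ (⊛-scale (f 0) g′ h n) (⊛-assoc f′ g h n))) ⟩
    f 0 ℚ.* (g 0 ℚ.* h (suc n)) ℚ.+ (f 0 ℚ.* (g′ ⊛ h) n ℚ.+ (f′ ⊛ (g ⊛ h)) n)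
      ≡⟨ ℚ.+-assoc (f 0 ℚ.* (g 0 ℚ.* h (suc n))) (f 0 ℚ.* (g′ ⊛ h) n) ((f′ ⊛ (g ⊛ h)) n) ⟨
    f 0 ℚ.* (g 0 ℚ.* h (suc n)) ℚ.+ f 0 ℚ.* (g′ ⊛ h) n ℚ.+ (f′ ⊛ (g ⊛ h)) n
      ≡⟨ cong (ℚ._+ (f′ ⊛ (g ⊛ h)) n) (ℚ.*-distribˡ-+ (f 0) (g 0 ℚ.* h (suc n)) ((g′ ⊛ h) n)) ⟨
    (f ⊛ (g ⊛ h)) (suc n) ∎
    where
    open ≡-Reasoning
    f′ g′ : Series
    f′ = f ∘ suc
    g′ = g ∘ suc

  ⊛-last : ∀ f g n → (f ⊛ g) (suc n) ≡ (f ⊛ (g ∘ suc)) n ℚ.+ f (suc n) ℚ.* g 0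
  ⊛-last f g zero    = cong₂ ℚ._+_ (sym (ℚ.+-identityʳ (f 0 ℚ.* g 1))) (ℚ.+-identityʳ (f 1 ℚ.* g 0))
  ⊛-last f g (suc n) = trans (cong (f 0 ℚ.* g (suc (suc n)) ℚ.+_) (⊛-last (f ∘ suc) g n))
    (sym (ℚ.+-assoc (f 0 ℚ.* g (suc (suc n))) (((f ∘ suc) ⊛ (g ∘ suc)) n) (f (suc (suc n)) ℚ.* g 0)))

  ⊛-comm : ∀ f g → f ⊛ g ≗ g ⊛ f
  ⊛-comm f g zero    = cong (ℚ._+ 0ℚ) (ℚ.*-comm (f 0) (g 0))
  ⊛-comm f g (suc n) = begin
    f 0 ℚ.* g (suc n) ℚ.+ ((f ∘ suc) ⊛ g) n  ≡⟨ ℚ.+-comm (f 0 ℚ.* g (suc n)) (((f ∘ suc) ⊛ g) n) ⟩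
    ((f ∘ suc) ⊛ g) n ℚ.+ f 0 ℚ.* g (suc n)  ≡⟨ cong₂ ℚ._+_ (⊛-comm (f ∘ suc) g n) (ℚ.*-comm (f 0) (g (suc n))) ⟩
    (g ⊛ (f ∘ suc)) n ℚ.+ g (suc n) ℚ.* f 0  ≡⟨ ⊛-last g f n ⟨
    (g ⊛ f) (suc n)                          ∎
    where open ≡-Reasoning

  ⊛-zeroˡ : ∀ f → (λ _ → 0ℚ) ⊛ f ≗ (λ _ → 0ℚ)
  ⊛-zeroˡ f zero    = cong (ℚ._+ 0ℚ) (ℚ.*-zeroˡ (f 0))
  ⊛-zeroˡ f (suc n) = cong₂ ℚ._+_ (ℚ.*-zeroˡ (f (suc n))) (⊛-zeroˡ f n)

  ⊛-identityˡ : ∀ f → one ⊛ f ≗ f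
  ⊛-identityˡ f zero    = trans (ℚ.+-identityʳ (1ℚ ℚ.* f 0)) (ℚ.*-identityˡ (f 0))
  ⊛-identityˡ f (suc n) = trans (cong₂ ℚ._+_ (ℚ.*-identityˡ (f (suc n))) (⊛-zeroˡ f n)) (ℚ.+-identityʳ (f (suc n)))

ℚ⟦x⟧ : CommutativeRing _ _
ℚ⟦x⟧ = record
  { Carrier = Series
  ; _≈_     = _≗_
  ; _+_     = _⊕_
  ; _*_     = _⊛_
  ; -_      = λ f n → ℚ.- f n
  ; 0#      = λ _ → 0ℚ
  ; 1#      = one
  ; isCommutativeRing = record
    { isRing = record
      { +-isAbelianGroup = Pointwise.isAbelianGroup ℕ ℚ.+-0-isAbelianGroup
      ; *-cong     = ⊛-cong
      ; *-assoc    = ⊛-assoc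
      ; *-identity = ⊛-identityˡ , λ f n → trans (⊛-comm f one n) (⊛-identityˡ f n)
      ; distrib    = (λ h f g n → trans (⊛-comm h (f ⊕ g) n) (trans (⊛-distribʳ h f g n)
                       (cong₂ ℚ._+_ (⊛-comm f h n) (⊛-comm g h n))))
                   , ⊛-distribʳ
      }
    ; *-comm = ⊛-comm
    }
  }

module ℚ⟦x⟧ where
  open CommutativeRing ℚ⟦x⟧ public
  open Exp semiring public

X : Series
X zero    = 0ℚ
X (suc n) = one n

egf : (ℕ → ℚ) → Series
egf a n = a n /! n

exp : ℚ → Series
exp t = egf (t ^_)

-- ∑ₙ bₙxⁿ/n! = xᵐeᵗˣ/(eˣ - 1)ᵐ in ℚ((x)), with the denominator cleared; ℚ⟦x⟧
-- being a domain, this determines b.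
IsBernoulli : ℕ → ℚ → (ℕ → ℚ) → Set
IsBernoulli m t b = egf b * (exp 1ℚ - 1#) ^ˢ m ≈ X ^ˢ m * exp t
  where open ℚ⟦x⟧ renaming (_^_ to _^ˢ_)

module Reciprocal (u : Series) where
  approx : ℕ → Series
  approx zero    = one
  approx (suc n) zero    = 1ℚ
  approx (suc n) (suc k) = ℚ.- (u ⊛ approx n) k

  recip : Series
  recip n = approx n n

  stable : ∀ m n k → k ℕ.≤ m → k ℕ.≤ n → approx m k ≡ approx n k
  stable zero    zero    k       _         _         = refl
  stable zero    (suc n) zero    _         _         = refl
  stable (suc m) zero    zero    _         _         = refl
  stable (suc m) (suc n) zero    _         _         = refl
  stable (suc m) (suc n) (suc k) (s≤s k≤m) (s≤s k≤n) =
    cong ℚ.-_ (⊛-cong-≤ u u (approx m) (approx n) k (λ _ → refl)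
      (λ i i≤k → stable m n i (ℕ.≤-trans i≤k k≤m) (ℕ.≤-trans i≤k k≤n)))

  -- recip = 1/(1 + x u)
  recip-inverse : ∀ f → f 0 ≡ 1ℚ → (∀ n → f (suc n) ≡ u n) → f ⊛ recip ≗ one
  recip-inverse f f₀ f′ zero    = cong (λ c → c ℚ.* 1ℚ ℚ.+ 0ℚ) f₀
  recip-inverse f f₀ f′ (suc n) = begin
    f 0 ℚ.* recip (suc n) ℚ.+ ((f ∘ suc) ⊛ recip) n
      ≡⟨ cong₂ ℚ._+_ (trans (cong (ℚ._* recip (suc n)) f₀) (ℚ.*-identityˡ (recip (suc n))))
           (⊛-cong-≤ (f ∘ suc) u recip (approx n) n f′ (λ k k≤n → stable k n k ℕ.≤-refl k≤n)) ⟩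
    ℚ.- (u ⊛ approx n) n ℚ.+ (u ⊛ approx n) n
      ≡⟨ ℚ.+-inverseˡ ((u ⊛ approx n) n) ⟩
    0ℚ ∎
    where open ≡-Reasoning

module Existence (m : ℕ) (t : ℚ) where
  open ℚ⟦x⟧ using (_≈_; _*_; _-_; 1#; *-congˡ; *-congʳ; *-assoc; *-comm; *-identityʳ; setoid)
    renaming (_^_ to _^ˢ_; ^-congˡ to ^ˢ-congˡ)
  open Mult (CommutativeRing.*-commutativeMonoid ℚ⟦x⟧) using () renaming (×-distrib-+ to ^ˢ-distrib-*)

  D E I : Series
  D = exp 1ℚ - 1#
  E = D ∘ suc
  I = Reciprocal.recip (E ∘ suc)

  E*I : E * I ≈ 1#
  E*I = Reciprocal.recip-inverse (E ∘ suc) E refl (λ _ → refl)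

  D≈X*E : D ≈ X * E
  D≈X*E zero    = sym (trans (ℚ.+-identityʳ (0ℚ ℚ.* E 0)) (ℚ.*-zeroˡ (E 0)))
  D≈X*E (suc n) = sym (trans (cong₂ ℚ._+_ (ℚ.*-zeroˡ (E (suc n))) (⊛-identityˡ E n)) (ℚ.+-identityˡ (E n)))

  I*D : I * D ≈ X
  I*D = begin
    I * D        ≈⟨ *-congˡ {I} {D} {X * E} D≈X*E ⟩
    I * (X * E)  ≈⟨ *-comm I (X * E) ⟩
    (X * E) * I  ≈⟨ *-assoc X E I ⟩
    X * (E * I)  ≈⟨ *-congˡ {X} {E * I} {1#} E*I ⟩
    X * 1#       ≈⟨ *-identityʳ X ⟩
    X            ∎
    where open SetoidReasoning setoid

  b : ℕ → ℚ
  b n = (exp t * I ^ˢ m) n ℚ.* ι (+ (n !))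

  n!*1/n! : ∀ n → ι (+ (n !)) ℚ.* (_/_ 1ℤ (n !) {{n ℕ.!≢0}}) ≡ 1ℚ
  n!*1/n! n = go (n !) {{n ℕ.!≢0}}
    where
    go : ∀ d .{{_ : NonZero d}} → ι (+ d) ℚ.* (1ℤ / d) ≡ 1ℚ
    go d@(suc k) = ℚ.toℚᵘ-injective (begin
      ℚ.toℚᵘ (ι (+ d) ℚ.* (1ℤ / d))
        ≈⟨ ℚ.toℚᵘ-homo-* (ι (+ d)) (1ℤ / d) ⟩
      ℚ.toℚᵘ (ι (+ d)) ℚᵘ.* ℚ.toℚᵘ (1ℤ / d)
        ≈⟨ ℚᵘ.*-cong (ℚ.toℚᵘ-fromℚᵘ (ℚᵘ.mkℚᵘ (+ d) 0)) (ℚ.toℚᵘ-fromℚᵘ (ℚᵘ.mkℚᵘ 1ℤ k)) ⟩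
      ℚᵘ.mkℚᵘ (+ d) 0 ℚᵘ.* ℚᵘ.mkℚᵘ 1ℤ k
        ≈⟨ ℚᵘ.*≡* (cong +_ (solve 1 (λ x → x :* con 1 :* con 1 := con 1 :* (con 1 :* x)) refl d)) ⟩
      ℚᵘ.1ℚᵘ ∎)
      where
      open SetoidReasoning ℚᵘ.≃-setoid
      open ℕSolver.+-*-Solver

  egf-b : egf b ≈ exp t * I ^ˢ m
  egf-b n = trans (ℚ.*-assoc c (ι (+ (n !))) (_/_ 1ℤ (n !) {{n ℕ.!≢0}})) (trans (cong (c ℚ.*_) (n!*1/n! n)) (ℚ.*-identityʳ c))
    where c = (exp t * I ^ˢ m) n

  isBernoulli : IsBernoulli m t b
  isBernoulli = begin
    egf b * D ^ˢ m              ≈⟨ *-congʳ {D ^ˢ m} {egf b} {exp t * I ^ˢ m} egf-b ⟩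
    (exp t * I ^ˢ m) * D ^ˢ m   ≈⟨ *-assoc (exp t) (I ^ˢ m) (D ^ˢ m) ⟩
    exp t * (I ^ˢ m * D ^ˢ m)   ≈⟨ *-congˡ {exp t} {(I * D) ^ˢ m} {I ^ˢ m * D ^ˢ m} (^ˢ-distrib-* I D m) ⟨
    exp t * (I * D) ^ˢ m        ≈⟨ *-congˡ {exp t} {(I * D) ^ˢ m} {X ^ˢ m} (^ˢ-congˡ m {I * D} {X} I*D) ⟩
    exp t * X ^ˢ m              ≈⟨ *-comm (exp t) (X ^ˢ m) ⟩
    X ^ˢ m * exp t              ∎
    where open SetoidReasoning setoid

bernoulli : ∀ m t → Σ (ℕ → ℚ) (IsBernoulli m t)
bernoulli m t = Existence.b m t , Existence.isBernoulli m t

-- B⟨ m ⟩ n t is Bₙ⁽ᵐ⁾(t), a polynomial represented by its values.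
B⟨_⟩ : ℕ → ℕ → ℚ → ℚ
B⟨ m ⟩ n t = proj₁ (bernoulli m t) n

B : ℕ → ℚ → ℚ
B = B⟨ 1 ⟩

module Fleck (p : ℕ) {{pr : Prime p}} where

  private
    pos⇒-nonZero : ∀ q → ℚ.Positive q → ℚ.NonZero (ℚ.- q)
    pos⇒-nonZero (mkℚ (+ suc _) _ _) _ = _

    neg≢0 : ∀ n .{{_ : NonZero n}} → ℚ.NonZero (ι (ℤ.- + n))
    neg≢0 (suc n) = pos⇒-nonZero (ℚ.normalize (suc n) 1) (ℚ.normalize-pos (suc n) 1)

  instance
    p≢0 : NonZero p
    p≢0 = prime⇒nonZero pr

    p-1≢0 : NonZero (p ∸ 1)
    p-1≢0 = ℕ.>-nonZero (ℕ.m<n⇒0<n∸m (ℕ.nonTrivial⇒n>1 p {{prime⇒nonTrivial pr}}))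

    -p≢0 : ℚ.NonZero (ι (ℤ.- + p))
    -p≢0 = neg≢0 p

  Cₚ : ℕ → ℤ → ℤ
  Cₚ n r = ∑ℤ (suc n) λ k → ⟦ + p ∣? (+ k ℤ.- r) ⟧ ℤ.* (+ (n C k) ℤ.* -1ℤ ℤ.^ k)

  -- _/ℕ_ rounds towards -∞, so the exponent is +1 when n = 0.
  F : ℕ → ℤ → ℚ
  F n r = ι (ℤ.- + p) ^ᶻ (ℤ.- ((+ n ℤ.- 1ℤ) /ℕ (p ∸ 1))) ℚ.* ι (Cₚ n r) ℚ.+ ι ⟦ n ℕ.≟ 0 ⟧

  infix 25 _⋆

  -- The least nonnegative residue of -n modulo p - 1.
  _⋆ : ℕ → ℕ
  n ⋆ = (ℤ.- + n) %ℕ (p ∸ 1)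

{-# OPTIONS --safe #-}
module Submission where

-- Let δ(r) = [p ∣ r], (∇f)(r) = f(r-1) - f(r), N = p - 1 and E = (eˣ - 1)/x. Then
-- (-1)ⁿCₚ(n,r) = (∇ⁿδ)(r), while ∇ multiplies r ↦ e⁻ʳˣ by eˣ - 1. Everything
-- follows from the congruence, for n = 1 + b + aN with b < N (so that n⋆ = N - 1 - b),
--
--     (∇ⁿδ)(r) ≡ (-p)ᵃ [xⁿ⋆] e⁻ʳˣEⁿ   (mod pᵃ⁺¹),
--
-- together with Eᵖ ≡ 1 (mod p) in degrees below N, which allows the exponent of E to be
-- reduced modulo p and to become negative.
--
-- For a = 0, Fermat and Wilson show that δ differs from φ(r) = [xᴺ] e⁻ʳˣ by a constant
-- modulo p, and ∇ kills constants. For the step from n to n + N, write the weights of ∇ᴺ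
-- as 1 - p h(k). The p-periodicity of δ gives ∇ⁿ⁺ᴺδ = -p T(∇ⁿδ), where
-- (Tf)(r) = ∑ h(k) f(r-k); and since ∇ᴺ annihilates [xʲ] e⁻ʳˣEⁿ for j < N, the operator T
-- acts there as multiplication by (eᵖˣ - 1)/(pxE), which is 1/E ≡ Eᴺ modulo p.

open import Defs
open import Algebra.Bundles using (CommutativeRing; CommutativeSemiring)
import Algebra.Properties.CommutativeSemiring.Binomial as Binomial
import Algebra.Properties.CommutativeSemiring.Exp as CExp
import Algebra.Properties.Semiring.Exp as Exp
import Algebra.Properties.Semiring.Mult as Mult
import Algebra.Properties.Semiring.Sum as Sum
import Algebra.Solver.Ring.NaturalCoefficients.Default as SeriesSolver
open import Data.Empty using (⊥-elim)
open import Data.Fin.Base as Fin using (Fin; toℕ; inject₁; fromℕ)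
import Data.Fin.Properties as Fin
open import Data.Integer.Base as ℤ using (ℤ; +_; -[1+_]; 0ℤ; 1ℤ; -1ℤ)
open import Data.Integer.DivMod using (_%ℕ_; _/ℕ_; n%ℕd<d)
open import Data.Integer.Divisibility.Signed as ℤ∣ using (_∣?_) renaming (_∣_ to _∣ℤ_)
import Data.Integer.Properties as ℤ
import Data.Integer.Solver as ℤSolver
open import Data.Nat.Base as ℕ using (ℕ; zero; suc; _∸_; _%_; _!; NonZero; z≤n; s≤s)
open import Data.Nat.Combinatorics using (_C_; nCk+nC[k+1]≡[n+1]C[k+1]; k>n⇒nCk≡0; nCn≡1; nCk≡n!/k![n-k]!; k![n∸k]!∣n!)
open import Data.Nat.Coprimality using () renaming (recompute to coprime-recompute)
import Data.Nat.DivMod as ℕ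
open import Data.Nat.Divisibility as ∣ using (_∣_)
open import Data.Nat.Primality using (Prime; euclidsLemma; prime⇒nonZero; prime⇒nonTrivial; ¬prime[1])
import Data.Nat.Properties as ℕ
open import Data.Product.Base using (∃; _×_; _,_; proj₁; proj₂)
open import Data.Rational.Base as ℚ using (ℚ; mkℚ; 0ℚ; 1ℚ; _+_; _*_; -_; _-_; _/_; 1/_)
import Data.Rational.Properties as ℚ
open import Data.Rational.Solver using (module +-*-Solver)
import Data.Rational.Unnormalised.Base as ℚᵘ
import Data.Rational.Unnormalised.Properties as ℚᵘ
open import Data.Sum.Base using (inj₁; inj₂)
open import Function.Base using (_∘_)
open import Relation.Binary.PropositionalEquality
import Relation.Binary.Reasoning.Setoid as SetoidReasoning
open import Relation.Nullary using (¬_; Dec; yes; no)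

open import Algebra.Properties.Group ℚ.+-0-group using (inverseˡ-unique)
open +-*-Solver using (solve; _:=_; _:+_; _:*_; _:-_; :-_; con)
open ℚ⟦x⟧ using (_≈_; 1#)
  renaming (_+_ to infixl 6 _+ˢ_; _-_ to infixl 6 _-ˢ_; _^_ to infixr 8 _^ˢ_)

private
  module ℚΣ = Sum (CommutativeRing.semiring ℚ.+-*-commutativeRing)
  module ℚ^ = CExp (CommutativeRing.commutativeSemiring ℚ.+-*-commutativeRing)
  module ℚ⟦x⟧^ = CExp ℚ⟦x⟧.commutativeSemiring
  module RS = SeriesSolver ℚ⟦x⟧.commutativeSemiring
  module R = SetoidReasoning ℚ⟦x⟧.setoid
  module Z = ℤSolver.+-*-Solver

-- Integers and finite sums in ℚ

-- The induction loses no precision because ∇ⁿ⁺ᴺδ = -p T(∇ⁿδ) is an exact identity and the weights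
-- h(k) lie in ℤ₍ₚ₎: an error in pᵃ⁺¹ℤ₍ₚ₎ turns into one in pᵃ⁺²ℤ₍ₚ₎. The identity requires n ≥ 1,
-- since the sum of ∇ⁿδ over a period telescopes to 0 only if the summand is itself a difference; so
-- n = 0 is treated apart. The restriction to degrees below N comes from the coefficient 1/p! of xᴺ
-- in E; it does no harm because n⋆ < N. All right-hand sides are readings of the single coefficient
-- [xⁿ⋆] e⁻ʳˣEⁿ. The coefficients of Eᵏ are the normalized Stirling numbers S̄(j + k, k), and eᵗˣE⁻ᵐ
-- generates B_j⁽ᵐ⁾(t)/j!. Reducing the exponent n to its residue modulo p gives the former,
-- replacing it by -m ≡ n gives the latter.

toℚᵘ-ι : ∀ z → ℚ.toℚᵘ (ι z) ℚᵘ.≃ ℚᵘ.mkℚᵘ z 0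
toℚᵘ-ι z = ℚ.toℚᵘ-fromℚᵘ (ℚᵘ.mkℚᵘ z 0)

ι-+ : ∀ x y → ι (x ℤ.+ y) ≡ ι x + ι y
ι-+ x y = ℚ.toℚᵘ-injective (begin
  ℚ.toℚᵘ (ι (x ℤ.+ y))              ≈⟨ toℚᵘ-ι (x ℤ.+ y) ⟩
  ℚᵘ.mkℚᵘ (x ℤ.+ y) 0               ≈⟨ ℚᵘ.*≡* (cong (ℤ._* 1ℤ) (sym (cong₂ ℤ._+_ (ℤ.*-identityʳ x) (ℤ.*-identityʳ y)))) ⟩
  ℚᵘ.mkℚᵘ x 0 ℚᵘ.+ ℚᵘ.mkℚᵘ y 0      ≈⟨ ℚᵘ.+-cong (toℚᵘ-ι x) (toℚᵘ-ι y) ⟨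
  ℚ.toℚᵘ (ι x) ℚᵘ.+ ℚ.toℚᵘ (ι y)    ≈⟨ ℚ.toℚᵘ-homo-+ (ι x) (ι y) ⟨
  ℚ.toℚᵘ (ι x + ι y)                ∎)
  where open SetoidReasoning ℚᵘ.≃-setoid

ι-* : ∀ x y → ι (x ℤ.* y) ≡ ι x * ι y
ι-* x y = ℚ.toℚᵘ-injective (begin
  ℚ.toℚᵘ (ι (x ℤ.* y))              ≈⟨ toℚᵘ-ι (x ℤ.* y) ⟩
  ℚᵘ.mkℚᵘ x 0 ℚᵘ.* ℚᵘ.mkℚᵘ y 0      ≈⟨ ℚᵘ.*-cong (toℚᵘ-ι x) (toℚᵘ-ι y) ⟨
  ℚ.toℚᵘ (ι x) ℚᵘ.* ℚ.toℚᵘ (ι y)    ≈⟨ ℚ.toℚᵘ-homo-* (ι x) (ι y) ⟨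
  ℚ.toℚᵘ (ι x * ι y)                ∎)
  where open SetoidReasoning ℚᵘ.≃-setoid

ι-neg : ∀ x → ι (ℤ.- x) ≡ - ι x
ι-neg x = inverseˡ-unique (ι (ℤ.- x)) (ι x) (trans (sym (ι-+ (ℤ.- x) x)) (cong ι (ℤ.+-inverseˡ x)))

ι-injective : ∀ {x y} → ι x ≡ ι y → x ≡ y
ι-injective {x} {y} eq with ℚᵘ.≃-trans (ℚᵘ.≃-sym (toℚᵘ-ι x)) (ℚᵘ.≃-trans (ℚᵘ.≃-reflexive (cong ℚ.toℚᵘ eq)) (toℚᵘ-ι y))
... | ℚᵘ.*≡* e = trans (sym (ℤ.*-identityʳ x)) (trans e (ℤ.*-identityʳ y))

ι-^ : ∀ x n → ι (x ℤ.^ n) ≡ ι x ^ n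
ι-^ x zero    = refl
ι-^ x (suc n) = trans (ι-* x (x ℤ.^ n)) (cong (ι x *_) (ι-^ x n))

ι-suc : ∀ n → ι (+ suc n) ≡ 1ℚ + ι (+ n)
ι-suc n = ι-+ 1ℤ (+ n)

∑-cong : ∀ n {f g : ℕ → ℚ} → (∀ k → k ℕ.< n → f k ≡ g k) → ∑ℚ n f ≡ ∑ℚ n g
∑-cong zero    f≡g = refl
∑-cong (suc n) f≡g = cong₂ _+_ (f≡g 0 ℕ.z<s) (∑-cong n (λ k k<n → f≡g (suc k) (ℕ.s<s k<n)))

∑-+ : ∀ n (f g : ℕ → ℚ) → ∑ℚ n (λ k → f k + g k) ≡ ∑ℚ n f + ∑ℚ n g
∑-+ n f g = ℚΣ.∑-distrib-+ {n} (f ∘ toℕ) (g ∘ toℕ)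

∑-* : ∀ n c (f : ℕ → ℚ) → c * ∑ℚ n f ≡ ∑ℚ n (λ k → c * f k)
∑-* n c f = ℚΣ.*-distribˡ-sum {n} c (f ∘ toℕ)

∑-last : ∀ n (f : ℕ → ℚ) → ∑ℚ (suc n) f ≡ ∑ℚ n f + f n
∑-last zero    f = ℚ.+-comm (f 0) 0ℚ
∑-last (suc n) f = trans (cong (_+_ (f 0)) (∑-last n (f ∘ suc)))
  (sym (ℚ.+-assoc (f 0) (∑ℚ n (f ∘ suc)) (f (suc n))))

ι-∑ : ∀ n (f : ℕ → ℤ) → ι (∑ℤ n f) ≡ ∑ℚ n (ι ∘ f)
ι-∑ zero    f = refl
ι-∑ (suc n) f = trans (ι-+ (f 0) (∑ℤ n (f ∘ suc))) (cong (_+_ (ι (f 0))) (ι-∑ n (f ∘ suc)))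

1/!-inverse : ∀ n → ι (+ (n !)) * (1ℚ /! n) ≡ 1ℚ
1/!-inverse n = trans (cong (ι (+ (n !)) *_) (ℚ.*-identityˡ _)) (Existence.n!*1/n! 0 0ℚ n)

-- Finite differences

abstract
  -- The coefficient of Sᵏ in (S - 1)ⁿ, where (Sf)(r) = f(r - 1), so that ∇ = S - 1.
  w : ℕ → ℕ → ℤ
  w n k = -1ℤ ℤ.^ n ℤ.* (+ (n C k) ℤ.* -1ℤ ℤ.^ k)

  w-def : ∀ n k → w n k ≡ -1ℤ ℤ.^ n ℤ.* (+ (n C k) ℤ.* -1ℤ ℤ.^ k)
  w-def n k = refl

  w-zero-zero : w 0 0 ≡ 1ℤ
  w-zero-zero = refl

  w-zero : ∀ n → w (suc n) 0 ≡ ℤ.- w n 0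
  w-zero n = Z.solve 2 (λ a b → (Z.con -1ℤ Z.:* a) Z.:* (Z.con 1ℤ Z.:* Z.con 1ℤ) Z.:= Z.:- (a Z.:* (Z.con 1ℤ Z.:* Z.con 1ℤ))) refl (-1ℤ ℤ.^ n) 0ℤ

  w-suc : ∀ n k → w (suc n) (suc k) ≡ w n k ℤ.- w n (suc k)
  w-suc n k = trans
    (cong (λ c → -1ℤ ℤ.* s ℤ.* (+ c ℤ.* (-1ℤ ℤ.* t))) (sym (nCk+nC[k+1]≡[n+1]C[k+1] n k)))
    (Z.solve 4 (λ s t a b → (Z.con -1ℤ Z.:* s) Z.:* ((a Z.:+ b) Z.:* (Z.con -1ℤ Z.:* t))
        Z.:= s Z.:* (a Z.:* t) Z.:- s Z.:* (b Z.:* (Z.con -1ℤ Z.:* t))) refl s t (+ (n C k)) (+ (n C suc k)))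
    where
    s t : ℤ
    s = -1ℤ ℤ.^ n
    t = -1ℤ ℤ.^ k

  w-vanishes : ∀ n → w n (suc n) ≡ 0ℤ
  w-vanishes n rewrite k>n⇒nCk≡0 (ℕ.n<1+n n) = ℤ.*-zeroʳ (-1ℤ ℤ.^ n)

∇ : (ℤ → ℚ) → ℤ → ℚ
∇ f r = f (r ℤ.- 1ℤ) - f r

∇^ : ℕ → (ℤ → ℚ) → ℤ → ℚ
∇^ zero    f = f
∇^ (suc n) f = ∇ (∇^ n f)

∇^-+ : ∀ m n f r → ∇^ (m ℕ.+ n) f r ≡ ∇^ m (∇^ n f) r
∇^-+ zero    n f r = refl
∇^-+ (suc m) n f r = cong₂ _-_ (∇^-+ m n f (r ℤ.- 1ℤ)) (∇^-+ m n f r)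

shift-suc : ∀ r k → r ℤ.- 1ℤ ℤ.- + k ≡ r ℤ.- + suc k
shift-suc r k = Z.solve 2 (λ r k → r Z.:- Z.con 1ℤ Z.:- k Z.:= r Z.:- (Z.con 1ℤ Z.:+ k)) refl r (+ k)

∇^-expansion : ∀ n f r → ∇^ n f r ≡ ∑ℚ (suc n) λ k → ι (w n k) * f (r ℤ.- + k)
∇^-expansion zero f r = sym (trans (ℚ.+-identityʳ (ι (w 0 0) * f (r ℤ.- 0ℤ)))
  (trans (cong₂ (λ c s → ι c * f s) w-zero-zero (ℤ.+-identityʳ r)) (ℚ.*-identityˡ (f r))))
∇^-expansion (suc n) f r = begin
  ∇^ n f (r ℤ.- 1ℤ) - ∇^ n f r
    ≡⟨ cong₂ _-_ (∇^-expansion n f (r ℤ.- 1ℤ)) (∇^-expansion n f r) ⟩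
  ∑ℚ (suc n) (λ k → ι (w n k) * f (r ℤ.- 1ℤ ℤ.- + k)) - ∑ℚ (suc n) a
    ≡⟨ cong₂ _-_ (∑-cong (suc n) (λ k _ → cong (λ x → ι (w n k) * f x) (shift-suc r k))) extend ⟩
  ∑ℚ (suc n) b - (a 0 + ∑ℚ (suc n) (a ∘ suc))
    ≡⟨ solve 3 (λ x y z → x :- (y :+ z) := :- y :+ (x :+ con (- 1ℚ) :* z)) refl (∑ℚ (suc n) b) (a 0) (∑ℚ (suc n) (a ∘ suc)) ⟩
  - a 0 + (∑ℚ (suc n) b + - 1ℚ * ∑ℚ (suc n) (a ∘ suc))
    ≡⟨ cong₂ _+_ head (trans (cong (_+_ (∑ℚ (suc n) b)) (∑-* (suc n) (- 1ℚ) (a ∘ suc))) (sym (∑-+ (suc n) b (λ k → - 1ℚ * a (suc k))))) ⟩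
  c 0 + ∑ℚ (suc n) (λ k → b k + - 1ℚ * a (suc k))
    ≡⟨ cong (_+_ (c 0)) (∑-cong (suc n) (λ k _ → step k)) ⟩
  ∑ℚ (suc (suc n)) c ∎
  where
  open ≡-Reasoning
  a b c : ℕ → ℚ
  a k = ι (w n k) * f (r ℤ.- + k)
  b k = ι (w n k) * f (r ℤ.- + suc k)
  c k = ι (w (suc n) k) * f (r ℤ.- + k)

  -- Since `w n (suc n)` is 0, a term may be appended; splitting off the first one then aligns the
  -- sum with `b`, and `w-suc` merges the two.
  extend : ∑ℚ (suc n) a ≡ ∑ℚ (suc (suc n)) a
  extend = sym (trans (∑-last (suc n) a)
    (trans (cong (λ z → ∑ℚ (suc n) a + ι z * f (r ℤ.- + suc n)) (w-vanishes n))
      (trans (cong (_+_ (∑ℚ (suc n) a)) (ℚ.*-zeroˡ (f (r ℤ.- + suc n)))) (ℚ.+-identityʳ _))))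

  head : - a 0 ≡ c 0
  head = trans (ℚ.neg-distribˡ-* (ι (w n 0)) (f (r ℤ.- 0ℤ))) (cong (_* f (r ℤ.- 0ℤ)) (trans (sym (ι-neg (w n 0))) (cong ι (sym (w-zero n)))))

  step : ∀ k → b k + - 1ℚ * a (suc k) ≡ c (suc k)
  step k = trans
    (solve 3 (λ x y z → x :* z :+ con (- 1ℚ) :* (y :* z) := (x :- y) :* z) refl (ι (w n k)) (ι (w n (suc k))) (f (r ℤ.- + suc k)))
    (cong (_* f (r ℤ.- + suc k)) (sym (trans (cong ι (w-suc n k)) (trans (ι-+ (w n k) (ℤ.- w n (suc k))) (cong (_+_ (ι (w n k))) (ι-neg (w n (suc k))))))))

-- Telescoping. Over p steps the result is 0 for a p-periodic `f`, and multiplication by eᵖˣ - 1 for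
-- r ↦ e⁻ʳˣ.
∑-∇ : ∀ n f r → ∑ℚ n (λ k → ∇ f (r ℤ.- + k)) ≡ f (r ℤ.- + n) - f r
∑-∇ zero    f r = sym (trans (cong (_- f r) (cong f (ℤ.+-identityʳ r))) (ℚ.+-inverseʳ (f r)))
∑-∇ (suc n) f r = begin
  ∑ℚ (suc n) (λ k → ∇ f (r ℤ.- + k))
    ≡⟨ ∑-last n (λ k → ∇ f (r ℤ.- + k)) ⟩
  ∑ℚ n (λ k → ∇ f (r ℤ.- + k)) + (f (r ℤ.- + n ℤ.- 1ℤ) - f (r ℤ.- + n))
    ≡⟨ cong₂ (λ x y → x + (f y - f (r ℤ.- + n))) (∑-∇ n f r) shift ⟩
  (f (r ℤ.- + n) - f r) + (f (r ℤ.- + suc n) - f (r ℤ.- + n))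
    ≡⟨ solve 3 (λ x y z → x :- y :+ (z :- x) := z :- y) refl (f (r ℤ.- + n)) (f r) (f (r ℤ.- + suc n)) ⟩
  f (r ℤ.- + suc n) - f r ∎
  where
  open ≡-Reasoning
  shift : r ℤ.- + n ℤ.- 1ℤ ≡ r ℤ.- + suc n
  shift = Z.solve 2 (λ r k → r Z.:- k Z.:- Z.con 1ℤ Z.:= r Z.:- (Z.con 1ℤ Z.:+ k)) refl r (+ n)

∇^-shift-invariant : ∀ s f → (∀ r → f (r ℤ.- s) ≡ f r) → ∀ n r → ∇^ n f (r ℤ.- s) ≡ ∇^ n f r
∇^-shift-invariant s f inv zero    r = inv r
∇^-shift-invariant s f inv (suc n) r = cong₂ _-_
  (trans (cong (∇^ n f) swap) (∇^-shift-invariant s f inv n (r ℤ.- 1ℤ)))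
  (∇^-shift-invariant s f inv n r)
  where
  swap : r ℤ.- s ℤ.- 1ℤ ≡ r ℤ.- 1ℤ ℤ.- s
  swap = Z.solve 2 (λ r s → r Z.:- s Z.:- Z.con 1ℤ Z.:= r Z.:- Z.con 1ℤ Z.:- s) refl r s

neg-mulˡ : ∀ x → - x ≡ - 1ℚ * x
neg-mulˡ = solve 1 (λ x → :- x := con (- 1ℚ) :* x) refl

-- Arithmetic modulo powers of p

module Local (p : ℕ) (pr : Prime p) where

  -- Any denominator prime to p serves as a witness, reduced or not, so closure under ring
  -- operations involves no gcd.
  record Integral (q : ℚ) : Set where
    constructor integral
    field
      den num : ℤ
      p∤den   : ¬ p ∣ ℤ.∣ den ∣
      den*q   : ι den * q ≡ ι num

  p∤1 : ¬ p ∣ 1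
  p∤1 p∣1 = ¬prime[1] (subst Prime (∣.∣1⇒≡1 p∣1) pr)

  p∤* : ∀ {m n} → ¬ p ∣ ℤ.∣ m ∣ → ¬ p ∣ ℤ.∣ n ∣ → ¬ p ∣ ℤ.∣ m ℤ.* n ∣
  p∤* {m} {n} p∤m p∤n p∣mn with euclidsLemma ℤ.∣ m ∣ ℤ.∣ n ∣ pr (subst (p ∣_) (ℤ.abs-* m n) p∣mn)
  ... | inj₁ p∣m = p∤m p∣m
  ... | inj₂ p∣n = p∤n p∣n

  p∤n! : ∀ n → n ℕ.< p → ¬ p ∣ n !
  p∤n! zero    _   = p∤1
  p∤n! (suc n) n<p p∣n! with euclidsLemma (suc n) (n !) pr p∣n!
  ... | inj₁ p∣n   = ℕ.<⇒≱ n<p (∣.∣⇒≤ p∣n)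
  ... | inj₂ p∣n!′ = p∤n! n (ℕ.<-trans (ℕ.n<1+n n) n<p) p∣n!′

  -- From dn = zD, a factor p of the reduced denominator D would divide dn, hence n, against
  -- coprimality.
  Integral⇒∈ℤ₍₎ : ∀ {q} → Integral q → q ∈ℤ₍ p ₎
  Integral⇒∈ℤ₍₎ {mkℚ n d-1 cop} (integral d z p∤d eq) p∣D = go (euclidsLemma ℤ.∣ d ∣ ℤ.∣ n ∣ pr p∣dn)
    where
    cross : d ℤ.* n ℤ.* 1ℤ ≡ z ℤ.* + suc d-1
    cross with ℚᵘ.≃-trans (ℚᵘ.≃-sym (ℚᵘ.≃-trans (ℚ.toℚᵘ-homo-* (ι d) (mkℚ n d-1 cop)) (ℚᵘ.*-cong (toℚᵘ-ι d) ℚᵘ.≃-refl)))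
                 (ℚᵘ.≃-trans (ℚᵘ.≃-reflexive (cong ℚ.toℚᵘ eq)) (toℚᵘ-ι z))
    ... | ℚᵘ.*≡* e = trans e (cong (λ k → z ℤ.* + suc k) (ℕ.+-identityʳ d-1))
    p∣dn : p ∣ ℤ.∣ d ∣ ℕ.* ℤ.∣ n ∣
    p∣dn = subst (p ∣_) (trans (sym (ℤ.abs-* z (+ suc d-1))) (trans (cong ℤ.∣_∣ (trans (sym cross) (ℤ.*-identityʳ (d ℤ.* n)))) (ℤ.abs-* d n)))
      (∣.∣n⇒∣m*n ℤ.∣ z ∣ p∣D)
    go : _ → _
    go (inj₁ p∣d) = p∤d p∣d
    go (inj₂ p∣n) = p∤1 (subst (p ∣_) (coprime-recompute cop (p∣n , p∣D)) ∣.∣-refl)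

  π : ℚ
  π = ι (+ p)

  integral-ι : ∀ z → Integral (ι z)
  integral-ι z = integral 1ℤ z p∤1 (ℚ.*-identityˡ (ι z))

  integral-+ : ∀ {x y} → Integral x → Integral y → Integral (x + y)
  integral-+ {x} {y} (integral d z p∤d eq) (integral d′ z′ p∤d′ eq′) = integral (d ℤ.* d′) (d′ ℤ.* z ℤ.+ d ℤ.* z′) (p∤* {d} {d′} p∤d p∤d′) (begin
    ι (d ℤ.* d′) * (x + y)                    ≡⟨ cong (_* (x + y)) (ι-* d d′) ⟩
    ι d * ι d′ * (x + y)                      ≡⟨ solve 4 (λ d e x y → d :* e :* (x :+ y) := e :* (d :* x) :+ d :* (e :* y)) refl (ι d) (ι d′) x y ⟩
    ι d′ * (ι d * x) + ι d * (ι d′ * y)       ≡⟨ cong₂ (λ a b → ι d′ * a + ι d * b) eq eq′ ⟩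
    ι d′ * ι z + ι d * ι z′                   ≡⟨ cong₂ _+_ (ι-* d′ z) (ι-* d z′) ⟨
    ι (d′ ℤ.* z) + ι (d ℤ.* z′)               ≡⟨ ι-+ (d′ ℤ.* z) (d ℤ.* z′) ⟨
    ι (d′ ℤ.* z ℤ.+ d ℤ.* z′)                 ∎)
    where open ≡-Reasoning

  integral-* : ∀ {x y} → Integral x → Integral y → Integral (x * y)
  integral-* {x} {y} (integral d z p∤d eq) (integral d′ z′ p∤d′ eq′) = integral (d ℤ.* d′) (z ℤ.* z′) (p∤* {d} {d′} p∤d p∤d′) (begin
    ι (d ℤ.* d′) * (x * y)        ≡⟨ cong (_* (x * y)) (ι-* d d′) ⟩
    ι d * ι d′ * (x * y)          ≡⟨ solve 4 (λ d e x y → d :* e :* (x :* y) := d :* x :* (e :* y)) refl (ι d) (ι d′) x y ⟩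
    ι d * x * (ι d′ * y)          ≡⟨ cong₂ _*_ eq eq′ ⟩
    ι z * ι z′                    ≡⟨ ι-* z z′ ⟨
    ι (z ℤ.* z′)                  ∎)
    where open ≡-Reasoning

  integral-neg : ∀ {x} → Integral x → Integral (- x)
  integral-neg {x} x∈ = subst Integral (sym (neg-mulˡ x)) (integral-* (integral-ι -1ℤ) x∈)

  integral-^ : ∀ {x} n → Integral x → Integral (x ^ n)
  integral-^ zero    x∈ = integral-ι 1ℤ
  integral-^ (suc n) x∈ = integral-* x∈ (integral-^ n x∈)

  integral-∑ : ∀ n {f} → (∀ k → k ℕ.< n → Integral (f k)) → Integral (∑ℚ n f)
  integral-∑ zero    f∈ = integral-ι 0ℤ
  integral-∑ (suc n) f∈ = integral-+ (f∈ 0 ℕ.z<s) (integral-∑ n (λ k k<n → f∈ (suc k) (ℕ.s<s k<n)))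

  integral-1/! : ∀ n → n ℕ.< p → Integral (1ℚ /! n)
  integral-1/! n n<p = integral (+ (n !)) 1ℤ (p∤n! n n<p) (1/!-inverse n)

  ι-inverse : ∀ d → ¬ p ∣ ℤ.∣ d ∣ → ∃ λ u → Integral u × ι d * u ≡ 1ℚ
  ι-inverse d p∤d = 1/ ι d , integral d 1ℤ p∤d (ℚ.*-inverseʳ (ι d)) , ℚ.*-inverseʳ (ι d)
    where
    instance
      ιd≢0 : ℚ.NonZero (ι d)
      ιd≢0 = ℚ.≢-nonZero (λ ιd≡0 → p∤d (subst (λ z → p ∣ ℤ.∣ z ∣) (sym (ι-injective {d} {0ℤ} ιd≡0)) (p ∣.∣0)))

  -- The ideal pᵇℤ₍ₚ₎. Congruences are carried as `𝔭 b (x - y)`, so each argument by congruence is a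
  -- ring identity that writes the difference as a combination of members.
  record 𝔭 (b : ℕ) (q : ℚ) : Set where
    constructor multiple
    field
      {quotient} : ℚ
      quotient∈  : Integral quotient
      equality   : q ≡ π ^ b * quotient

  𝔭⇒≡ : ∀ {b} x y → 𝔭 b (x - y) → x ≡ y [mod p ^ b ]
  𝔭⇒≡ x y (multiple z∈ eq) = _ , Integral⇒∈ℤ₍₎ z∈ , eq

  𝔭-0 : ∀ {b} → 𝔭 b 0ℚ
  𝔭-0 {b} = multiple (integral-ι 0ℤ) (sym (ℚ.*-zeroʳ (π ^ b)))

  𝔭-≡ : ∀ {b x y} → x ≡ y → 𝔭 b (x - y)
  𝔭-≡ {b} {x} refl = subst (𝔭 b) (sym (ℚ.+-inverseʳ x)) 𝔭-0

  𝔭-+ : ∀ {b x y} → 𝔭 b x → 𝔭 b y → 𝔭 b (x + y)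
  𝔭-+ {b} (multiple {z} z∈ eq) (multiple {z′} z′∈ eq′) =
    multiple (integral-+ z∈ z′∈) (trans (cong₂ _+_ eq eq′) (sym (ℚ.*-distribˡ-+ (π ^ b) z z′)))

  𝔭-* : ∀ {b x y} → Integral x → 𝔭 b y → 𝔭 b (x * y)
  𝔭-* {b} {x} x∈ (multiple {z} z∈ eq) = multiple (integral-* x∈ z∈)
    (trans (cong (x *_) eq) (solve 3 (λ a b c → a :* (b :* c) := b :* (a :* c)) refl x (π ^ b) z))

  𝔭-neg : ∀ {b x} → 𝔭 b x → 𝔭 b (- x)
  𝔭-neg {b} {x} x∈ = subst (𝔭 b) (sym (neg-mulˡ x)) (𝔭-* (integral-ι -1ℤ) x∈)

  𝔭-- : ∀ {b x y} → 𝔭 b x → 𝔭 b y → 𝔭 b (x - y)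
  𝔭-- x∈ y∈ = 𝔭-+ x∈ (𝔭-neg y∈)

  𝔭-sym : ∀ {b} x y → 𝔭 b (x - y) → 𝔭 b (y - x)
  𝔭-sym {b} x y h = subst (𝔭 b) (solve 2 (λ x y → :- (x :- y) := y :- x) refl x y) (𝔭-neg h)

  𝔭-trans : ∀ {b} x y z → 𝔭 b (x - y) → 𝔭 b (y - z) → 𝔭 b (x - z)
  𝔭-trans {b} x y z h h′ = subst (𝔭 b) (solve 3 (λ x y z → x :- y :+ (y :- z) := x :- z) refl x y z) (𝔭-+ h h′)

  𝔭-∑ : ∀ {b} n {f} → (∀ k → k ℕ.< n → 𝔭 b (f k)) → 𝔭 b (∑ℚ n f)
  𝔭-∑ zero    f∈ = 𝔭-0
  𝔭-∑ (suc n) f∈ = 𝔭-+ (f∈ 0 ℕ.z<s) (𝔭-∑ n (λ k k<n → f∈ (suc k) (ℕ.s<s k<n)))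

  𝔭-π : ∀ {b x} → 𝔭 b x → 𝔭 (suc b) (π * x)
  𝔭-π {b} (multiple {z} z∈ eq) = multiple z∈ (trans (cong (π *_) eq) (sym (ℚ.*-assoc π (π ^ b) z)))

  𝔭⇒integral : ∀ {b x} → 𝔭 b x → Integral x
  𝔭⇒integral {b} (multiple z∈ eq) = subst Integral (sym eq) (integral-* (integral-^ b (integral-ι (+ p))) z∈)

  𝔭-cancel : ∀ {b} d {x} → ¬ p ∣ ℤ.∣ d ∣ → 𝔭 b (ι d * x) → 𝔭 b x
  𝔭-cancel {b} d {x} p∤d dx∈ with ι-inverse d p∤d
  ... | u , u∈ , du≡1 = subst (𝔭 b)
    (trans (solve 3 (λ u d x → u :* (d :* x) := d :* u :* x) refl u (ι d) x) (trans (cong (_* x) du≡1) (ℚ.*-identityˡ x)))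
    (𝔭-* u∈ dx∈)

  ∣⇒𝔭 : ∀ z → p ∣ ℤ.∣ z ∣ → 𝔭 1 (ι z)
  ∣⇒𝔭 z p∣z with ℤ∣.∣ᵤ⇒∣ {+ p} {z} p∣z
  ... | ℤ∣.divides q eq = multiple {quotient = ι q} (integral-ι q)
    (trans (cong ι eq) (trans (ι-* q (+ p)) (trans (ℚ.*-comm (ι q) π) (cong (_* ι q) (sym (ℚ.*-identityʳ π))))))

-- Exponential series

inverse-/! : ∀ n → ι (+ suc n) * (1ℚ /! suc n) ≡ 1ℚ /! n
inverse-/! n = begin
  s * b                   ≡⟨ ℚ.*-identityʳ (s * b) ⟨
  s * b * 1ℚ              ≡⟨ cong (s * b *_) (1/!-inverse n) ⟨
  s * b * (f * a)         ≡⟨ solve 4 (λ s b f a → s :* b :* (f :* a) := s :* f :* b :* a) refl s b f a ⟩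
  s * f * b * a           ≡⟨ cong (λ x → x * b * a) (trans (sym (ι-* (+ suc n) (+ (n !)))) (cong ι (sym (ℤ.pos-* (suc n) (n !))))) ⟩
  ι (+ (suc n !)) * b * a ≡⟨ cong (_* a) (1/!-inverse (suc n)) ⟩
  1ℚ * a                  ≡⟨ ℚ.*-identityˡ a ⟩
  a                       ∎
  where
  open ≡-Reasoning
  s f a b : ℚ
  s = ι (+ suc n)
  f = ι (+ (n !))
  a = 1ℚ /! n
  b = 1ℚ /! suc n

/!-def : ∀ q n → q /! n ≡ q * (1ℚ /! n)
/!-def q n = cong (q *_) (sym (ℚ.*-identityˡ (_/_ 1ℤ (n !) {{n ℕ.!≢0}})))

/!-suc : ∀ q n → ι (+ suc n) * (q /! suc n) ≡ q /! n
/!-suc q n = begin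
  ι (+ suc n) * (q /! suc n)          ≡⟨ cong (ι (+ suc n) *_) (/!-def q (suc n)) ⟩
  ι (+ suc n) * (q * (1ℚ /! suc n))   ≡⟨ solve 3 (λ a b c → a :* (b :* c) := b :* (a :* c)) refl (ι (+ suc n)) q (1ℚ /! suc n) ⟩
  q * (ι (+ suc n) * (1ℚ /! suc n))   ≡⟨ cong (q *_) (inverse-/! n) ⟩
  q * (1ℚ /! n)                       ≡⟨ /!-def q n ⟨
  q /! n                              ∎
  where open ≡-Reasoning

ι-suc-cancel : ∀ n {x y} → ι (+ suc n) * x ≡ ι (+ suc n) * y → x ≡ y
ι-suc-cancel n {x} {y} eq = trans (sym (unit x)) (trans (cong (u *_) eq) (unit y))
  where
  open ≡-Reasoning
  u : ℚ
  u = ι (+ (n !)) * (1ℚ /! suc n)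
  unit : ∀ z → u * (ι (+ suc n) * z) ≡ z
  unit z = begin
    u * (ι (+ suc n) * z)                             ≡⟨ solve 4 (λ f a s z → f :* a :* (s :* z) := f :* (s :* a) :* z) refl (ι (+ (n !))) (1ℚ /! suc n) (ι (+ suc n)) z ⟩
    ι (+ (n !)) * (ι (+ suc n) * (1ℚ /! suc n)) * z   ≡⟨ cong (λ x → ι (+ (n !)) * x * z) (inverse-/! n) ⟩
    ι (+ (n !)) * (1ℚ /! n) * z                       ≡⟨ cong (_* z) (1/!-inverse n) ⟩
    1ℚ * z                                            ≡⟨ ℚ.*-identityˡ z ⟩
    z                                                 ∎

-- Scalars as constant series, so that the semiring solver for series can treat them as ordinary
-- factors.
κ : ℚ → Series
κ c zero    = c
κ c (suc n) = 0ℚ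

κ-⊛ : ∀ c f n → (κ c ⊛ f) n ≡ c * f n
κ-⊛ c f zero    = ℚ.+-identityʳ (c * f 0)
κ-⊛ c f (suc n) = trans (cong (_+_ (c * f (suc n))) (ℚ⟦x⟧.zeroˡ f n)) (ℚ.+-identityʳ (c * f (suc n)))

κ-+ : ∀ a b → κ (a + b) ≈ κ a +ˢ κ b
κ-+ a b zero    = refl
κ-+ a b (suc n) = refl

X-⊛-zero : ∀ f → (X ⊛ f) 0 ≡ 0ℚ
X-⊛-zero f = trans (ℚ.+-identityʳ (0ℚ * f 0)) (ℚ.*-zeroˡ (f 0))

X-⊛-suc : ∀ f n → (X ⊛ f) (suc n) ≡ f n
X-⊛-suc f n = trans (cong₂ _+_ (ℚ.*-zeroˡ (f (suc n))) (ℚ⟦x⟧.*-identityˡ f n)) (ℚ.+-identityˡ (f n))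

X^-⊛-+ : ∀ m f j → (X ^ˢ m ⊛ f) (m ℕ.+ j) ≡ f j
X^-⊛-+ zero    f j = ℚ⟦x⟧.*-identityˡ f j
X^-⊛-+ (suc m) f j = trans (ℚ⟦x⟧.*-assoc X (X ^ˢ m) f (suc (m ℕ.+ j)))
  (trans (X-⊛-suc (X ^ˢ m ⊛ f) (m ℕ.+ j)) (X^-⊛-+ m f j))

X^-⊛-< : ∀ m f j → j ℕ.< m → (X ^ˢ m ⊛ f) j ≡ 0ℚ
X^-⊛-< (suc m) f zero    _         = trans (ℚ⟦x⟧.*-assoc X (X ^ˢ m) f 0) (X-⊛-zero (X ^ˢ m ⊛ f))
X^-⊛-< (suc m) f (suc j) (s≤s j<m) = trans (ℚ⟦x⟧.*-assoc X (X ^ˢ m) f (suc j))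
  (trans (X-⊛-suc (X ^ˢ m ⊛ f) j) (X^-⊛-< m f j j<m))

-- The derivation x·d/dx.
θ : Series → Series
θ f n = ι (+ n) * f n

θ-⊛ : ∀ f g → θ (f ⊛ g) ≈ θ f ⊛ g +ˢ f ⊛ θ g
θ-⊛ f g n = begin
  ι (+ n) * ∑ℚ (suc n) (λ k → f k * g (n ∸ k))
    ≡⟨ ∑-* (suc n) (ι (+ n)) (λ k → f k * g (n ∸ k)) ⟩
  ∑ℚ (suc n) (λ k → ι (+ n) * (f k * g (n ∸ k)))
    ≡⟨ ∑-cong (suc n) (λ k k≤n → trans
         (cong (_* (f k * g (n ∸ k))) (trans (cong (ι ∘ +_) (sym (ℕ.m+[n∸m]≡n (ℕ.≤-pred k≤n)))) (ι-+ (+ k) (+ (n ∸ k)))))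
         (solve 4 (λ a b x y → (a :+ b) :* (x :* y) := a :* x :* y :+ x :* (b :* y)) refl (ι (+ k)) (ι (+ (n ∸ k))) (f k) (g (n ∸ k)))) ⟩
  ∑ℚ (suc n) (λ k → θ f k * g (n ∸ k) + f k * θ g (n ∸ k))
    ≡⟨ ∑-+ (suc n) (λ k → θ f k * g (n ∸ k)) (λ k → f k * θ g (n ∸ k)) ⟩
  (θ f ⊛ g +ˢ f ⊛ θ g) n ∎
  where open ≡-Reasoning

κ-X : ∀ c f n → (κ c ⊛ (X ⊛ f)) (suc n) ≡ c * f n
κ-X c f n = trans (κ-⊛ c (X ⊛ f) (suc n)) (cong (c *_) (X-⊛-suc f n))

θ-exp : ∀ t → θ (exp t) ≈ κ t ⊛ (X ⊛ exp t)
θ-exp t zero    = trans (ℚ.*-zeroˡ (exp t 0)) (sym (trans (κ-⊛ t (X ⊛ exp t) 0) (trans (cong (t *_) (X-⊛-zero (exp t))) (ℚ.*-zeroʳ t))))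
θ-exp t (suc n) = begin
  ι (+ suc n) * (t ^ suc n /! suc n)   ≡⟨ /!-suc (t ^ suc n) n ⟩
  t * t ^ n /! n                       ≡⟨ ℚ.*-assoc t (t ^ n) (_/_ 1ℤ (n !) {{n ℕ.!≢0}}) ⟩
  t * exp t n                          ≡⟨ κ-X t (exp t) n ⟨
  (κ t ⊛ (X ⊛ exp t)) (suc n)          ∎
  where open ≡-Reasoning

-- In degree n + 1 the equation reads (n + 1) f(n + 1) = t f(n), which fixes all coefficients from
-- the first. It turns the addition theorem `exp-+` into Leibniz' rule.
exp-unique : ∀ t f → f 0 ≡ 1ℚ → θ f ≈ κ t ⊛ (X ⊛ f) → f ≈ exp t
exp-unique t f f₀ θf zero    = f₀
exp-unique t f f₀ θf (suc n) = ι-suc-cancel n (begin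
  ι (+ suc n) * f (suc n)        ≡⟨ θf (suc n) ⟩
  (κ t ⊛ (X ⊛ f)) (suc n)        ≡⟨ κ-X t f n ⟩
  t * f n                        ≡⟨ cong (t *_) (exp-unique t f f₀ θf n) ⟩
  t * exp t n                    ≡⟨ κ-X t (exp t) n ⟨
  (κ t ⊛ (X ⊛ exp t)) (suc n)    ≡⟨ θ-exp t (suc n) ⟨
  ι (+ suc n) * exp t (suc n)    ∎)
  where open ≡-Reasoning

exp-+ : ∀ s t → exp s ⊛ exp t ≈ exp (s + t)
exp-+ s t = exp-unique (s + t) (exp s ⊛ exp t) refl (begin
  θ (exp s ⊛ exp t)
    ≈⟨ θ-⊛ (exp s) (exp t) ⟩
  θ (exp s) ⊛ exp t +ˢ exp s ⊛ θ (exp t)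
    ≈⟨ ℚ⟦x⟧.+-cong {θ (exp s) ⊛ exp t} {(κ s ⊛ (X ⊛ exp s)) ⊛ exp t}
         (ℚ⟦x⟧.*-congʳ {exp t} {θ (exp s)} {κ s ⊛ (X ⊛ exp s)} (θ-exp s))
         (ℚ⟦x⟧.*-congˡ {exp s} {θ (exp t)} {κ t ⊛ (X ⊛ exp t)} (θ-exp t)) ⟩
  (κ s ⊛ (X ⊛ exp s)) ⊛ exp t +ˢ exp s ⊛ (κ t ⊛ (X ⊛ exp t))
    ≈⟨ RS.solve 5 (λ a b x f g → (a RS.:* (x RS.:* f)) RS.:* g RS.:+ f RS.:* (b RS.:* (x RS.:* g)) RS.:= (a RS.:+ b) RS.:* (x RS.:* (f RS.:* g)))
         (λ _ → refl) (κ s) (κ t) X (exp s) (exp t) ⟩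
  (κ s +ˢ κ t) ⊛ (X ⊛ (exp s ⊛ exp t))
    ≈⟨ ℚ⟦x⟧.*-congʳ {X ⊛ (exp s ⊛ exp t)} {κ (s + t)} {κ s +ˢ κ t} (κ-+ s t) ⟨
  κ (s + t) ⊛ (X ⊛ (exp s ⊛ exp t)) ∎)
  where open SetoidReasoning ℚ⟦x⟧.setoid

exp-0 : exp 0ℚ ≈ 1#
exp-0 zero    = refl
exp-0 (suc n) = trans (cong (_/! suc n) (ℚ.*-zeroˡ (0ℚ ^ n))) (ℚ.*-zeroˡ (_/_ 1ℤ (suc n !) {{suc n ℕ.!≢0}}))

-- D = eˣ - 1, E = D/x and I = 1/E do not depend on the parameters of Existence.
open Existence 0 0ℚ using (D; E; I; E*I; D≈X*E)

-- Powers of eˣ - 1 and Stirling numbers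

exp1≈1+D : exp 1ℚ ≈ 1# +ˢ D
exp1≈1+D n = solve 2 (λ a b → a := b :+ (a :- b)) refl (exp 1ℚ n) (one n)

θD : θ D ≈ X ⊛ exp 1ℚ
θD zero    = trans (ℚ.*-zeroˡ (D 0)) (sym (X-⊛-zero (exp 1ℚ)))
θD (suc n) = begin
  ι (+ suc n) * (exp 1ℚ (suc n) + 0ℚ)   ≡⟨ cong (ι (+ suc n) *_) (ℚ.+-identityʳ (exp 1ℚ (suc n))) ⟩
  ι (+ suc n) * exp 1ℚ (suc n)          ≡⟨ θ-exp 1ℚ (suc n) ⟩
  (κ 1ℚ ⊛ (X ⊛ exp 1ℚ)) (suc n)         ≡⟨ κ-X 1ℚ (exp 1ℚ) n ⟩
  1ℚ * exp 1ℚ n                         ≡⟨ ℚ.*-identityˡ (exp 1ℚ n) ⟩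
  exp 1ℚ n                              ≡⟨ X-⊛-suc (exp 1ℚ) n ⟨
  (X ⊛ exp 1ℚ) (suc n)                  ∎
  where open ≡-Reasoning

-- D′ = eˣ = 1 + D, so (Dᵏ⁺¹)′ = (k + 1)(Dᵏ + Dᵏ⁺¹): the recurrence of the Stirling numbers in terms
-- of generating functions.
θD^ : ∀ k → θ (D ^ˢ suc k) ≈ κ (ι (+ suc k)) ⊛ (X ⊛ (D ^ˢ k +ˢ D ^ˢ suc k))
θD^ k = R.begin
  θ (D ⊛ D ^ˢ k)
    R.≈⟨ θ-⊛ D (D ^ˢ k) ⟩
  θ D ⊛ D ^ˢ k +ˢ D ⊛ θ (D ^ˢ k)
    R.≈⟨ ℚ⟦x⟧.+-cong {θ D ⊛ D ^ˢ k} {(X ⊛ (1# +ˢ D)) ⊛ D ^ˢ k}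
           (ℚ⟦x⟧.*-congʳ {D ^ˢ k} {θ D} {X ⊛ (1# +ˢ D)} (ℚ⟦x⟧.trans {θ D} {X ⊛ exp 1ℚ} {X ⊛ (1# +ˢ D)} θD (ℚ⟦x⟧.*-congˡ {X} {exp 1ℚ} {1# +ˢ D} exp1≈1+D)))
           (rest k) ⟩
  (X ⊛ (1# +ˢ D)) ⊛ D ^ˢ k +ˢ κ (ι (+ k)) ⊛ (X ⊛ (D ^ˢ k +ˢ D ^ˢ suc k))
    R.≈⟨ RS.solve 4 (λ c x d e → (x RS.:* (RS.con 1 RS.:+ d)) RS.:* e RS.:+ c RS.:* (x RS.:* (e RS.:+ d RS.:* e))
           RS.:= (RS.con 1 RS.:+ c) RS.:* (x RS.:* (e RS.:+ d RS.:* e))) (λ _ → refl) (κ (ι (+ k))) X D (D ^ˢ k) ⟩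
  ((1# +ˢ (λ _ → 0ℚ)) +ˢ κ (ι (+ k))) ⊛ (X ⊛ (D ^ˢ k +ˢ D ^ˢ suc k))
    R.≈⟨ ℚ⟦x⟧.*-congʳ {X ⊛ (D ^ˢ k +ˢ D ^ˢ suc k)} {(1# +ˢ (λ _ → 0ℚ)) +ˢ κ (ι (+ k))} {κ (ι (+ suc k))} coefficient ⟩
  κ (ι (+ suc k)) ⊛ (X ⊛ (D ^ˢ k +ˢ D ^ˢ suc k)) R.∎
  where
  coefficient : (1# +ˢ (λ _ → 0ℚ)) +ˢ κ (ι (+ k)) ≈ κ (ι (+ suc k))
  coefficient zero    = sym (ι-suc k)
  coefficient (suc n) = refl

  -- `rest` and `θD^` call each other: D θ(Dᵏ) reduces to `θD^` at the preceding exponent, and at k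
  -- = 0 both sides are 0.
  rest : ∀ k → D ⊛ θ (D ^ˢ k) ≈ κ (ι (+ k)) ⊛ (X ⊛ (D ^ˢ k +ˢ D ^ˢ suc k))
  rest zero n = trans (trans (ℚ⟦x⟧.*-congˡ {D} {θ 1#} {λ _ → 0ℚ} θ1 n) (ℚ⟦x⟧.zeroʳ D n))
    (sym (trans (κ-⊛ 0ℚ (X ⊛ (1# +ˢ D ^ˢ 1)) n) (ℚ.*-zeroˡ ((X ⊛ (1# +ˢ D ^ˢ 1)) n))))
    where
    θ1 : θ 1# ≈ (λ _ → 0ℚ)
    θ1 zero    = refl
    θ1 (suc n) = ℚ.*-zeroʳ (ι (+ suc n))
  rest (suc k) = R.begin
    D ⊛ θ (D ^ˢ suc k)
      R.≈⟨ ℚ⟦x⟧.*-congˡ {D} {θ (D ^ˢ suc k)} {κ (ι (+ suc k)) ⊛ (X ⊛ (D ^ˢ k +ˢ D ^ˢ suc k))} (θD^ k) ⟩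
    D ⊛ (κ (ι (+ suc k)) ⊛ (X ⊛ (D ^ˢ k +ˢ D ^ˢ suc k)))
      R.≈⟨ RS.solve 5 (λ c x d e e′ → d RS.:* (c RS.:* (x RS.:* (e RS.:+ e′))) RS.:= c RS.:* (x RS.:* (d RS.:* e RS.:+ d RS.:* e′)))
             (λ _ → refl) (κ (ι (+ suc k))) X D (D ^ˢ k) (D ^ˢ suc k) ⟩
    κ (ι (+ suc k)) ⊛ (X ⊛ (D ^ˢ suc k +ˢ D ^ˢ suc (suc k))) R.∎

-- Multiplied by n + 1, the coefficients on both sides satisfy one and the same recurrence, given on
-- the left by `θD^` and on the right by `S-suc`.
D^≡S̄ : ∀ n k → (D ^ˢ k) n ≡ S̄ n k
D^≡S̄ zero    zero    = refl
D^≡S̄ (suc n) zero    = sym (ℚ.*-zeroʳ (ι (+ 1) /! suc n))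
D^≡S̄ zero    (suc k) = trans (trans (ℚ.+-identityʳ (0ℚ * (D ^ˢ k) 0)) (ℚ.*-zeroˡ ((D ^ˢ k) 0))) (sym (ℚ.*-zeroʳ (ι (+ (suc k !)) /! 0)))
D^≡S̄ (suc n) (suc k) = ι-suc-cancel n (begin
  ι (+ suc n) * (D ^ˢ suc k) (suc n)
    ≡⟨ θD^ k (suc n) ⟩
  (κ c ⊛ (X ⊛ (D ^ˢ k +ˢ D ^ˢ suc k))) (suc n)
    ≡⟨ κ-X c (D ^ˢ k +ˢ D ^ˢ suc k) n ⟩
  c * ((D ^ˢ k) n + (D ^ˢ suc k) n)
    ≡⟨ cong₂ (λ x y → c * (x + y)) (D^≡S̄ n k) (D^≡S̄ n (suc k)) ⟩
  c * (f * a * s + f′ * a * s′)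
    ≡⟨ cong (λ x → c * (f * a * s + x * a * s′)) f′≡cf ⟩
  c * (f * a * s + c * f * a * s′)
    ≡⟨ solve 5 (λ c f a s t → c :* (f :* a :* s :+ c :* f :* a :* t) := c :* f :* a :* (s :+ c :* t)) refl c f a s s′ ⟩
  c * f * a * (s + c * s′)
    ≡⟨ cong₂ (λ x y → x * a * y) f′≡cf S-suc ⟨
  f′ * a * ι (+ S (suc n) (suc k))
    ≡⟨ cong (_* ι (+ S (suc n) (suc k))) (/!-suc f′ n) ⟨
  ι (+ suc n) * (f′ /! suc n) * ι (+ S (suc n) (suc k))
    ≡⟨ ℚ.*-assoc (ι (+ suc n)) (f′ /! suc n) (ι (+ S (suc n) (suc k))) ⟩
  ι (+ suc n) * S̄ (suc n) (suc k) ∎)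
  where
  open ≡-Reasoning
  c f f′ a s s′ : ℚ
  c = ι (+ suc k)
  f = ι (+ (k !))
  f′ = ι (+ (suc k !))
  a = _/_ 1ℤ (n !) {{n ℕ.!≢0}}
  s = ι (+ S n k)
  s′ = ι (+ S n (suc k))
  f′≡cf : f′ ≡ c * f
  f′≡cf = trans (cong ι (ℤ.pos-* (suc k) (k !))) (ι-* (+ suc k) (+ (k !)))
  -- `S` unfolds to S(n + 1, k + 1) = S(n, k) + (k + 1) S(n, k + 1); only the passage to ℚ is left.
  S-suc : ι (+ S (suc n) (suc k)) ≡ s + c * s′
  S-suc = trans (ι-+ (+ S n k) (+ (suc k ℕ.* S n (suc k))))
    (cong (_+_ s) (trans (cong ι (ℤ.pos-* (suc k) (S n (suc k)))) (ι-* (+ suc k) (+ S n (suc k)))))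

D^≈X^⊛E^ : ∀ n → D ^ˢ n ≈ X ^ˢ n ⊛ E ^ˢ n
D^≈X^⊛E^ n = ℚ⟦x⟧.trans {D ^ˢ n} {(X ⊛ E) ^ˢ n} {X ^ˢ n ⊛ E ^ˢ n} (ℚ⟦x⟧.^-congˡ n {D} {X ⊛ E} D≈X*E)
  (ℚ⟦x⟧^.^-distrib-* X E n)

E^≡S̄ : ∀ k j → (E ^ˢ k) j ≡ S̄ (j ℕ.+ k) k
E^≡S̄ k j = begin
  (E ^ˢ k) j                    ≡⟨ X^-⊛-+ k (E ^ˢ k) j ⟨
  (X ^ˢ k ⊛ E ^ˢ k) (k ℕ.+ j)   ≡⟨ D^≈X^⊛E^ k (k ℕ.+ j) ⟨
  (D ^ˢ k) (k ℕ.+ j)            ≡⟨ D^≡S̄ (k ℕ.+ j) k ⟩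
  S̄ (k ℕ.+ j) k                 ≡⟨ cong (λ n → S̄ n k) (ℕ.+-comm k j) ⟩
  S̄ (j ℕ.+ k) k                 ∎
  where open ≡-Reasoning

-- Differences of r ↦ e⁻ʳˣ

χ : ℤ → Series
χ r = exp (ι (ℤ.- r))

χ-shift : ∀ r s → χ (r ℤ.- s) ≈ χ r ⊛ exp (ι s)
χ-shift r s n = sym (trans (exp-+ (ι (ℤ.- r)) (ι s) n) (cong (λ t → exp t n)
  (trans (sym (ι-+ (ℤ.- r) s)) (cong ι (sym (trans (ℤ.neg-distrib-+ r (ℤ.- s)) (cong (λ z → ℤ.- r ℤ.+ z) (ℤ.neg-involutive s))))))))

χ-∇ : Series → ℕ → ℤ → ℚ
χ-∇ g j r = (χ r ⊛ g) j

∇-χ : ∀ g j r → ∇ (χ-∇ g j) r ≡ χ-∇ (D ⊛ g) j r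
∇-χ g j r = trans (cong (_- (χ r ⊛ g) j) (eq j)) (solve 2 (λ x y → x :+ y :- y := x) refl ((χ r ⊛ (D ⊛ g)) j) ((χ r ⊛ g) j))
  where
  eq : χ (r ℤ.- 1ℤ) ⊛ g ≈ χ r ⊛ (D ⊛ g) +ˢ χ r ⊛ g
  eq = R.begin
    χ (r ℤ.- 1ℤ) ⊛ g
      R.≈⟨ ℚ⟦x⟧.*-congʳ {g} {χ (r ℤ.- 1ℤ)} {χ r ⊛ exp 1ℚ} (χ-shift r 1ℤ) ⟩
    (χ r ⊛ exp 1ℚ) ⊛ g
      R.≈⟨ ℚ⟦x⟧.*-congʳ {g} {χ r ⊛ exp 1ℚ} {χ r ⊛ (1# +ˢ D)} (ℚ⟦x⟧.*-congˡ {χ r} {exp 1ℚ} {1# +ˢ D} exp1≈1+D) ⟩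
    (χ r ⊛ (1# +ˢ D)) ⊛ g
      R.≈⟨ RS.solve 3 (λ c d g → (c RS.:* (RS.con 1 RS.:+ d)) RS.:* g RS.:= c RS.:* (d RS.:* g) RS.:+ c RS.:* g) (λ _ → refl) (χ r) D g ⟩
    χ r ⊛ (D ⊛ g) +ˢ χ r ⊛ g R.∎

∇^-χ : ∀ n g j r → ∇^ n (χ-∇ g j) r ≡ χ-∇ (D ^ˢ n ⊛ g) j r
∇^-χ zero    g j r = sym (ℚ⟦x⟧.*-congˡ {χ r} {1# ⊛ g} {g} (ℚ⟦x⟧.*-identityˡ g) j)
∇^-χ (suc n) g j r = begin
  ∇ (∇^ n (χ-∇ g j)) r          ≡⟨ cong₂ _-_ (∇^-χ n g j (r ℤ.- 1ℤ)) (∇^-χ n g j r) ⟩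
  ∇ (χ-∇ (D ^ˢ n ⊛ g) j) r      ≡⟨ ∇-χ (D ^ˢ n ⊛ g) j r ⟩
  χ-∇ (D ⊛ (D ^ˢ n ⊛ g)) j r    ≡⟨ ℚ⟦x⟧.*-congˡ {χ r} {(D ^ˢ suc n) ⊛ g} {D ⊛ (D ^ˢ n ⊛ g)} (ℚ⟦x⟧.*-assoc D (D ^ˢ n) g) j ⟨
  χ-∇ (D ^ˢ suc n ⊛ g) j r      ∎
  where open ≡-Reasoning

-- Dⁿ = xⁿEⁿ: every difference costs one degree and leaves a factor E. So n differences annihilate
-- the coefficients of degree below n.
∇^-χ-X : ∀ n g r → (χ r ⊛ (D ^ˢ n ⊛ g)) ≈ X ^ˢ n ⊛ (χ r ⊛ (E ^ˢ n ⊛ g))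
∇^-χ-X n g r = R.begin
  χ r ⊛ (D ^ˢ n ⊛ g)
    R.≈⟨ ℚ⟦x⟧.*-congˡ {χ r} {D ^ˢ n ⊛ g} {(X ^ˢ n ⊛ E ^ˢ n) ⊛ g} (ℚ⟦x⟧.*-congʳ {g} {D ^ˢ n} {X ^ˢ n ⊛ E ^ˢ n} (D^≈X^⊛E^ n)) ⟩
  χ r ⊛ ((X ^ˢ n ⊛ E ^ˢ n) ⊛ g)
    R.≈⟨ RS.solve 4 (λ c x e g → c RS.:* ((x RS.:* e) RS.:* g) RS.:= x RS.:* (c RS.:* (e RS.:* g))) (λ _ → refl) (χ r) (X ^ˢ n) (E ^ˢ n) g ⟩
  X ^ˢ n ⊛ (χ r ⊛ (E ^ˢ n ⊛ g)) R.∎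

∇^-χ-≥ : ∀ n g j r → ∇^ n (χ-∇ g (n ℕ.+ j)) r ≡ χ-∇ (E ^ˢ n ⊛ g) j r
∇^-χ-≥ n g j r = trans (∇^-χ n g (n ℕ.+ j) r) (trans (∇^-χ-X n g r (n ℕ.+ j)) (X^-⊛-+ n (χ r ⊛ (E ^ˢ n ⊛ g)) j))

∇^-χ-< : ∀ n g j r → j ℕ.< n → ∇^ n (χ-∇ g j) r ≡ 0ℚ
∇^-χ-< n g j r j<n = trans (∇^-χ n g j r) (trans (∇^-χ-X n g r j) (X^-⊛-< n (χ r ⊛ (E ^ˢ n ⊛ g)) j j<n))

-- Reflection

-- The substitution x ↦ cx.
scale : ℚ → Series → Series
scale c f n = c ^ n * f n

scale-cong : ∀ c {f g} → f ≈ g → scale c f ≈ scale c g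
scale-cong c f≈g n = cong (c ^ n *_) (f≈g n)

scale-⊛ : ∀ c f g → scale c (f ⊛ g) ≈ scale c f ⊛ scale c g
scale-⊛ c f g n = trans (∑-* (suc n) (c ^ n) (λ k → f k * g (n ∸ k)))
  (∑-cong (suc n) (λ k k≤n → trans
    (cong (_* (f k * g (n ∸ k))) (trans (cong (c ^_) (sym (ℕ.m+[n∸m]≡n (ℕ.≤-pred k≤n)))) (ℚ^.^-homo-* c k (n ∸ k))))
    (solve 4 (λ a b x y → a :* b :* (x :* y) := a :* x :* (b :* y)) refl (c ^ k) (c ^ (n ∸ k)) (f k) (g (n ∸ k)))))

scale-exp : ∀ c t → scale c (exp t) ≈ exp (c * t)
scale-exp c t n = trans (sym (ℚ.*-assoc (c ^ n) (t ^ n) (_/_ 1ℤ (n !) {{n ℕ.!≢0}}))) (cong (_/! n) (sym (ℚ^.^-distrib-* c t n)))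

scale-1 : ∀ c → scale c 1# ≈ 1#
scale-1 c zero    = refl
scale-1 c (suc n) = ℚ.*-zeroʳ (c ^ suc n)

exp-⊛D : ∀ t → exp t ⊛ D ≈ exp (t + 1ℚ) -ˢ exp t
exp-⊛D t n = begin
  (exp t ⊛ D) n                           ≡⟨ solve 2 (λ x y → x := x :+ y :- y) refl ((exp t ⊛ D) n) (exp t n) ⟩
  (exp t ⊛ D) n + exp t n - exp t n       ≡⟨ cong (_- exp t n) (sym (split n)) ⟩
  exp (t + 1ℚ) n - exp t n                ∎
  where
  open ≡-Reasoning
  split : exp (t + 1ℚ) ≈ exp t ⊛ D +ˢ exp t
  split = R.begin
    exp (t + 1ℚ)              R.≈⟨ exp-+ t 1ℚ ⟨
    exp t ⊛ exp 1ℚ            R.≈⟨ ℚ⟦x⟧.*-congˡ {exp t} {exp 1ℚ} {1# +ˢ D} exp1≈1+D ⟩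
    exp t ⊛ (1# +ˢ D)         R.≈⟨ RS.solve 2 (λ e d → e RS.:* (RS.con 1 RS.:+ d) RS.:= e RS.:* d RS.:+ e) (λ _ → refl) (exp t) D ⟩
    exp t ⊛ D +ˢ exp t        R.∎

scale-E : scale (- 1ℚ) E ≈ exp (- 1ℚ) ⊛ E
scale-E n = begin
  s ^ n * (exp 1ℚ (suc n) + 0ℚ)
    -- The coefficient of E in degree n is that of D in degree n + 1, so (-1)ⁿ becomes -(-1)ⁿ⁺¹;
    -- this accounts for (e⁻ˣ - 1)/(-x) having the terms reversed.
    ≡⟨ solve 2 (λ a b → a :* (b :+ con 0ℚ) := con 0ℚ :- con (- 1ℚ) :* a :* b) refl (s ^ n) (exp 1ℚ (suc n)) ⟩
  0ℚ - scale s (exp 1ℚ) (suc n)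
    ≡⟨ cong (_-_ 0ℚ) (scale-exp s 1ℚ (suc n)) ⟩
  0ℚ - exp s (suc n)
    ≡⟨ cong (_- exp s (suc n)) (exp-0 (suc n)) ⟨
  exp 0ℚ (suc n) - exp s (suc n)
    ≡⟨ exp-⊛D s (suc n) ⟨
  (exp s ⊛ D) (suc n)
    ≡⟨ ℚ⟦x⟧.*-congˡ {exp s} {D} {X ⊛ E} D≈X*E (suc n) ⟩
  (exp s ⊛ (X ⊛ E)) (suc n)
    ≡⟨ RS.solve 3 (λ a x e → a RS.:* (x RS.:* e) RS.:= x RS.:* (a RS.:* e)) (λ _ → refl) (exp s) X E (suc n) ⟩
  (X ⊛ (exp s ⊛ E)) (suc n)
    ≡⟨ X-⊛-suc (exp s ⊛ E) n ⟩
  (exp s ⊛ E) n ∎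
  where
  open ≡-Reasoning
  s : ℚ
  s = - 1ℚ

scale-I : scale (- 1ℚ) I ≈ exp 1ℚ ⊛ I
scale-I = R.begin
  σI                                      R.≈⟨ ℚ⟦x⟧.*-identityˡ σI ⟨
  1# ⊛ σI                                 R.≈⟨ ℚ⟦x⟧.*-congʳ {σI} {(exp 1ℚ ⊛ e) ⊛ (E ⊛ I)} {1#} unit ⟨
  ((exp 1ℚ ⊛ e) ⊛ (E ⊛ I)) ⊛ σI           R.≈⟨ RS.solve 5 (λ a b c d f → ((a RS.:* b) RS.:* (c RS.:* d)) RS.:* f RS.:= (a RS.:* d) RS.:* ((b RS.:* c) RS.:* f))
                                                (λ _ → refl) (exp 1ℚ) e E I σI ⟩
  (exp 1ℚ ⊛ I) ⊛ ((e ⊛ E) ⊛ σI)           R.≈⟨ ℚ⟦x⟧.*-congˡ {exp 1ℚ ⊛ I} {(e ⊛ E) ⊛ σI} {1#} inverse ⟩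
  (exp 1ℚ ⊛ I) ⊛ 1#                       R.≈⟨ ℚ⟦x⟧.*-identityʳ (exp 1ℚ ⊛ I) ⟩
  exp 1ℚ ⊛ I                              R.∎
  where
  σI e : Series
  σI = scale (- 1ℚ) I
  e = exp (- 1ℚ)
  unit : (exp 1ℚ ⊛ e) ⊛ (E ⊛ I) ≈ 1#
  unit = R.begin
    (exp 1ℚ ⊛ e) ⊛ (E ⊛ I)   R.≈⟨ ℚ⟦x⟧.*-congˡ {exp 1ℚ ⊛ e} {E ⊛ I} {1#} E*I ⟩
    (exp 1ℚ ⊛ e) ⊛ 1#        R.≈⟨ ℚ⟦x⟧.*-identityʳ (exp 1ℚ ⊛ e) ⟩
    exp 1ℚ ⊛ e               R.≈⟨ exp-+ 1ℚ (- 1ℚ) ⟩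
    exp 0ℚ                   R.≈⟨ exp-0 ⟩
    1#                       R.∎
  inverse : (e ⊛ E) ⊛ σI ≈ 1#
  inverse = R.begin
    (e ⊛ E) ⊛ σI                 R.≈⟨ ℚ⟦x⟧.*-congʳ {σI} {scale (- 1ℚ) E} {e ⊛ E} scale-E ⟨
    scale (- 1ℚ) E ⊛ σI          R.≈⟨ scale-⊛ (- 1ℚ) E I ⟨
    scale (- 1ℚ) (E ⊛ I)         R.≈⟨ scale-cong (- 1ℚ) {E ⊛ I} {1#} E*I ⟩
    scale (- 1ℚ) 1#              R.≈⟨ scale-1 (- 1ℚ) ⟩
    1#                           R.∎

-- Under x ↦ -x the series eᵗˣ/E becomes e⁻ᵗˣ · eˣ/E. This is the symmetry B_n(1 - t) = (-1)ⁿB_n(t).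
exp-⊛I-reflection : ∀ t n → (- 1ℚ) ^ n * (exp t ⊛ I) n ≡ (exp (1ℚ - t) ⊛ I) n
exp-⊛I-reflection t = R.begin
  scale (- 1ℚ) (exp t ⊛ I)              R.≈⟨ scale-⊛ (- 1ℚ) (exp t) I ⟩
  scale (- 1ℚ) (exp t) ⊛ scale (- 1ℚ) I R.≈⟨ ℚ⟦x⟧.*-cong {scale (- 1ℚ) (exp t)} {exp (- 1ℚ * t)} {scale (- 1ℚ) I} {exp 1ℚ ⊛ I} (scale-exp (- 1ℚ) t) scale-I ⟩
  exp (- 1ℚ * t) ⊛ (exp 1ℚ ⊛ I)         R.≈⟨ ℚ⟦x⟧.*-assoc (exp (- 1ℚ * t)) (exp 1ℚ) I ⟨
  (exp (- 1ℚ * t) ⊛ exp 1ℚ) ⊛ I         R.≈⟨ ℚ⟦x⟧.*-congʳ {I} {exp (- 1ℚ * t) ⊛ exp 1ℚ} {exp (1ℚ - t)} sum ⟩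
  exp (1ℚ - t) ⊛ I                      R.∎
  where
  sum : exp (- 1ℚ * t) ⊛ exp 1ℚ ≈ exp (1ℚ - t)
  sum n = trans (exp-+ (- 1ℚ * t) 1ℚ n) (cong (λ u → exp u n) (solve 1 (λ t → con (- 1ℚ) :* t :+ con 1ℚ := con 1ℚ :- t) refl t))

-- Power series modulo p

nCk*k![n∸k]!≡n! : ∀ {n k} → k ℕ.≤ n → (n C k) ℕ.* (k ! ℕ.* (n ∸ k) !) ≡ n !
nCk*k![n∸k]!≡n! {n} {k} k≤n = trans (cong (ℕ._* (k ! ℕ.* (n ∸ k) !)) (nCk≡n!/k![n-k]! k≤n)) (ℕ.m/n*n≡m (k![n∸k]!∣n! k≤n))
  where
  instance
    k![n∸k]!≢0 : NonZero (k ! ℕ.* (n ∸ k) !)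
    k![n∸k]!≢0 = ℕ.m*n≢0 (k !) ((n ∸ k) !) {{k ℕ.!≢0}} {{(n ∸ k) ℕ.!≢0}}

p∣pCk : ∀ {p k} → Prime p → 0 ℕ.< k → k ℕ.< p → p ∣ p C k
p∣pCk {p@(suc p-1)} {k@(suc k-1)} pr _ k<p with euclidsLemma (p C k) (k ! ℕ.* (p ∸ k) !) pr
    (subst (p ∣_) (sym (nCk*k![n∸k]!≡n! (ℕ.<⇒≤ k<p))) (∣.∣m⇒∣m*n (p-1 !) ∣.∣-refl))
... | inj₁ p∣C = p∣C
... | inj₂ p∣k![p∸k]! with euclidsLemma (k !) ((p ∸ k) !) pr p∣k![p∸k]!
...   | inj₁ p∣k!     = ⊥-elim (Local.p∤n! p pr k k<p p∣k!)
...   | inj₂ p∣[p∸k]! = ⊥-elim (Local.p∤n! p pr (p ∸ k) (s≤s (ℕ.m∸n≤m p-1 k-1)) p∣[p∸k]!)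

-- Generic in the semiring and in the set `P` of negligible elements: it is applied to series with
-- `P` meaning divisible by p below degree N, for Eᵖ, and to ℚ with `P` = `𝔭 1`, for Fermat.
module Frobenius {a ℓ} (A : CommutativeSemiring a ℓ) where
  open CommutativeSemiring A
    renaming (_≈_ to infix 4 _≈ᴬ_; _+_ to infixl 6 _⊞_; _*_ to infixl 7 _⊠_; refl to ≈-refl; sym to ≈-sym; trans to ≈-trans)
  open Exp semiring using () renaming (_^_ to infixr 8 _^ᴬ_)
  open Mult semiring using (×-homo-1; ×-congˡ) renaming (_×_ to infixr 8 _×ᴬ_)
  open Sum semiring using (sum; sum-init-last)

  module _ {q} (P : Carrier → Set q) (P-0 : P 0#) (P-+ : ∀ {x y} → P x → P y → P (x ⊞ y)) where

    P-sum : ∀ n (f : Fin n → Carrier) → (∀ i → P (f i)) → P (sum f)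
    P-sum zero    f Pf = P-0
    P-sum (suc n) f Pf = P-+ (Pf Fin.zero) (P-sum n (f ∘ Fin.suc) (Pf ∘ Fin.suc))

    frobenius : ∀ {p} → Prime p → ∀ x y → (∀ c i j → p ∣ c → P (c ×ᴬ (x ^ᴬ i ⊠ y ^ᴬ j))) →
                ∃ λ m → P m × (x ⊞ y) ^ᴬ p ≈ᴬ y ^ᴬ p ⊞ (m ⊞ x ^ᴬ p)
    frobenius {p@(suc (suc k))} pr x y Pcxy = m , Pm , ≈-trans (Binomial.theorem A p x y)
      (+-cong first (≈-trans (sum-init-last (t ∘ Fin.suc)) (+-congˡ last)))
      where
      t : Fin (suc p) → Carrier
      t = Binomial.binomialTerm A x y p
      m : Carrier
      m = sum (λ i → t (Fin.suc (inject₁ i)))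
      Pm : P m
      Pm = P-sum (suc k) (λ i → t (Fin.suc (inject₁ i))) (λ i → Pcxy _ (suc (toℕ (inject₁ i))) (suc k ∸ toℕ (inject₁ i))
        (p∣pCk pr ℕ.z<s (s≤s (subst (ℕ._< suc k) (sym (Fin.toℕ-inject₁ i)) (Fin.toℕ<n i)))))
      first : t Fin.zero ≈ᴬ y ^ᴬ p
      first = ≈-trans (×-homo-1 _) (*-identityˡ _)
      last : t (Fin.suc (fromℕ (suc k))) ≈ᴬ x ^ᴬ p
      last rewrite Fin.toℕ-fromℕ k | nCn≡1 p | ℕ.n∸n≡0 k = ≈-trans (×-homo-1 _) (*-identityʳ _)

open Mult ℚ⟦x⟧.semiring using () renaming (_×_ to infixr 8 _×ˢ_)

1^n≡1 : ∀ n → 1ℚ ^ n ≡ 1ℚ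
1^n≡1 zero    = refl
1^n≡1 (suc n) = trans (ℚ.*-identityˡ (1ℚ ^ n)) (1^n≡1 n)

×ˢ-coefficient : ∀ c f k → (c ×ˢ f) k ≡ ι (+ c) * f k
×ˢ-coefficient zero    f k = sym (ℚ.*-zeroˡ (f k))
×ˢ-coefficient (suc c) f k = trans (cong (_+_ (f k)) (×ˢ-coefficient c f k))
  (trans (solve 2 (λ x c → x :+ c :* x := (con 1ℚ :+ c) :* x) refl (f k) (ι (+ c))) (cong (_* f k) (sym (ι-suc c))))

1^ˢ : ∀ n → 1# ^ˢ n ≈ 1#
1^ˢ zero    k = refl
1^ˢ (suc n) k = trans (ℚ⟦x⟧.*-identityˡ (1# ^ˢ n) k) (1^ˢ n k)

module Truncation (p : ℕ) (pr : Prime p) where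
  open Local p pr

  N : ℕ
  N = p ∸ 1

  <N⇒<p : ∀ {k} → k ℕ.< N → suc k ℕ.< p
  <N⇒<p {k} k<N = subst (suc k ℕ.<_) (ℕ.suc-pred p {{prime⇒nonZero pr}}) (s≤s k<N)

  -- Only the coefficients of 1, x, …, xᵖ⁻² matter: that of xᵖ⁻¹ may be 1/p!.
  Integralˢ : Series → Set
  Integralˢ f = ∀ k → k ℕ.< N → Integral (f k)

  infix 4 _∼_
  record _∼_ (f g : Series) : Set where
    constructor coefficientwise
    field at : ∀ k → k ℕ.< N → 𝔭 1 (f k - g k)
  open _∼_

  ≈⇒∼ : ∀ {f g} → f ≈ g → f ∼ g
  ≈⇒∼ f≈g = coefficientwise λ k _ → 𝔭-≡ (f≈g k)

  ∼-sym : ∀ {f g} → f ∼ g → g ∼ f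
  ∼-sym {f} {g} f∼g = coefficientwise λ k k<N → 𝔭-sym (f k) (g k) (at f∼g k k<N)

  ∼-trans : ∀ {f g h} → f ∼ g → g ∼ h → f ∼ h
  ∼-trans {f} {g} {h} f∼g g∼h = coefficientwise λ k k<N → 𝔭-trans (f k) (g k) (h k) (at f∼g k k<N) (at g∼h k k<N)

  integral-⊛ : ∀ {f g} → Integralˢ f → Integralˢ g → Integralˢ (f ⊛ g)
  integral-⊛ f∈ g∈ k k<N = integral-∑ (suc k) (λ i i≤k → integral-*
    (f∈ i (ℕ.≤-<-trans (ℕ.≤-pred i≤k) k<N)) (g∈ (k ∸ i) (ℕ.≤-<-trans (ℕ.m∸n≤m k i) k<N)))

  integral-one : Integralˢ 1#
  integral-one zero    _ = integral-ι 1ℤ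
  integral-one (suc k) _ = integral-ι 0ℤ

  integral-^ˢ : ∀ {f} n → Integralˢ f → Integralˢ (f ^ˢ n)
  integral-^ˢ zero    f∈ = integral-one
  integral-^ˢ (suc n) f∈ = integral-⊛ f∈ (integral-^ˢ n f∈)

  ⊛-∼ˡ : ∀ {h f g} → Integralˢ h → f ∼ g → h ⊛ f ∼ h ⊛ g
  ⊛-∼ˡ {h} {f} {g} h∈ f∼g = coefficientwise λ k k<N → subst (𝔭 1) (eq k) (𝔭-∑ (suc k) (λ i i≤k → 𝔭-*
    (h∈ i (ℕ.≤-<-trans (ℕ.≤-pred i≤k) k<N)) (at f∼g (k ∸ i) (ℕ.≤-<-trans (ℕ.m∸n≤m k i) k<N))))
    where
    open ≡-Reasoning
    eq : ∀ k → ∑ℚ (suc k) (λ i → h i * (f (k ∸ i) - g (k ∸ i))) ≡ (h ⊛ f) k - (h ⊛ g) k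
    eq k = begin
      ∑ℚ (suc k) (λ i → h i * (f (k ∸ i) - g (k ∸ i)))
        ≡⟨ ∑-cong (suc k) (λ i _ → solve 3 (λ h a b → h :* (a :- b) := h :* a :+ con (- 1ℚ) :* (h :* b)) refl (h i) (f (k ∸ i)) (g (k ∸ i))) ⟩
      ∑ℚ (suc k) (λ i → h i * f (k ∸ i) + - 1ℚ * (h i * g (k ∸ i)))
        ≡⟨ ∑-+ (suc k) (λ i → h i * f (k ∸ i)) (λ i → - 1ℚ * (h i * g (k ∸ i))) ⟩
      (h ⊛ f) k + ∑ℚ (suc k) (λ i → - 1ℚ * (h i * g (k ∸ i)))
        ≡⟨ cong (_+_ ((h ⊛ f) k)) (∑-* (suc k) (- 1ℚ) (λ i → h i * g (k ∸ i))) ⟨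
      (h ⊛ f) k + - 1ℚ * (h ⊛ g) k
        ≡⟨ cong (_+_ ((h ⊛ f) k)) (sym (neg-mulˡ ((h ⊛ g) k))) ⟩
      (h ⊛ f) k - (h ⊛ g) k ∎

  ⊛-∼-1 : ∀ {h f} → Integralˢ h → f ∼ 1# → h ⊛ f ∼ h
  ⊛-∼-1 {h} {f} h∈ f∼1 = ∼-trans (⊛-∼ˡ {h} {f} {1#} h∈ f∼1) (≈⇒∼ (ℚ⟦x⟧.*-identityʳ h))

  ^-∼-1 : ∀ {f} n → Integralˢ f → f ∼ 1# → f ^ˢ n ∼ 1#
  ^-∼-1 zero    f∈ f∼1 = ≈⇒∼ {1#} {1#} (λ _ → refl)
  ^-∼-1 {f} (suc n) f∈ f∼1 = ∼-trans (⊛-∼-1 {f} {f ^ˢ n} f∈ (^-∼-1 n f∈ f∼1)) f∼1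

  -- As the constant term of `f` is 1, the equation in degree k expresses `g k` by earlier
  -- coefficients of `g`; the bound `m` in `below` makes this a strong induction.
  integral-inverse : ∀ f g → f 0 ≡ 1ℚ → f ⊛ g ≈ 1# → Integralˢ f → Integralˢ g
  integral-inverse f g f₀ fg≈1 f∈ k = below (suc k) k ℕ.≤-refl
    where
    below : ∀ m k → k ℕ.< m → k ℕ.< N → Integral (g k)
    below (suc m) zero _ _ = subst Integral (sym (begin
      g 0                ≡⟨ solve 1 (λ x → x := con 1ℚ :* x :+ con 0ℚ) refl (g 0) ⟩
      1ℚ * g 0 + 0ℚ      ≡⟨ cong (λ c → c * g 0 + 0ℚ) f₀ ⟨
      f 0 * g 0 + 0ℚ     ≡⟨ fg≈1 0 ⟩
      1ℚ                 ∎)) (integral-ι 1ℤ)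
      where open ≡-Reasoning
    below (suc m) (suc k) (s≤s k<m) k<N = subst Integral (sym (begin
      g (suc k)                       ≡⟨ solve 2 (λ x y → x := :- y :+ (con 1ℚ :* x :+ y)) refl (g (suc k)) tail ⟩
      - tail + (1ℚ * g (suc k) + tail) ≡⟨ cong (λ c → - tail + (c * g (suc k) + tail)) f₀ ⟨
      - tail + (f ⊛ g) (suc k)        ≡⟨ cong (_+_ (- tail)) (fg≈1 (suc k)) ⟩
      - tail + 0ℚ                     ≡⟨ ℚ.+-identityʳ (- tail) ⟩
      - tail                          ∎))
      (integral-neg (integral-∑ (suc k) (λ i i≤k → integral-*
        (f∈ (suc i) (ℕ.≤-<-trans i≤k k<N))
        (below m (k ∸ i) (ℕ.≤-<-trans (ℕ.m∸n≤m k i) k<m) (ℕ.≤-<-trans (ℕ.m∸n≤m k i) (ℕ.<-trans (ℕ.n<1+n k) k<N))))))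
      where
      open ≡-Reasoning
      tail : ℚ
      tail = ((f ∘ suc) ⊛ g) k

  integral-exp : ∀ z → Integralˢ (exp (ι z))
  integral-exp z k k<N = subst Integral (sym (/!-def (ι z ^ k) k))
    (integral-* (integral-^ k (integral-ι z)) (integral-1/! k (ℕ.<-trans (ℕ.n<1+n k) (<N⇒<p k<N))))

  integral-E : Integralˢ E
  integral-E k k<N = subst Integral
    (sym (trans (ℚ.+-identityʳ (exp 1ℚ (suc k))) (trans (/!-def (1ℚ ^ suc k) (suc k)) (trans (cong (_* (1ℚ /! suc k)) (1^n≡1 (suc k))) (ℚ.*-identityˡ (1ℚ /! suc k))))))
    (integral-1/! (suc k) (<N⇒<p k<N))

  integral-I : Integralˢ I
  integral-I = integral-inverse E I refl E*I integral-E

  -- Write E = 1 + xU. The p-th power is 1 + xᵖUᵖ up to multiples of p, and xᵖUᵖ starts beyond the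
  -- degrees considered.
  E^p∼1 : E ^ˢ p ∼ 1#
  E^p∼1 = coefficientwise λ k k<N → subst (𝔭 1) (sym (begin
    (E ^ˢ p) k - 1# k                              ≡⟨ cong (_- 1# k) (ℚ⟦x⟧.^-congˡ p {E} {W +ˢ 1#} E≈W+1 k) ⟩
    ((W +ˢ 1#) ^ˢ p) k - 1# k                      ≡⟨ cong (_- 1# k) (expansion k) ⟩
    (1# ^ˢ p) k + (m k + (W ^ˢ p) k) - 1# k        ≡⟨ cong₂ (λ a b → a + (m k + b) - 1# k) (1^ˢ p k) (W^p k k<N) ⟩
    1# k + (m k + 0ℚ) - 1# k                       ≡⟨ solve 2 (λ a m → a :+ (m :+ con 0ℚ) :- a := m) refl (1# k) (m k) ⟩
    m k                                            ∎)) (m∈ k k<N)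
    where
    open ≡-Reasoning
    W U : Series
    U = E ∘ suc
    W = X ⊛ U
    E≈W+1 : E ≈ W +ˢ 1#
    E≈W+1 zero    = sym (cong (_+ 1ℚ) (X-⊛-zero U))
    E≈W+1 (suc n) = sym (trans (ℚ.+-identityʳ (W (suc n))) (X-⊛-suc U n))
    W∈ : Integralˢ W
    W∈ zero    _   = subst Integral (sym (X-⊛-zero U)) (integral-ι 0ℤ)
    W∈ (suc k) k<N = subst Integral (sym (X-⊛-suc U k)) (integral-E (suc k) k<N)
    pℤₚ : Series → Set
    pℤₚ f = ∀ k → k ℕ.< N → 𝔭 1 (f k)
    result = Frobenius.frobenius ℚ⟦x⟧.commutativeSemiring pℤₚ (λ _ _ → 𝔭-0) (λ f∈ g∈ k k<N → 𝔭-+ (f∈ k k<N) (g∈ k k<N)) pr W 1#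
      (λ c i j p∣c k k<N → subst (𝔭 1) (sym (trans (×ˢ-coefficient c (W ^ˢ i ⊛ 1# ^ˢ j) k) (ℚ.*-comm (ι (+ c)) _)))
        (𝔭-* (integral-⊛ (integral-^ˢ i W∈) (integral-^ˢ j integral-one) k k<N) (∣⇒𝔭 (+ c) p∣c)))
    m : Series
    m = proj₁ result
    m∈ : pℤₚ m
    m∈ = proj₁ (proj₂ result)
    expansion : (W +ˢ 1#) ^ˢ p ≈ 1# ^ˢ p +ˢ (m +ˢ W ^ˢ p)
    expansion = proj₂ (proj₂ result)
    W^p : ∀ k → k ℕ.< N → (W ^ˢ p) k ≡ 0ℚ
    W^p k k<N = trans (ℚ⟦x⟧^.^-distrib-* X U p k)
      (X^-⊛-< p (U ^ˢ p) k (ℕ.<-trans (ℕ.n<1+n k) (<N⇒<p k<N)))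

  E^-periodic : ∀ n q → E ^ˢ (n ℕ.+ p ℕ.* q) ∼ E ^ˢ n
  E^-periodic n q = ∼-trans (≈⇒∼ {E ^ˢ (n ℕ.+ p ℕ.* q)} {E ^ˢ n ⊛ (E ^ˢ p) ^ˢ q} split)
    (⊛-∼-1 {E ^ˢ n} {(E ^ˢ p) ^ˢ q} (integral-^ˢ n integral-E) (^-∼-1 q (integral-^ˢ p integral-E) E^p∼1))
    where
    split : E ^ˢ (n ℕ.+ p ℕ.* q) ≈ E ^ˢ n ⊛ (E ^ˢ p) ^ˢ q
    split k = trans (ℚ⟦x⟧.^-homo-* E n (p ℕ.* q) k) (ℚ⟦x⟧.*-congˡ {E ^ˢ n} {E ^ˢ (p ℕ.* q)} {(E ^ˢ p) ^ˢ q} (λ i → sym (ℚ⟦x⟧.^-assocʳ E p q i)) k)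

  -- Eⁿ = E⁻ᵐEᵐ⁺ⁿ, and Eᵐ⁺ⁿ is a power of Eᵖ.
  E^∼I^ : ∀ m n → p ∣ m ℕ.+ n → E ^ˢ n ∼ I ^ˢ m
  E^∼I^ m n (∣.divides q m+n≡qp) = ∼-trans (≈⇒∼ {E ^ˢ n} {I ^ˢ m ⊛ E ^ˢ (m ℕ.+ n)} split)
    (⊛-∼-1 {I ^ˢ m} {E ^ˢ (m ℕ.+ n)} (integral-^ˢ m integral-I) E^∼1)
    where
    E^∼1 : E ^ˢ (m ℕ.+ n) ∼ 1#
    E^∼1 = subst (λ k → E ^ˢ k ∼ 1#) (sym (trans m+n≡qp (ℕ.*-comm q p))) (E^-periodic 0 q)
    split : E ^ˢ n ≈ I ^ˢ m ⊛ E ^ˢ (m ℕ.+ n)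
    split = R.begin
      E ^ˢ n                               R.≈⟨ ℚ⟦x⟧.*-identityˡ (E ^ˢ n) ⟨
      1# ⊛ E ^ˢ n                          R.≈⟨ ℚ⟦x⟧.*-congʳ {E ^ˢ n} {(E ⊛ I) ^ˢ m} {1#} (λ k → trans (ℚ⟦x⟧.^-congˡ m {E ⊛ I} {1#} E*I k) (1^ˢ m k)) ⟨
      (E ⊛ I) ^ˢ m ⊛ E ^ˢ n                R.≈⟨ ℚ⟦x⟧.*-congʳ {E ^ˢ n} {(E ⊛ I) ^ˢ m} {E ^ˢ m ⊛ I ^ˢ m} (ℚ⟦x⟧^.^-distrib-* E I m) ⟩
      (E ^ˢ m ⊛ I ^ˢ m) ⊛ E ^ˢ n           R.≈⟨ RS.solve 3 (λ a b c → (a RS.:* b) RS.:* c RS.:= b RS.:* (a RS.:* c)) (λ _ → refl) (E ^ˢ m) (I ^ˢ m) (E ^ˢ n) ⟩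
      I ^ˢ m ⊛ (E ^ˢ m ⊛ E ^ˢ n)           R.≈⟨ ℚ⟦x⟧.*-congˡ {I ^ˢ m} {E ^ˢ (m ℕ.+ n)} {E ^ˢ m ⊛ E ^ˢ n} (ℚ⟦x⟧.^-homo-* E m n) ⟨
      I ^ˢ m ⊛ E ^ˢ (m ℕ.+ n)              R.∎

-- The main congruence

⟦⟧-cong : ∀ {A B : Set} (A? : Dec A) (B? : Dec B) → (A → B) → (B → A) → ⟦ A? ⟧ ≡ ⟦ B? ⟧
⟦⟧-cong (yes a) (yes b) f g = refl
⟦⟧-cong (yes a) (no ¬b) f g = ⊥-elim (¬b (f a))
⟦⟧-cong (no ¬a) (yes b) f g = ⊥-elim (¬a (g b))
⟦⟧-cong (no ¬a) (no ¬b) f g = refl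

⟦⟧-yes : ∀ {A : Set} (A? : Dec A) → A → ⟦ A? ⟧ ≡ 1ℤ
⟦⟧-yes (yes _) _ = refl
⟦⟧-yes (no ¬a) a = ⊥-elim (¬a a)

⟦⟧-no : ∀ {A : Set} (A? : Dec A) → ¬ A → ⟦ A? ⟧ ≡ 0ℤ
⟦⟧-no (yes a) ¬a = ⊥-elim (¬a a)
⟦⟧-no (no _)  _  = refl

w-diagonal : ∀ n → w n n ≡ 1ℤ
w-diagonal zero    = w-zero-zero
w-diagonal (suc n) = trans (w-suc n n) (trans (cong (λ x → w n n ℤ.- x) (w-vanishes n)) (trans (ℤ.+-identityʳ (w n n)) (w-diagonal n)))

module FleckQuotient (p : ℕ) (pr : Prime p) where
  open Local p pr
  open Truncation p pr
  open _∼_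

  -- The indicator of pℤ as a polynomial: Fermat and Wilson

  p≡1+N : p ≡ suc N
  p≡1+N = sym (ℕ.suc-pred p {{prime⇒nonZero pr}})

  N<p : N ℕ.< p
  N<p = subst (N ℕ.<_) (sym p≡1+N) (ℕ.n<1+n N)

  0<N : 0 ℕ.< N
  0<N = ℕ.m<n⇒0<n∸m (ℕ.nonTrivial⇒n>1 p {{prime⇒nonTrivial pr}})

  -- The sign makes `δ (r - k)` test whether p divides k - r, as `Cₚ` does.
  δ : ℤ → ℚ
  δ r = ι ⟦ + p ∣? (ℤ.- r) ⟧

  δ-periodic : ∀ r → δ (r ℤ.- + p) ≡ δ r
  δ-periodic r = cong ι (⟦⟧-cong (+ p ∣? ℤ.- (r ℤ.- + p)) (+ p ∣? ℤ.- r)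
    (λ h → subst (+ p ∣ℤ_) (Z.solve 2 (λ r p → Z.:- (r Z.:- p) Z.:- p Z.:= Z.:- r) refl r (+ p)) (ℤ∣.∣m∣n⇒∣m-n {+ p} {ℤ.- (r ℤ.- + p)} {+ p} h ℤ∣.∣-refl))
    (λ h → subst (+ p ∣ℤ_) (Z.solve 2 (λ r p → Z.:- r Z.:+ p Z.:= Z.:- (r Z.:- p)) refl r (+ p)) (ℤ∣.∣m∣n⇒∣m+n {+ p} {ℤ.- r} {+ p} h ℤ∣.∣-refl)))

  frobenius-ι : ∀ z → 𝔭 1 (ι (1ℤ ℤ.+ z) ^ p - (1ℚ + ι z ^ p))
  frobenius-ι z = subst (𝔭 1) (sym (begin
    ι (1ℤ ℤ.+ z) ^ p - (1ℚ + ι z ^ p)        ≡⟨ cong (λ x → x ^ p - (1ℚ + ι z ^ p)) (trans (ι-+ 1ℤ z) (ℚ.+-comm 1ℚ (ι z))) ⟩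
    (ι z + 1ℚ) ^ p - (1ℚ + ι z ^ p)          ≡⟨ cong (_- (1ℚ + ι z ^ p)) (proj₂ (proj₂ result)) ⟩
    1ℚ ^ p + (m + ι z ^ p) - (1ℚ + ι z ^ p)  ≡⟨ cong (λ x → x + (m + ι z ^ p) - (1ℚ + ι z ^ p)) (1^n≡1 p) ⟩
    1ℚ + (m + ι z ^ p) - (1ℚ + ι z ^ p)      ≡⟨ solve 2 (λ m y → con 1ℚ :+ (m :+ y) :- (con 1ℚ :+ y) := m) refl m (ι z ^ p) ⟩
    m                                        ∎)) (proj₁ (proj₂ result))
    where
    open ≡-Reasoning
    open Mult (CommutativeSemiring.semiring (CommutativeRing.commutativeSemiring ℚ.+-*-commutativeRing)) using () renaming (_×_ to _×ℚ_)
    ×ℚ-ι : ∀ c x → c ×ℚ x ≡ x * ι (+ c)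
    ×ℚ-ι zero    x = sym (ℚ.*-zeroʳ x)
    ×ℚ-ι (suc c) x = trans (cong (_+_ x) (×ℚ-ι c x))
      (trans (solve 2 (λ x c → x :+ x :* c := x :* (con 1ℚ :+ c)) refl x (ι (+ c))) (cong (x *_) (sym (ι-suc c))))
    result = Frobenius.frobenius (CommutativeRing.commutativeSemiring ℚ.+-*-commutativeRing) (𝔭 1) 𝔭-0 𝔭-+ pr (ι z) 1ℚ
      (λ c i j p∣c → subst (𝔭 1) (sym (×ℚ-ι c (ι z ^ i * 1ℚ ^ j)))
        (𝔭-* (integral-* (integral-^ i (integral-ι z)) (integral-^ j (integral-ι 1ℤ))) (∣⇒𝔭 (+ c) p∣c)))
    m : ℚ
    m = proj₁ result

  -- By (1 + z)ᵖ ≡ 1 + zᵖ the claims for z and 1 + z are equivalent, so it spreads from 0 upwards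
  -- and downwards.
  fermat : ∀ z → 𝔭 1 (ι z ^ p - ι z)
  fermat (+ n) = nonnegative n
    where
    nonnegative : ∀ n → 𝔭 1 (ι (+ n) ^ p - ι (+ n))
    nonnegative zero    = subst (λ q → 𝔭 1 (0ℚ ^ q - 0ℚ)) (sym p≡1+N) (𝔭-≡ (ℚ.*-zeroˡ (0ℚ ^ N)))
    nonnegative (suc n) = subst (𝔭 1)
      (trans (solve 3 (λ a b c → a :- (con 1ℚ :+ b) :+ (b :- c) := a :- (con 1ℚ :+ c)) refl (ι (+ suc n) ^ p) (ι (+ n) ^ p) (ι (+ n)))
        (cong (_-_ (ι (+ suc n) ^ p)) (sym (ι-suc n))))
      (𝔭-+ (frobenius-ι (+ n)) (nonnegative n))
  fermat -[1+ n ] = negative n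
    where
    1+z : ∀ z → ι (1ℤ ℤ.+ z) - 1ℚ ≡ ι z
    1+z z = trans (cong (_- 1ℚ) (ι-+ 1ℤ z)) (solve 1 (λ z → con 1ℚ :+ z :- con 1ℚ := z) refl (ι z))
    descend : ∀ z → 𝔭 1 (ι (1ℤ ℤ.+ z) ^ p - ι (1ℤ ℤ.+ z)) → 𝔭 1 (ι z ^ p - ι z)
    descend z h = subst (𝔭 1)
      (trans (solve 3 (λ a b c → (a :- b) :- (a :- (con 1ℚ :+ c)) := c :- (b :- con 1ℚ)) refl (ι (1ℤ ℤ.+ z) ^ p) (ι (1ℤ ℤ.+ z)) (ι z ^ p))
        (cong (_-_ (ι z ^ p)) (1+z z)))
      (𝔭-- h (frobenius-ι z))
    negative : ∀ n → 𝔭 1 (ι -[1+ n ] ^ p - ι -[1+ n ])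
    negative zero    = descend -[1+ 0 ] (fermat (+ 0))
    negative (suc n) = descend -[1+ suc n ] (negative n)

  -- For z prime to p, cancel z in zᵖ ≡ z; otherwise zᴺ ≡ 0 because N > 0. So modulo p the indicator
  -- of pℤ is a polynomial of degree N, to which differences can be applied.
  fermat-N : ∀ z → 𝔭 1 (ι z ^ N - (1ℚ - ι ⟦ + p ∣? z ⟧))
  fermat-N z = go (+ p ∣? z)
    where
    power : ∀ n → 0 ℕ.< n → p ∣ ℤ.∣ z ∣ → 𝔭 1 (ι z ^ n)
    power (suc n) _ p∣z = subst (𝔭 1) (ℚ.*-comm (ι z ^ n) (ι z)) (𝔭-* (integral-^ n (integral-ι z)) (∣⇒𝔭 z p∣z))
    go : (d : Dec (+ p ∣ℤ z)) → 𝔭 1 (ι z ^ N - (1ℚ - ι ⟦ d ⟧))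
    go (yes p∣z) = subst (𝔭 1) (solve 1 (λ x → x := x :- (con 1ℚ :- con 1ℚ)) refl (ι z ^ N)) (power N 0<N (ℤ∣.∣⇒∣ᵤ p∣z))
    go (no p∤z) = 𝔭-cancel z (λ h → p∤z (ℤ∣.∣ᵤ⇒∣ h))
      (subst (𝔭 1) (trans (cong (λ q → ι z ^ q - ι z) p≡1+N) (solve 2 (λ z y → z :* y :- z := z :* (y :- (con 1ℚ :- con 0ℚ))) refl (ι z) (ι z ^ N))) (fermat z))

  w∈ : ∀ k → k ℕ.< N → 𝔭 1 (ι (w p (suc k)))
  w∈ k k<N = ∣⇒𝔭 (w p (suc k)) (subst (p ∣_) (sym (trans (cong ℤ.∣_∣ (w-def p (suc k))) abs))
    (∣.∣n⇒∣m*n ℤ.∣ -1ℤ ℤ.^ p ∣ (∣.∣m⇒∣m*n ℤ.∣ -1ℤ ℤ.^ suc k ∣ (p∣pCk pr ℕ.z<s (<N⇒<p k<N)))))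
    where
    abs : ℤ.∣ -1ℤ ℤ.^ p ℤ.* (+ (p C suc k) ℤ.* -1ℤ ℤ.^ suc k) ∣ ≡ ℤ.∣ -1ℤ ℤ.^ p ∣ ℕ.* ((p C suc k) ℕ.* ℤ.∣ -1ℤ ℤ.^ suc k ∣)
    abs = trans (ℤ.abs-* (-1ℤ ℤ.^ p) (+ (p C suc k) ℤ.* -1ℤ ℤ.^ suc k)) (cong (ℤ.∣ -1ℤ ℤ.^ p ∣ ℕ.*_) (ℤ.abs-* (+ (p C suc k)) (-1ℤ ℤ.^ suc k)))

  -- `w p (suc k)` = `w N k` - `w N (suc k)` is divisible by p, so the weights of ∇ᴺ agree modulo p;
  -- the last of them is 1.
  w≡1 : ∀ k → k ℕ.≤ N → 𝔭 1 (1ℚ - ι (w N k))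
  w≡1 k k≤N = 𝔭-trans 1ℚ (ι (w N 0)) (ι (w N k))
    (𝔭-sym (ι (w N 0)) 1ℚ (subst (λ z → 𝔭 1 (ι (w N 0) - ι z)) (w-diagonal N) (constant N ℕ.≤-refl)))
    (constant k k≤N)
    where
    constant : ∀ k → k ℕ.≤ N → 𝔭 1 (ι (w N 0) - ι (w N k))
    constant zero    _   = 𝔭-≡ {x = ι (w N 0)} refl
    constant (suc k) k<N = 𝔭-trans (ι (w N 0)) (ι (w N k)) (ι (w N (suc k))) (constant k (ℕ.<⇒≤ k<N))
      (subst (𝔭 1) (trans (cong (λ q → ι (w q (suc k))) p≡1+N) (trans (cong ι (w-suc N k)) (trans (ι-+ (w N k) (ℤ.- w N (suc k))) (cong (_+_ (ι (w N k))) (ι-neg (w N (suc k)))))))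
        (w∈ k k<N))

  φ : ℤ → ℚ
  φ = χ-∇ 1# N

  φ-value : ∀ r → ι (+ (N !)) * φ r ≡ ι (ℤ.- r) ^ N
  φ-value r = begin
    f * (χ r ⊛ 1#) N                 ≡⟨ cong (f *_) (ℚ⟦x⟧.*-identityʳ (χ r) N) ⟩
    f * (ι (ℤ.- r) ^ N /! N)         ≡⟨ cong (f *_) (/!-def (ι (ℤ.- r) ^ N) N) ⟩
    f * (ι (ℤ.- r) ^ N * (1ℚ /! N))  ≡⟨ solve 3 (λ f x g → f :* (x :* g) := x :* (f :* g)) refl f (ι (ℤ.- r) ^ N) (1ℚ /! N) ⟩
    ι (ℤ.- r) ^ N * (f * (1ℚ /! N))  ≡⟨ cong (ι (ℤ.- r) ^ N *_) (1/!-inverse N) ⟩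
    ι (ℤ.- r) ^ N * 1ℚ               ≡⟨ ℚ.*-identityʳ (ι (ℤ.- r) ^ N) ⟩
    ι (ℤ.- r) ^ N                    ∎
    where
    open ≡-Reasoning
    f : ℚ
    f = ι (+ (N !))

  -- N! is the N-th finite difference of xᴺ at 0, whose coefficients w N k are 1 modulo p.
  wilson : 𝔭 1 (ι (+ (N !)) + 1ℚ)
  -- All N summands are 1 modulo p. Removing these N ones and adding p = N + 1 leaves N! + 1.
  wilson = subst (𝔭 1) total (𝔭-+ (𝔭-∑ N (λ k k<N → term k k<N)) (∣⇒𝔭 (+ p) ∣.∣-refl))
    where
    open ≡-Reasoning
    f : ℚ
    f = ι (+ (N !))
    a : ℕ → ℚ
    a k = ι (w N k) * ι (+ k) ^ N
    term : ∀ k → k ℕ.< N → 𝔭 1 (a (suc k) - 1ℚ)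
    term k k<N = subst (𝔭 1) (solve 2 (λ w x → w :* (x :- (con 1ℚ :- con 0ℚ)) :- (con 1ℚ :- w) := w :* x :- con 1ℚ) refl (ι (w N (suc k))) (ι (+ suc k) ^ N))
      (𝔭-- (𝔭-* (integral-ι (w N (suc k)))
             (subst (λ z → 𝔭 1 (ι (+ suc k) ^ N - (1ℚ - ι z))) (⟦⟧-no (+ p ∣? + suc k) (λ h → ℕ.<⇒≱ (<N⇒<p k<N) (∣.∣⇒≤ (ℤ∣.∣⇒∣ᵤ h)))) (fermat-N (+ suc k))))
           (w≡1 (suc k) k<N))
    0^N : ∀ n → 0 ℕ.< n → 0ℚ ^ n ≡ 0ℚ
    0^N (suc n) _ = ℚ.*-zeroˡ (0ℚ ^ n)
    E₀ : ∀ n → (E ^ˢ n) 0 ≡ 1ℚ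
    E₀ zero    = refl
    E₀ (suc n) = trans (ℚ.+-identityʳ (1ℚ * (E ^ˢ n) 0)) (trans (ℚ.*-identityˡ ((E ^ˢ n) 0)) (E₀ n))
    expand : f ≡ ∑ℚ N (a ∘ suc)
    expand = begin
      f                                         ≡⟨ ℚ.*-identityʳ f ⟨
      f * 1ℚ                                    ≡⟨ cong (f *_) top ⟨
      f * ∇^ N φ 0ℤ                             ≡⟨ cong (f *_) (∇^-expansion N φ 0ℤ) ⟩
      f * ∑ℚ (suc N) (λ k → ι (w N k) * φ (0ℤ ℤ.- + k))
        ≡⟨ ∑-* (suc N) f (λ k → ι (w N k) * φ (0ℤ ℤ.- + k)) ⟩
      ∑ℚ (suc N) (λ k → f * (ι (w N k) * φ (0ℤ ℤ.- + k)))
        ≡⟨ ∑-cong (suc N) (λ k _ → trans (solve 3 (λ f w x → f :* (w :* x) := w :* (f :* x)) refl f (ι (w N k)) (φ (0ℤ ℤ.- + k)))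
             (cong (ι (w N k) *_) (trans (φ-value (0ℤ ℤ.- + k)) (cong (λ z → ι z ^ N) (trans (cong ℤ.-_ (ℤ.+-identityˡ (ℤ.- + k))) (ℤ.neg-involutive (+ k))))))) ⟩
      ∑ℚ (suc N) a
        ≡⟨ cong (λ x → ι (w N 0) * x + ∑ℚ N (a ∘ suc)) (0^N N 0<N) ⟩
      ι (w N 0) * 0ℚ + ∑ℚ N (a ∘ suc)
        ≡⟨ solve 2 (λ w s → w :* con 0ℚ :+ s := s) refl (ι (w N 0)) (∑ℚ N (a ∘ suc)) ⟩
      ∑ℚ N (a ∘ suc)                            ∎
      where
      top : ∇^ N φ 0ℤ ≡ 1ℚ
      top = trans (cong (λ n → ∇^ N (χ-∇ 1# n) 0ℤ) (sym (ℕ.+-identityʳ N))) (trans (∇^-χ-≥ N 1# 0 0ℤ)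
        (trans (ℚ.+-identityʳ (1ℚ * (E ^ˢ N ⊛ 1#) 0)) (trans (ℚ.*-identityˡ ((E ^ˢ N ⊛ 1#) 0)) (trans (ℚ⟦x⟧.*-identityʳ (E ^ˢ N) 0) (E₀ N)))))
    ∑-minus-1 : ∀ n (g : ℕ → ℚ) → ∑ℚ n (λ k → g k - 1ℚ) + ι (+ suc n) ≡ ∑ℚ n g + 1ℚ
    ∑-minus-1 zero    g = refl
    ∑-minus-1 (suc n) g = begin
      g 0 - 1ℚ + s + ι (+ suc (suc n))     ≡⟨ cong (_+_ (g 0 - 1ℚ + s)) (ι-suc (suc n)) ⟩
      g 0 - 1ℚ + s + (1ℚ + ι (+ suc n))    ≡⟨ solve 3 (λ g s i → g :- con 1ℚ :+ s :+ (con 1ℚ :+ i) := g :+ (s :+ i)) refl (g 0) s (ι (+ suc n)) ⟩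
      g 0 + (s + ι (+ suc n))              ≡⟨ cong (_+_ (g 0)) (∑-minus-1 n (g ∘ suc)) ⟩
      g 0 + (∑ℚ n (g ∘ suc) + 1ℚ)          ≡⟨ ℚ.+-assoc (g 0) (∑ℚ n (g ∘ suc)) 1ℚ ⟨
      g 0 + ∑ℚ n (g ∘ suc) + 1ℚ            ∎
      where
      s : ℚ
      s = ∑ℚ n (λ k → g (suc k) - 1ℚ)
    total : ∑ℚ N (λ k → a (suc k) - 1ℚ) + π ≡ f + 1ℚ
    total = trans (cong (λ q → ∑ℚ N (λ k → a (suc k) - 1ℚ) + ι (+ q)) p≡1+N)
      (trans (∑-minus-1 N (a ∘ suc)) (cong (_+ 1ℚ) (sym expand)))

  -- By Wilson φ(r) = (-r)ᴺ/N! ≡ -(-r)ᴺ, and by Fermat (-r)ᴺ ≡ 1 - δ(r). The proof works with the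
  -- N!-fold, to stay with integers.
  δ-φ≡1 : ∀ r → 𝔭 1 (δ r - φ r - 1ℚ)
  δ-φ≡1 r = 𝔭-cancel (+ (N !)) (p∤n! N N<p) (subst (𝔭 1) (begin
    (f + 1ℚ) * (δ r - 1ℚ) - (x ^ N - (1ℚ - δ r))   ≡⟨ solve 3 (λ f d y → (f :+ con 1ℚ) :* (d :- con 1ℚ) :- (y :- (con 1ℚ :- d)) := f :* (d :- con 1ℚ) :- y) refl f (δ r) (x ^ N) ⟩
    f * (δ r - 1ℚ) - x ^ N                         ≡⟨ cong (_-_ (f * (δ r - 1ℚ))) (φ-value r) ⟨
    f * (δ r - 1ℚ) - f * φ r                       ≡⟨ solve 3 (λ f d y → f :* (d :- con 1ℚ) :- f :* y := f :* (d :- y :- con 1ℚ)) refl f (δ r) (φ r) ⟩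
    f * (δ r - φ r - 1ℚ)                           ∎)
    (𝔭-- (subst (𝔭 1) (ℚ.*-comm (δ r - 1ℚ) (f + 1ℚ)) (𝔭-* (integral-+ (integral-ι ⟦ + p ∣? (ℤ.- r) ⟧) (integral-ι -1ℤ)) wilson)) (fermat-N (ℤ.- r))))
    where
    open ≡-Reasoning
    f x : ℚ
    f = ι (+ (N !))
    x = ι (ℤ.- r)

  ∇^-kills-constants : ∀ {b} c {f g} → (∀ r → 𝔭 b (f r - g r - c)) → ∀ n r → 𝔭 b (∇^ (suc n) f r - ∇^ (suc n) g r)
  ∇^-kills-constants {b} c {f} {g} h zero r = subst (𝔭 b)
    (solve 5 (λ x y u v c → x :- y :- c :- (u :- v :- c) := x :- u :- (y :- v)) refl (f (r ℤ.- 1ℤ)) (g (r ℤ.- 1ℤ)) (f r) (g r) c)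
    (𝔭-- (h (r ℤ.- 1ℤ)) (h r))
  ∇^-kills-constants {b} c {f} {g} h (suc n) r = subst (𝔭 b)
    (solve 4 (λ x y u v → x :- y :- (u :- v) := x :- u :- (y :- v)) refl (∇^ (suc n) f (r ℤ.- 1ℤ)) (∇^ (suc n) g (r ℤ.- 1ℤ)) (∇^ (suc n) f r) (∇^ (suc n) g r))
    (𝔭-- (∇^-kills-constants c {f} {g} h n (r ℤ.- 1ℤ)) (∇^-kills-constants c {f} {g} h n r))

  -- The operator T

  π-inverse : ∃ λ u → π * u ≡ 1ℚ
  π-inverse = 1/ π , ℚ.*-inverseʳ π
    where
    instance
      π≢0 : ℚ.NonZero π
      π≢0 = ℚ.≢-nonZero (λ π≡0 → ℕ.≢-nonZero⁻¹ p {{prime⇒nonZero pr}} (ℤ.+-injective (ι-injective {+ p} {0ℤ} π≡0)))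

  abstract
    1/π : ℚ
    1/π = proj₁ π-inverse

    π*1/π : π * 1/π ≡ 1ℚ
    π*1/π = proj₂ π-inverse

  π-cancel : ∀ {x y} → π * x ≡ π * y → x ≡ y
  π-cancel {x} {y} eq = trans (sym (unit x)) (trans (cong (1/π *_) eq) (unit y))
    where
    unit : ∀ z → 1/π * (π * z) ≡ z
    unit z = trans (solve 3 (λ u p z → u :* (p :* z) := p :* u :* z) refl 1/π π z) (trans (cong (_* z) π*1/π) (ℚ.*-identityˡ z))

  -- The exact quotient (1 - `w N k`)/p, in ℤ₍ₚ₎ for k < p by `w≡1`. Keeping it exact, and not only
  -- modulo p, is what lets each step gain a factor p.
  h : ℕ → ℚ
  h k = 1/π * (1ℚ - ι (w N k))

  π*h : ∀ k → π * h k ≡ 1ℚ - ι (w N k)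
  π*h k = trans (sym (ℚ.*-assoc π 1/π (1ℚ - ι (w N k)))) (trans (cong (_* (1ℚ - ι (w N k))) π*1/π) (ℚ.*-identityˡ (1ℚ - ι (w N k))))

  𝔭-quotient : ∀ {x} → 𝔭 1 (π * x) → Integral x
  𝔭-quotient (multiple {z} z∈ eq) = subst Integral (π-cancel (trans (cong (_* z) (sym (ℚ.*-identityʳ π))) (sym eq))) z∈

  integral-h : ∀ k → k ℕ.< p → Integral (h k)
  integral-h k k<p = 𝔭-quotient (subst (𝔭 1) (sym (π*h k)) (w≡1 k (ℕ.≤-pred (subst (k ℕ.<_) p≡1+N k<p))))

  -- Modulo p the weights w N k are all 1, so the N-th difference of f is a full
  -- period sum of f up to p times T f.
  T : (ℤ → ℚ) → ℤ → ℚ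
  T f r = ∑ℚ p λ k → h k * f (r ℤ.- + k)

  π*T : ∀ f r → π * T f r ≡ ∑ℚ p (λ k → f (r ℤ.- + k)) - ∇^ N f r
  π*T f r = begin
    π * T f r
      ≡⟨ ∑-* p π (λ k → h k * f (r ℤ.- + k)) ⟩
    ∑ℚ p (λ k → π * (h k * f (r ℤ.- + k)))
      ≡⟨ ∑-cong p (λ k _ → trans (sym (ℚ.*-assoc π (h k) (f (r ℤ.- + k)))) (trans (cong (_* f (r ℤ.- + k)) (π*h k))
           (solve 2 (λ w x → (con 1ℚ :- w) :* x := x :+ con (- 1ℚ) :* (w :* x)) refl (ι (w N k)) (f (r ℤ.- + k))))) ⟩
    ∑ℚ p (λ k → f (r ℤ.- + k) + - 1ℚ * (ι (w N k) * f (r ℤ.- + k)))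
      ≡⟨ ∑-+ p (λ k → f (r ℤ.- + k)) (λ k → - 1ℚ * (ι (w N k) * f (r ℤ.- + k))) ⟩
    ∑ℚ p (λ k → f (r ℤ.- + k)) + ∑ℚ p (λ k → - 1ℚ * (ι (w N k) * f (r ℤ.- + k)))
      ≡⟨ cong (_+_ (∑ℚ p (λ k → f (r ℤ.- + k)))) (∑-* p (- 1ℚ) (λ k → ι (w N k) * f (r ℤ.- + k))) ⟨
    ∑ℚ p (λ k → f (r ℤ.- + k)) + - 1ℚ * ∑ℚ p (λ k → ι (w N k) * f (r ℤ.- + k))
      ≡⟨ cong (λ s → ∑ℚ p (λ k → f (r ℤ.- + k)) + - 1ℚ * s) (trans (cong (λ q → ∑ℚ q (λ k → ι (w N k) * f (r ℤ.- + k))) p≡1+N) (sym (∇^-expansion N f r))) ⟩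
    ∑ℚ p (λ k → f (r ℤ.- + k)) + - 1ℚ * ∇^ N f r
      ≡⟨ cong (_+_ (∑ℚ p (λ k → f (r ℤ.- + k)))) (sym (neg-mulˡ (∇^ N f r))) ⟩
    ∑ℚ p (λ k → f (r ℤ.- + k)) - ∇^ N f r ∎
    where open ≡-Reasoning

  -- `T` is linear with weights in ℤ₍ₚ₎, so it preserves every power of p in an error.
  T-𝔭 : ∀ {b} c {f g} → (∀ r → 𝔭 b (f r - c * g r)) → ∀ r → 𝔭 b (T f r - c * T g r)
  T-𝔭 {b} c {f} {g} hyp r = subst (𝔭 b) (begin
    ∑ℚ p (λ k → h k * (f (r ℤ.- + k) - c * g (r ℤ.- + k)))
      ≡⟨ ∑-cong p (λ k _ → solve 4 (λ h f c g → h :* (f :- c :* g) := h :* f :+ :- c :* (h :* g)) refl (h k) (f (r ℤ.- + k)) c (g (r ℤ.- + k))) ⟩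
    ∑ℚ p (λ k → h k * f (r ℤ.- + k) + - c * (h k * g (r ℤ.- + k)))
      ≡⟨ ∑-+ p (λ k → h k * f (r ℤ.- + k)) (λ k → - c * (h k * g (r ℤ.- + k))) ⟩
    T f r + ∑ℚ p (λ k → - c * (h k * g (r ℤ.- + k)))
      ≡⟨ cong (_+_ (T f r)) (trans (sym (∑-* p (- c) (λ k → h k * g (r ℤ.- + k)))) (sym (ℚ.neg-distribˡ-* c (T g r)))) ⟩
    T f r - c * T g r ∎)
    (𝔭-∑ p (λ k k<p → 𝔭-* (integral-h k k<p) (hyp (r ℤ.- + k))))
    where open ≡-Reasoning

  -- By `π*T`, ∇ᴺf is the sum of f over a period minus p T f. For f = ∇(∇ⁿδ) that sum telescopes,
  -- and periodicity makes it 0.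
  ∇^δ-step : ∀ n r → ∇^ (N ℕ.+ suc n) δ r ≡ - π * T (∇^ (suc n) δ) r
  ∇^δ-step n r = begin
    ∇^ (N ℕ.+ suc n) δ r                       ≡⟨ ∇^-+ N (suc n) δ r ⟩
    ∇^ N f r                                   ≡⟨ solve 2 (λ x s → x := s :- (s :- x)) refl (∇^ N f r) s ⟩
    s - (s - ∇^ N f r)                         ≡⟨ cong₂ _-_ period (sym (π*T f r)) ⟩
    0ℚ - π * T f r                             ≡⟨ solve 2 (λ p t → con 0ℚ :- p :* t := :- p :* t) refl π (T f r) ⟩
    - π * T f r                                ∎
    where
    open ≡-Reasoning
    f : ℤ → ℚ
    f = ∇^ (suc n) δ
    s : ℚ
    s = ∑ℚ p (λ k → f (r ℤ.- + k))
    period : s ≡ 0ℚ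
    period = trans (∑-∇ p (∇^ n δ) r)
      (trans (cong (_- ∇^ n δ r) (∇^-shift-invariant (+ p) δ δ-periodic n r)) (ℚ.+-inverseʳ (∇^ n δ r)))

  -- Q = (eᵖˣ - 1)/(px).
  Q : Series
  Q n = π ^ n /! suc n

  exp-π : exp π ≈ 1# +ˢ κ π ⊛ (X ⊛ Q)
  exp-π zero    = sym (cong (_+_ 1ℚ) (trans (κ-⊛ π (X ⊛ Q) 0) (trans (cong (π *_) (X-⊛-zero Q)) (ℚ.*-zeroʳ π))))
  exp-π (suc n) = sym (trans (ℚ.+-identityˡ ((κ π ⊛ (X ⊛ Q)) (suc n))) (trans (κ-X π Q n)
    (sym (ℚ.*-assoc π (π ^ n) (_/_ 1ℤ (suc n !) {{suc n ℕ.!≢0}})))))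

  -- The coefficient pᵏ/(k + 1)! keeps its factor p for 0 < k < N, because (k + 1)! is prime to p.
  Q∼1 : Q ∼ 1#
  Q∼1 = coefficientwise λ where
    zero    _   → 𝔭-≡ {x = 1ℚ} refl
    (suc k) k<N → subst (𝔭 1) (trans (sym (/!-def (π ^ suc k) (suc (suc k)))) (sym (ℚ.+-identityʳ (Q (suc k)))))
      (subst (𝔭 1) (solve 3 (λ p y c → y :* c :* p := p :* y :* c) refl π (π ^ k) (1ℚ /! suc (suc k)))
        (𝔭-* (integral-* (integral-^ k (integral-ι (+ p))) (integral-1/! (suc (suc k)) (<N⇒<p k<N))) (∣⇒𝔭 (+ p) ∣.∣-refl)))

  ∇-χ-E : ∀ g j r → ∇ (χ-∇ g (suc j)) r ≡ χ-∇ (E ⊛ g) j r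
  ∇-χ-E g j r = trans (∇-χ g (suc j) r) (trans (eq (suc j)) (X-⊛-suc (χ r ⊛ (E ⊛ g)) j))
    where
    eq : χ r ⊛ (D ⊛ g) ≈ X ⊛ (χ r ⊛ (E ⊛ g))
    eq = R.begin
      χ r ⊛ (D ⊛ g)          R.≈⟨ ℚ⟦x⟧.*-congˡ {χ r} {D ⊛ g} {(X ⊛ E) ⊛ g} (ℚ⟦x⟧.*-congʳ {g} {D} {X ⊛ E} D≈X*E) ⟩
      χ r ⊛ ((X ⊛ E) ⊛ g)    R.≈⟨ RS.solve 4 (λ c x e g → c RS.:* ((x RS.:* e) RS.:* g) RS.:= x RS.:* (c RS.:* (e RS.:* g))) (λ _ → refl) (χ r) X E g ⟩
      X ⊛ (χ r ⊛ (E ⊛ g))    R.∎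

  -- The function is the difference of the coefficient of degree j + 1 of e⁻ʳˣEⁿ, so its period sum
  -- telescopes to multiplication by eᵖˣ - 1 = pxQ, while its N-th difference vanishes as j < N.
  -- This is an identity in ℚ: degree j + 1 may be N, where integrality fails.
  T-χ : ∀ n j r → j ℕ.< N → T (χ-∇ (E ^ˢ suc n) j) r ≡ (χ r ⊛ (E ^ˢ n ⊛ Q)) j
  T-χ n j r j<N = π-cancel (begin
    π * T f r
      ≡⟨ π*T f r ⟩
    ∑ℚ p (λ k → f (r ℤ.- + k)) - ∇^ N f r
      ≡⟨ cong₂ _-_ (∑-cong p (λ k _ → sym (∇-χ-E g j (r ℤ.- + k)))) (∇^-χ-< N (E ^ˢ suc n) j r j<N) ⟩
    ∑ℚ p (λ k → ∇ (χ-∇ g (suc j)) (r ℤ.- + k)) - 0ℚ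
      ≡⟨ ℚ.+-identityʳ (∑ℚ p (λ k → ∇ (χ-∇ g (suc j)) (r ℤ.- + k))) ⟩
    ∑ℚ p (λ k → ∇ (χ-∇ g (suc j)) (r ℤ.- + k))
      ≡⟨ ∑-∇ p (χ-∇ g (suc j)) r ⟩
    (χ (r ℤ.- + p) ⊛ g) (suc j) - (χ r ⊛ g) (suc j)
      ≡⟨ cong (_- (χ r ⊛ g) (suc j)) (shifted (suc j)) ⟩
    (χ r ⊛ g) (suc j) + (κ π ⊛ (X ⊛ (χ r ⊛ (g ⊛ Q)))) (suc j) - (χ r ⊛ g) (suc j)
      ≡⟨ solve 2 (λ a b → a :+ b :- a := b) refl ((χ r ⊛ g) (suc j)) ((κ π ⊛ (X ⊛ (χ r ⊛ (g ⊛ Q)))) (suc j)) ⟩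
    (κ π ⊛ (X ⊛ (χ r ⊛ (g ⊛ Q)))) (suc j)
      ≡⟨ κ-X π (χ r ⊛ (g ⊛ Q)) j ⟩
    π * (χ r ⊛ (g ⊛ Q)) j ∎)
    where
    open ≡-Reasoning
    g : Series
    g = E ^ˢ n
    f : ℤ → ℚ
    f = χ-∇ (E ^ˢ suc n) j
    shifted : χ (r ℤ.- + p) ⊛ g ≈ χ r ⊛ g +ˢ κ π ⊛ (X ⊛ (χ r ⊛ (g ⊛ Q)))
    shifted = R.begin
      χ (r ℤ.- + p) ⊛ g                      R.≈⟨ ℚ⟦x⟧.*-congʳ {g} {χ (r ℤ.- + p)} {χ r ⊛ exp π} (χ-shift r (+ p)) ⟩
      (χ r ⊛ exp π) ⊛ g                      R.≈⟨ ℚ⟦x⟧.*-congʳ {g} {χ r ⊛ exp π} {χ r ⊛ (1# +ˢ κ π ⊛ (X ⊛ Q))} (ℚ⟦x⟧.*-congˡ {χ r} {exp π} {1# +ˢ κ π ⊛ (X ⊛ Q)} exp-π) ⟩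
      (χ r ⊛ (1# +ˢ κ π ⊛ (X ⊛ Q))) ⊛ g      R.≈⟨ RS.solve 5 (λ c k x q g → (c RS.:* (RS.con 1 RS.:+ k RS.:* (x RS.:* q))) RS.:* g RS.:= c RS.:* g RS.:+ k RS.:* (x RS.:* (c RS.:* (g RS.:* q))))
                                                  (λ _ → refl) (χ r) (κ π) X Q g ⟩
      χ r ⊛ g +ˢ κ π ⊛ (X ⊛ (χ r ⊛ (g ⊛ Q))) R.∎

  -- Q ≡ 1 leaves Eⁿ, and Eⁿ ≡ Eⁿ⁺ᵖ; since n + p = N + (n + 1), this is the exponent required after
  -- N more differences.
  T-χ∼ : ∀ n j r → j ℕ.< N → 𝔭 1 (T (χ-∇ (E ^ˢ suc n) j) r - χ-∇ (E ^ˢ (N ℕ.+ suc n)) j r)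
  T-χ∼ n j r j<N = subst (λ x → 𝔭 1 (x - χ-∇ (E ^ˢ (N ℕ.+ suc n)) j r)) (sym (T-χ n j r j<N))
    (at (⊛-∼ˡ {χ r} {E ^ˢ n ⊛ Q} {E ^ˢ (N ℕ.+ suc n)} (integral-exp (ℤ.- r))
      (∼-trans (⊛-∼-1 {E ^ˢ n} {Q} (integral-^ˢ n integral-E) Q∼1)
        (∼-sym (subst (λ k → E ^ˢ k ∼ E ^ˢ n) exponent (E^-periodic n 1))))) j j<N)
    where
    exponent : n ℕ.+ p ℕ.* 1 ≡ N ℕ.+ suc n
    exponent = trans (cong (n ℕ.+_) (trans (ℕ.*-identityʳ p) p≡1+N)) (trans (ℕ.+-suc n N) (trans (cong suc (ℕ.+-comm n N)) (sym (ℕ.+-suc N n))))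

  𝔭-[-π]^ : ∀ a {b x} → 𝔭 b x → 𝔭 (a ℕ.+ b) ((- π) ^ a * x)
  𝔭-[-π]^ zero    {b} {x} x∈ = subst (𝔭 b) (sym (ℚ.*-identityˡ x)) x∈
  𝔭-[-π]^ (suc a) {b} {x} x∈ = subst (𝔭 (suc (a ℕ.+ b))) (solve 3 (λ p q x → :- (p :* (q :* x)) := :- p :* q :* x) refl π ((- π) ^ a) x)
    (𝔭-neg (𝔭-π (𝔭-[-π]^ a x∈)))

  ∇^δ≡χ : ∀ a b → b ℕ.< N → ∀ r → let n = suc (b ℕ.+ a ℕ.* N) in
          𝔭 (suc a) (∇^ n δ r - (- π) ^ a * χ-∇ (E ^ˢ n) (N ∸ suc b) r)
  -- One difference already removes the constant 1 from δ - φ; the `suc b` ≤ N differences take φ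
  -- from degree N down to degree N - (b + 1), with a factor E for each.
  ∇^δ≡χ zero b b<N r = subst (λ n → 𝔭 1 (∇^ (suc n) δ r - 1ℚ * χ-∇ (E ^ˢ suc n) (N ∸ suc b) r)) (sym (ℕ.+-identityʳ b))
    (subst (λ x → 𝔭 1 (∇^ (suc b) δ r - x)) value (∇^-kills-constants 1ℚ {δ} {φ} δ-φ≡1 b r))
    where
    value : ∇^ (suc b) φ r ≡ 1ℚ * χ-∇ (E ^ˢ suc b) (N ∸ suc b) r
    value = trans (cong (λ n → ∇^ (suc b) (χ-∇ 1# n) r) (sym (ℕ.m+[n∸m]≡n b<N)))
      (trans (∇^-χ-≥ (suc b) 1# (N ∸ suc b) r)
        (trans (ℚ⟦x⟧.*-congˡ {χ r} {E ^ˢ suc b ⊛ 1#} {E ^ˢ suc b} (ℚ⟦x⟧.*-identityʳ (E ^ˢ suc b)) (N ∸ suc b)) (sym (ℚ.*-identityˡ _))))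
  -- Two errors meet in pᵃ⁺²ℤ₍ₚ₎: the inductive one, kept by `T` and then multiplied by p, and that
  -- of `T-χ∼`, known only modulo p but multiplied by (-p)ᵃ⁺¹.
  ∇^δ≡χ (suc a) b b<N r = subst (λ n → 𝔭 (suc (suc a)) (∇^ n δ r - (- π) ^ suc a * χ-∇ (E ^ˢ n) j r)) exponent
    (subst (𝔭 (suc (suc a))) split (𝔭-- (subst (λ b → 𝔭 b ((- π) ^ suc a * (T G r - G′ r))) (ℕ.+-comm (suc a) 1) (𝔭-[-π]^ (suc a) (T-χ∼ m j r j<N)))
      (𝔭-π (T-𝔭 ((- π) ^ a) {∇^ (suc m) δ} {G} (∇^δ≡χ a b b<N) r))))
    where
    open ≡-Reasoning
    m j : ℕ
    m = b ℕ.+ a ℕ.* N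
    j = N ∸ suc b
    j<N : j ℕ.< N
    j<N = ℕ.∸-monoʳ-< {N} {suc b} {0} ℕ.z<s b<N
    G G′ : ℤ → ℚ
    G = χ-∇ (E ^ˢ suc m) j
    G′ = χ-∇ (E ^ˢ (N ℕ.+ suc m)) j
    exponent : N ℕ.+ suc m ≡ suc (b ℕ.+ suc a ℕ.* N)
    exponent = trans (ℕ.+-suc N m) (cong suc (trans (sym (ℕ.+-assoc N b (a ℕ.* N))) (trans (cong (ℕ._+ a ℕ.* N) (ℕ.+-comm N b)) (ℕ.+-assoc b N (a ℕ.* N)))))
    split : (- π) ^ suc a * (T G r - G′ r) - π * (T (∇^ (suc m) δ) r - (- π) ^ a * T G r) ≡ ∇^ (N ℕ.+ suc m) δ r - (- π) ^ suc a * G′ r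
    split = trans (solve 5 (λ p q t g s → :- p :* q :* (t :- g) :- p :* (s :- q :* t) := :- p :* s :- :- p :* q :* g) refl π ((- π) ^ a) (T G r) (G′ r) (T (∇^ (suc m) δ) r))
      (cong (_- (- π) ^ suc a * G′ r) (sym (∇^δ-step m r)))

-- Fleck quotients

suc-% : ∀ m N .{{_ : NonZero N}} → suc m % N ≡ suc (m % N) % N
suc-% m N = trans (cong (λ x → suc x % N) (ℕ.m≡m%n+[m/n]*n m N)) (ℕ.[m+kn]%n≡m%n (suc (m % N)) (m ℕ./ N) N)

-- If m = b + aN with b < N, then -(m + 1) = (N - 1 - b) - (a + 1)N.
%ℕ-neg-suc : ∀ m N .{{_ : NonZero N}} → -[1+ m ] %ℕ N ≡ N ∸ suc (m % N)
%ℕ-neg-suc m N with ℕ.m≤n⇒m<n∨m≡n (ℕ.m%n<n m N)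
... | inj₁ lt rewrite trans (suc-% m N) (ℕ.m<n⇒m%n≡m lt) = refl
... | inj₂ eq rewrite trans (suc-% m N) (trans (cong (_% N) eq) (ℕ.n%n≡0 N)) = sym (trans (cong (N ∸_) eq) (ℕ.n∸n≡0 N))

-1/ℕ : ∀ N .{{_ : NonZero N}} → -1ℤ /ℕ N ≡ -1ℤ
-1/ℕ (suc zero)    = refl
-1/ℕ (suc (suc N)) = refl

sign-square : ∀ n → ι (-1ℤ ℤ.^ n) * ι (-1ℤ ℤ.^ n) ≡ 1ℚ
sign-square zero    = refl
sign-square (suc n) = trans (cong₂ _*_ (ι-* -1ℤ (-1ℤ ℤ.^ n)) (ι-* -1ℤ (-1ℤ ℤ.^ n)))
  (trans (solve 1 (λ s → con (- 1ℚ) :* s :* (con (- 1ℚ) :* s) := s :* s) refl (ι (-1ℤ ℤ.^ n))) (sign-square n))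

sign-+ : ∀ m n → ι (-1ℤ ℤ.^ (m ℕ.+ n)) ≡ ι (-1ℤ ℤ.^ m) * ι (-1ℤ ℤ.^ n)
sign-+ m n = trans (cong ι (ℤ.^-distribˡ-+-* -1ℤ m n)) (ι-* (-1ℤ ℤ.^ m) (-1ℤ ℤ.^ n))

^ᶻ-neg : ∀ x .{{_ : ℚ.NonZero x}} a → x ^ᶻ (ℤ.- + a) * x ^ a ≡ 1ℚ
^ᶻ-neg x zero    = refl
^ᶻ-neg x (suc a) = power (suc a)
  where
  power : ∀ n → (1/ x) ^ n * x ^ n ≡ 1ℚ
  power zero    = refl
  power (suc n) = trans (solve 4 (λ u v x y → u :* v :* (x :* y) := u :* x :* (v :* y)) refl (1/ x) ((1/ x) ^ n) x (x ^ n))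
    (trans (cong₂ _*_ (ℚ.*-inverseˡ x) (power n)) refl)

∑-single : ∀ n r (f : ℕ → ℚ) → r ℕ.< n → (∀ k → k ℕ.< n → k ≢ r → f k ≡ 0ℚ) → ∑ℚ n f ≡ f r
∑-single (suc n) zero f _ f≡0 = trans (cong (_+_ (f 0)) (trans (∑-cong n (λ k k<n → f≡0 (suc k) (s≤s k<n) (λ ()))) (∑-0 n))) (ℚ.+-identityʳ (f 0))
  where
  ∑-0 : ∀ n → ∑ℚ n (λ _ → 0ℚ) ≡ 0ℚ
  ∑-0 zero    = refl
  ∑-0 (suc n) = trans (ℚ.+-identityˡ (∑ℚ n (λ _ → 0ℚ))) (∑-0 n)
∑-single (suc n) (suc r) f (s≤s r<n) f≡0 = trans (cong₂ _+_ (f≡0 0 ℕ.z<s (λ ()))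
    (∑-single n r (f ∘ suc) r<n (λ k k<n k≢r → f≡0 (suc k) (s≤s k<n) (λ e → k≢r (ℕ.suc-injective e)))))
  (ℚ.+-identityˡ (f (suc r)))

∑-++ : ∀ m n (f : ℕ → ℚ) → ∑ℚ (m ℕ.+ n) f ≡ ∑ℚ m f + ∑ℚ n (λ k → f (m ℕ.+ k))
∑-++ zero    n f = sym (ℚ.+-identityˡ (∑ℚ n f))
∑-++ (suc m) n f = trans (cong (_+_ (f 0)) (∑-++ m n (f ∘ suc))) (sym (ℚ.+-assoc (f 0) (∑ℚ m (f ∘ suc)) (∑ℚ n (λ k → f (suc m ℕ.+ k)))))

module Congruences (p : ℕ) (pr : Prime p) where
  open Fleck p {{pr}}
  open Local p pr
  open Truncation p pr
  open FleckQuotient p pr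
  open _∼_

  ⋆-suc : ∀ m → suc m ⋆ ≡ N ∸ suc (m % N)
  ⋆-suc m = %ℕ-neg-suc m N

  ⋆-zero : 0 ⋆ ≡ 0
  ⋆-zero = ℕ.m<n⇒m%n≡m 0<N

  ⋆<N : ∀ n → n ⋆ ℕ.< N
  ⋆<N n = n%ℕd<d (ℤ.- + n) N

  ∇^δ≡C : ∀ n r → ∇^ n δ r ≡ ι (-1ℤ ℤ.^ n) * ι (Cₚ n r)
  ∇^δ≡C n r = begin
    ∇^ n δ r
      ≡⟨ ∇^-expansion n δ r ⟩
    ∑ℚ (suc n) (λ k → ι (w n k) * δ (r ℤ.- + k))
      ≡⟨ ∑-cong (suc n) (λ k _ → term k) ⟩
    ∑ℚ (suc n) (λ k → ι (-1ℤ ℤ.^ n) * ι (c k))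
      ≡⟨ ∑-* (suc n) (ι (-1ℤ ℤ.^ n)) (ι ∘ c) ⟨
    ι (-1ℤ ℤ.^ n) * ∑ℚ (suc n) (ι ∘ c)
      ≡⟨ cong (ι (-1ℤ ℤ.^ n) *_) (ι-∑ (suc n) c) ⟨
    ι (-1ℤ ℤ.^ n) * ι (Cₚ n r) ∎
    where
    open ≡-Reasoning
    c : ℕ → ℤ
    c k = ⟦ + p ∣? (+ k ℤ.- r) ⟧ ℤ.* (+ (n C k) ℤ.* -1ℤ ℤ.^ k)
    term : ∀ k → ι (w n k) * δ (r ℤ.- + k) ≡ ι (-1ℤ ℤ.^ n) * ι (c k)
    term k = begin
      ι (w n k) * ι ⟦ + p ∣? (ℤ.- (r ℤ.- + k)) ⟧
        ≡⟨ cong₂ (λ x y → ι x * ι ⟦ + p ∣? y ⟧) (w-def n k) (Z.solve 2 (λ r k → Z.:- (r Z.:- k) Z.:= k Z.:- r) refl r (+ k)) ⟩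
      ι (s ℤ.* b) * ι d                             ≡⟨ cong (_* ι d) (ι-* s b) ⟩
      ι s * ι b * ι d                               ≡⟨ solve 3 (λ s b d → s :* b :* d := s :* (d :* b)) refl (ι s) (ι b) (ι d) ⟩
      ι s * (ι d * ι b)                             ≡⟨ cong (ι s *_) (ι-* d b) ⟨
      ι s * ι (d ℤ.* b)                             ∎
      where
      s b d : ℤ
      s = -1ℤ ℤ.^ n
      b = + (n C k) ℤ.* -1ℤ ℤ.^ k
      d = ⟦ + p ∣? (+ k ℤ.- r) ⟧

  𝔭-divide : ∀ a u {y} → u * (- π) ^ a ≡ 1ℚ → 𝔭 (suc a) y → 𝔭 1 (u * y)
  𝔭-divide a u unit (multiple {z} z∈ eq) = multiple (integral-* (integral-^ a (integral-ι -1ℤ)) z∈) (begin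
    u * _                                        ≡⟨ cong (u *_) eq ⟩
    u * (π * π ^ a * z)                          ≡⟨ cong (λ x → u * (π * x ^ a * z)) (solve 1 (λ x → x := con (- 1ℚ) :* :- x) refl π) ⟩
    u * (π * (- 1ℚ * - π) ^ a * z)               ≡⟨ cong (λ x → u * (π * x * z)) (ℚ^.^-distrib-* (- 1ℚ) (- π) a) ⟩
    u * (π * ((- 1ℚ) ^ a * (- π) ^ a) * z)       ≡⟨ solve 5 (λ u p s q z → u :* (p :* (s :* q) :* z) := u :* q :* (p :* con 1ℚ :* (s :* z))) refl u π ((- 1ℚ) ^ a) ((- π) ^ a) z ⟩
    u * (- π) ^ a * (π * 1ℚ * ((- 1ℚ) ^ a * z))  ≡⟨ cong (_* (π * 1ℚ * ((- 1ℚ) ^ a * z))) unit ⟩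
    1ℚ * (π * 1ℚ * ((- 1ℚ) ^ a * z))             ≡⟨ ℚ.*-identityˡ (π * 1ℚ * ((- 1ℚ) ^ a * z)) ⟩
    π ^ 1 * ((- 1ℚ) ^ a * z)                     ∎)
    where open ≡-Reasoning

  -- For n = m + 1 the exponent of -p in `F` is -⌊m/N⌋, so the main congruence is divided by exactly
  -- the power it carries. For n = 0 it is +1: the sum becomes a multiple of p, and the bracket
  -- supplies the coefficient 1 of E⁰.
  F≡χ : ∀ n r → 𝔭 1 (ι (-1ℤ ℤ.^ n) * F n r - χ-∇ (E ^ˢ n) (n ⋆) r)
  F≡χ zero r = subst (λ j → 𝔭 1 (1ℚ * F 0 r - χ-∇ 1# j r)) (sym ⋆-zero) (subst (𝔭 1) (begin
    π * - c                                     ≡⟨ solve 2 (λ p c → p :* :- c := con 1ℚ :* (:- p :* con 1ℚ :* c :+ con 1ℚ) :- con 1ℚ) refl π c ⟩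
    1ℚ * (- π * 1ℚ * c + 1ℚ) - 1ℚ               ≡⟨ cong (λ x → 1ℚ * (x * 1ℚ * c + 1ℚ) - 1ℚ) (ι-neg (+ p)) ⟨
    1ℚ * (q ^ᶻ 1ℤ * c + 1ℚ) - 1ℚ                ≡⟨ cong (λ e → 1ℚ * (q ^ᶻ (ℤ.- e) * c + 1ℚ) - 1ℚ) (-1/ℕ N) ⟨
    1ℚ * F 0 r - 1ℚ                             ∎)
    (subst (𝔭 1) (ℚ.*-comm (- c) π) (𝔭-* (integral-neg (integral-ι (Cₚ 0 r))) (∣⇒𝔭 (+ p) ∣.∣-refl))))
    where
    open ≡-Reasoning
    q c : ℚ
    q = ι (ℤ.- + p)
    c = ι (Cₚ 0 r)
  F≡χ (suc m) r = subst (λ j → 𝔭 1 (ι s * F (suc m) r - χ-∇ (E ^ˢ suc m) j r)) (sym (⋆-suc m)) (subst (𝔭 1) (begin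
    u * (∇^ (suc m) δ r - (- π) ^ a * G)
      ≡⟨ cong (λ x → u * (x - (- π) ^ a * G)) (∇^δ≡C (suc m) r) ⟩
    u * (ι s * c - (- π) ^ a * G)
      -- The `con 0ℚ` is the bracket for n = 0, which vanishes at a successor.
      ≡⟨ solve 5 (λ u s c q g → u :* (s :* c :- q :* g) := s :* (u :* c :+ con 0ℚ) :- u :* q :* g) refl u (ι s) c ((- π) ^ a) G ⟩
    ι s * F (suc m) r - u * (- π) ^ a * G
      ≡⟨ cong (_-_ (ι s * F (suc m) r)) (trans (cong (_* G) unit) (ℚ.*-identityˡ G)) ⟩
    ι s * F (suc m) r - G ∎)
    (𝔭-divide a u unit (subst (λ n → 𝔭 (suc a) (∇^ (suc n) δ r - (- π) ^ a * χ-∇ (E ^ˢ suc n) (N ∸ suc (m % N)) r))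
      (sym (ℕ.m≡m%n+[m/n]*n m N)) (∇^δ≡χ a (m % N) (ℕ.m%n<n m N) r))))
    where
    open ≡-Reasoning
    a : ℕ
    a = m ℕ./ N
    s : ℤ
    s = -1ℤ ℤ.^ suc m
    u c G : ℚ
    u = ι (ℤ.- + p) ^ᶻ (ℤ.- + a)
    c = ι (Cₚ (suc m) r)
    G = χ-∇ (E ^ˢ suc m) (N ∸ suc (m % N)) r
    unit : u * (- π) ^ a ≡ 1ℚ
    unit = trans (cong (λ x → u * x ^ a) (sym (ι-neg (+ p)))) (^ᶻ-neg (ι (ℤ.- + p)) a)

  χ-0 : ∀ g j → χ-∇ g j 0ℤ ≡ g j
  χ-0 g j = trans (ℚ⟦x⟧.*-congʳ {g} {exp 0ℚ} {1#} exp-0 j) (ℚ⟦x⟧.*-identityˡ g j)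

  E^∼E^% : ∀ n → E ^ˢ n ∼ E ^ˢ (n % p)
  E^∼E^% n = subst (λ k → E ^ˢ k ∼ E ^ˢ (n % p))
    (sym (trans (ℕ.m≡m%n+[m/n]*n n p) (cong (n % p ℕ.+_) (ℕ.*-comm (n ℕ./ p) p))))
    (E^-periodic (n % p) (n ℕ./ p))

  -- At r = 0 the factor e⁻ʳˣ is 1. What remains is a coefficient of Eⁿ in degree n⋆ < N, where the
  -- exponent may be reduced modulo p.
  F≡S̄ : ∀ n → ι (-1ℤ ℤ.^ n) * F n 0ℤ ≡ S̄ (n ⋆ ℕ.+ n % p) (n % p) [mod p ^ 1 ]
  F≡S̄ n = 𝔭⇒≡ x y (𝔭-trans x (c (n ⋆)) y
    (subst (λ z → 𝔭 1 (x - z)) (χ-0 c (n ⋆)) (F≡χ n 0ℤ))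
    (subst (λ z → 𝔭 1 (c (n ⋆) - z)) (E^≡S̄ (n % p) (n ⋆)) (at (E^∼E^% n) (n ⋆) (⋆<N n))))
    where
    c : Series
    c = E ^ˢ n
    x y : ℚ
    x = ι (-1ℤ ℤ.^ n) * F n 0ℤ
    y = S̄ (n ⋆ ℕ.+ n % p) (n % p)

  B/!≡ : ∀ m n t → B⟨ m ⟩ n t /! n ≡ (exp t ⊛ I ^ˢ m) n
  B/!≡ m n t = Existence.egf-b m t n

  S̄≡B : ∀ n m → p ∣ m ℕ.+ n → S̄ (n ⋆ ℕ.+ n % p) (n % p) ≡ B⟨ m ⟩ (n ⋆) 0ℚ /! (n ⋆) [mod p ^ 1 ]
  S̄≡B n m p∣m+n = 𝔭⇒≡ (S̄ (n ⋆ ℕ.+ n % p) (n % p)) (B⟨ m ⟩ (n ⋆) 0ℚ /! (n ⋆)) (subst₂ (λ x y → 𝔭 1 (x - y))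
    (E^≡S̄ (n % p) (n ⋆)) (sym (trans (B/!≡ m (n ⋆) 0ℚ) (χ-0 (I ^ˢ m) (n ⋆))))
    (at (∼-trans (∼-sym (E^∼E^% n)) (E^∼I^ m n p∣m+n)) (n ⋆) (⋆<N n)))

  integral-χ : ∀ m j r → j ℕ.< N → Integral (χ-∇ (I ^ˢ m) j r)
  integral-χ m j r j<N = integral-⊛ {χ r} {I ^ˢ m} (integral-exp (ℤ.- r)) (integral-^ˢ m integral-I) j j<N

  χE≡χI : ∀ m n → p ∣ m ℕ.+ n → ∀ j r → j ℕ.< N → 𝔭 1 (χ-∇ (E ^ˢ n) j r - χ-∇ (I ^ˢ m) j r)
  χE≡χI m n p∣m+n j r j<N = at (⊛-∼ˡ {χ r} {E ^ˢ n} {I ^ˢ m} (integral-exp (ℤ.- r)) (E^∼I^ m n p∣m+n)) j j<N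

  -- Thus pn + p - 1 is n modulo N, which leaves `⋆` unchanged, and -1 modulo p, which turns the
  -- power of E into 1/E and yields the usual Bernoulli polynomials.
  pn+p≡ : ∀ n → p ℕ.* n ℕ.+ p ≡ suc (n ℕ.+ suc n ℕ.* N)
  pn+p≡ n = begin
    p ℕ.* n ℕ.+ p            ≡⟨ ℕ.+-comm (p ℕ.* n) p ⟩
    p ℕ.+ p ℕ.* n            ≡⟨ ℕ.*-suc p n ⟨
    p ℕ.* suc n              ≡⟨ ℕ.*-comm p (suc n) ⟩
    suc n ℕ.* p              ≡⟨ cong (suc n ℕ.*_) p≡1+N ⟩
    suc n ℕ.* suc N          ≡⟨ ℕ.*-suc (suc n) N ⟩
    suc n ℕ.+ suc n ℕ.* N    ∎
    where open ≡-Reasoning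

  pn+p∸1≡ : ∀ n → p ℕ.* n ℕ.+ p ∸ 1 ≡ n ℕ.+ suc n ℕ.* N
  pn+p∸1≡ n = cong (_∸ 1) (pn+p≡ n)

  ⋆-periodic : ∀ n k → (n ℕ.+ k ℕ.* N) ⋆ ≡ n ⋆
  ⋆-periodic (suc m) k = trans (⋆-suc (m ℕ.+ k ℕ.* N)) (trans (cong (λ x → N ∸ suc x) (ℕ.[m+kn]%n≡m%n m k N)) (sym (⋆-suc m)))
  ⋆-periodic zero zero    = refl
  -- `⋆-suc` speaks of successors, so one N is written as `suc M`; its residue N - (M + 1) is 0.
  ⋆-periodic zero (suc k) = begin
    (N ℕ.+ k ℕ.* N) ⋆                 ≡⟨ cong (λ x → (x ℕ.+ k ℕ.* N) ⋆) 1+M≡N ⟨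
    suc (M ℕ.+ k ℕ.* N) ⋆             ≡⟨ ⋆-suc (M ℕ.+ k ℕ.* N) ⟩
    N ∸ suc ((M ℕ.+ k ℕ.* N) % N)     ≡⟨ cong (λ x → N ∸ suc x) (trans (ℕ.[m+kn]%n≡m%n M k N) (ℕ.m<n⇒m%n≡m (subst (M ℕ.<_) 1+M≡N (ℕ.n<1+n M)))) ⟩
    N ∸ suc M                         ≡⟨ cong (N ∸_) 1+M≡N ⟩
    N ∸ N                             ≡⟨ ℕ.n∸n≡0 N ⟩
    0                                 ≡⟨ ⋆-zero ⟨
    0 ⋆                               ∎
    where
    open ≡-Reasoning
    M : ℕ
    M = N ∸ 1
    1+M≡N : suc M ≡ N
    1+M≡N = ℕ.suc-pred N

  -- The sign (-1)ᵖ⁻¹: it is 1 for odd p and -1 for p = 2, hence 1 modulo p in all cases. Using this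
  -- congruence spares a distinction by parity.
  e : ℚ
  e = ι (-1ℤ ℤ.^ N)

  e≡1 : 𝔭 1 (1ℚ - e)
  e≡1 = subst (λ z → 𝔭 1 (1ℚ - ι z)) (w₀ N) (w≡1 0 z≤n)
    where
    w₀ : ∀ n → w n 0 ≡ -1ℤ ℤ.^ n
    w₀ zero    = w-zero-zero
    w₀ (suc n) = trans (w-zero n) (trans (cong ℤ.-_ (w₀ n)) (sym (ℤ.-1*i≡-i (-1ℤ ℤ.^ n))))

  integral-e : Integral e
  integral-e = integral-ι (-1ℤ ℤ.^ N)

  e^≡1 : ∀ k → 𝔭 1 (1ℚ - e ^ k)
  e^≡1 zero    = 𝔭-≡ {x = 1ℚ} refl
  e^≡1 (suc k) = subst (𝔭 1) (solve 2 (λ e x → con 1ℚ :- e :+ e :* (con 1ℚ :- x) := con 1ℚ :- e :* x) refl e (e ^ k))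
    (𝔭-+ e≡1 (𝔭-* integral-e (e^≡1 k)))

  sign-*N : ∀ k → ι (-1ℤ ℤ.^ (k ℕ.* N)) ≡ e ^ k
  sign-*N zero    = refl
  sign-*N (suc k) = trans (sign-+ N (k ℕ.* N)) (cong (e *_) (sign-*N k))

  sign-periodic : ∀ n k → 𝔭 1 (ι (-1ℤ ℤ.^ n) - ι (-1ℤ ℤ.^ (n ℕ.+ k ℕ.* N)))
  sign-periodic n k = subst (𝔭 1)
    (trans (solve 2 (λ s x → s :* (con 1ℚ :- x) := s :- s :* x) refl (ι (-1ℤ ℤ.^ n)) (e ^ k))
      (cong (_-_ (ι (-1ℤ ℤ.^ n))) (sym (trans (sign-+ n (k ℕ.* N)) (cong (ι (-1ℤ ℤ.^ n) *_) (sign-*N k))))))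
    (𝔭-* (integral-ι (-1ℤ ℤ.^ n)) (e^≡1 k))

  F≡B : ∀ n r → ι (-1ℤ ℤ.^ n) * F (p ℕ.* n ℕ.+ p ∸ 1) r ≡ B (n ⋆) (ι (ℤ.- r)) /! (n ⋆) [mod p ^ 1 ]
  F≡B n r = 𝔭⇒≡ (s * F (p ℕ.* n ℕ.+ p ∸ 1) r) (B j (ι (ℤ.- r)) /! j) (subst₂ (λ M β → 𝔭 1 (s * F M r - β)) (sym (pn+p∸1≡ n)) (sym (B/!≡ 1 j (ι (ℤ.- r))))
    (𝔭-trans (s * f) (s′ * f) β (subst (𝔭 1) swap (𝔭-* (integral-* (integral-ι (-1ℤ ℤ.^ n′)) A∈)
      (sign-periodic n (suc n)))) A≡β))
    where
    n′ j : ℕ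
    n′ = n ℕ.+ suc n ℕ.* N
    j = n ⋆
    s s′ f β : ℚ
    s = ι (-1ℤ ℤ.^ n)
    s′ = ι (-1ℤ ℤ.^ n′)
    f = F n′ r
    β = χ-∇ (I ^ˢ 1) j r
    p∣1+n′ : p ∣ 1 ℕ.+ n′
    p∣1+n′ = subst (p ∣_) (pn+p≡ n) (∣.∣m∣n⇒∣m+n (∣.∣m⇒∣m*n n ∣.∣-refl) ∣.∣-refl)
    A≡β : 𝔭 1 (s′ * f - β)
    A≡β = 𝔭-trans (s′ * f) (χ-∇ (E ^ˢ n′) j r) β
      (subst (λ i → 𝔭 1 (s′ * f - χ-∇ (E ^ˢ n′) i r)) (⋆-periodic n (suc n)) (F≡χ n′ r))
      (χE≡χI 1 n′ p∣1+n′ j r (⋆<N n))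
    -- The integrality of the Fleck quotient is obtained here from its congruence to the integral
    -- `β`. It permits trading the sign `s′` for `s`, which agree only modulo p when p = 2.
    A∈ : Integral (s′ * f)
    A∈ = subst Integral (solve 2 (λ a b → a :- b :+ b := a) refl (s′ * f) β) (integral-+ (𝔭⇒integral A≡β) (integral-χ 1 j r (⋆<N n)))
    swap : s′ * (s′ * f) * (s - s′) ≡ s * f - s′ * f
    swap = trans (solve 3 (λ t f s → t :* (t :* f) :* (s :- t) := t :* t :* (s :* f) :- t :* t :* (t :* f)) refl s′ f s)
      (trans (cong (λ x → x * (s * f) - x * (s′ * f)) (sign-square n′))
        (cong₂ _-_ (ℚ.*-identityˡ (s * f)) (ℚ.*-identityˡ (s′ * f))))

  -- Since (N choose j) = ±1 modulo p, this follows from N! = -1.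
  [N∸j]!*j! : ∀ j → j ℕ.≤ N → 𝔭 1 (ι (-1ℤ ℤ.^ j) + ι (+ ((N ∸ j) !)) * ι (+ (j !)))
  [N∸j]!*j! j j≤N = subst (𝔭 1) (begin
    -- Three multiples of p are combined: 1 - `w N j` from the binomial coefficient, N! + 1 from
    -- Wilson, and 1 - `e`.
    M * (1ℚ - ι (w N j)) + s * (e * (f + 1ℚ)) + s * (1ℚ - e)
      ≡⟨ cong (λ x → M * (1ℚ - x) + s * (e * (f + 1ℚ)) + s * (1ℚ - e)) w≡ ⟩
    M * (1ℚ - e * (c * s)) + s * (e * (f + 1ℚ)) + s * (1ℚ - e)
      ≡⟨ solve 5 (λ M e c s f → M :* (con 1ℚ :- e :* (c :* s)) :+ s :* (e :* (f :+ con 1ℚ)) :+ s :* (con 1ℚ :- e)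
           := s :+ M :+ (s :* e) :* (f :- c :* M)) refl M e c s f ⟩
    s + M + (s * e) * (f - c * M)
      ≡⟨ cong (λ x → s + M + (s * e) * (f - x)) cM≡f ⟩
    s + M + (s * e) * (f - f)
      ≡⟨ solve 4 (λ s e f M → s :+ M :+ (s :* e) :* (f :- f) := s :+ M) refl s e f M ⟩
    s + M
      ≡⟨ cong (_+_ s) (ℚ.*-comm (ι (+ (j !))) (ι (+ ((N ∸ j) !)))) ⟩
    s + ι (+ ((N ∸ j) !)) * ι (+ (j !)) ∎)
    (𝔭-+ (𝔭-+ (𝔭-* M∈ (w≡1 j j≤N)) (𝔭-* (integral-ι (-1ℤ ℤ.^ j)) (𝔭-* integral-e wilson))) (𝔭-* (integral-ι (-1ℤ ℤ.^ j)) e≡1))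
    where
    open ≡-Reasoning
    M c s f : ℚ
    M = ι (+ (j !)) * ι (+ ((N ∸ j) !))
    c = ι (+ (N C j))
    s = ι (-1ℤ ℤ.^ j)
    f = ι (+ (N !))
    M∈ : Integral M
    M∈ = integral-* (integral-ι (+ (j !))) (integral-ι (+ ((N ∸ j) !)))
    w≡ : ι (w N j) ≡ e * (c * s)
    w≡ = trans (cong ι (w-def N j)) (trans (ι-* (-1ℤ ℤ.^ N) (+ (N C j) ℤ.* -1ℤ ℤ.^ j)) (cong (e *_) (ι-* (+ (N C j)) (-1ℤ ℤ.^ j))))
    cM≡f : c * M ≡ f
    cM≡f = begin
      c * (ι (+ (j !)) * ι (+ ((N ∸ j) !)))          ≡⟨ cong (c *_) (ι-pos-* (j !) ((N ∸ j) !)) ⟨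
      c * ι (+ (j ! ℕ.* (N ∸ j) !))                  ≡⟨ ι-pos-* (N C j) (j ! ℕ.* (N ∸ j) !) ⟨
      ι (+ ((N C j) ℕ.* (j ! ℕ.* (N ∸ j) !)))        ≡⟨ cong (ι ∘ +_) (nCk*k![n∸k]!≡n! j≤N) ⟩
      f                                              ∎
      where
      ι-pos-* : ∀ a b → ι (+ (a ℕ.* b)) ≡ ι (+ a) * ι (+ b)
      ι-pos-* a b = trans (cong ι (ℤ.pos-* a b)) (ι-* (+ a) (+ b))

  B-def : ∀ m n t → B⟨ m ⟩ n t ≡ (exp t ⊛ I ^ˢ m) n * ι (+ (n !))
  B-def m n t = refl

  -- The symmetry t ↦ 1 - t takes -r to r + 1 at the price of (-1)ʲ. Modulo p this sign is -(N - j)!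
  -- j!, whose j! cancels the denominator.
  B-reflection : ∀ j r → j ℕ.< N → B j (ι (ℤ.- r)) /! j ≡ - ι (+ ((N ∸ j) !)) * B j (ι (r ℤ.+ 1ℤ)) [mod p ^ 1 ]
  B-reflection j r j<N = 𝔭⇒≡ (B j (ι (ℤ.- r)) /! j) (- a * B j (ι (r ℤ.+ 1ℤ))) (subst (𝔭 1) (begin
    β * (s + a * b)                             ≡⟨ solve 4 (λ β s a b → β :* (s :+ a :* b) := s :* β :- (:- a :* (β :* b))) refl β s a b ⟩
    s * β - - a * (β * b)                       ≡⟨ cong₂ (λ x y → x - - a * y) sβ≡α (sym (B-def 1 j (ι (r ℤ.+ 1ℤ)))) ⟩
    α - - a * B j (ι (r ℤ.+ 1ℤ))                ≡⟨ cong (_- - a * B j (ι (r ℤ.+ 1ℤ))) (B/!≡ 1 j (ι (ℤ.- r))) ⟨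
    B j (ι (ℤ.- r)) /! j - - a * B j (ι (r ℤ.+ 1ℤ)) ∎)
    (𝔭-* β∈ ([N∸j]!*j! j (ℕ.<⇒≤ j<N))))
    where
    open ≡-Reasoning
    s a b α β : ℚ
    s = ι (-1ℤ ℤ.^ j)
    a = ι (+ ((N ∸ j) !))
    b = ι (+ (j !))
    α = (exp (ι (ℤ.- r)) ⊛ I ^ˢ 1) j
    β = (exp (ι (r ℤ.+ 1ℤ)) ⊛ I ^ˢ 1) j
    β∈ : Integral β
    β∈ = integral-⊛ {exp (ι (r ℤ.+ 1ℤ))} {I ^ˢ 1} (integral-exp (r ℤ.+ 1ℤ)) (integral-^ˢ 1 integral-I) j j<N
    I^1 : ∀ t → (exp t ⊛ I ^ˢ 1) j ≡ (exp t ⊛ I) j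
    I^1 t = ℚ⟦x⟧.*-congˡ {exp t} {I ^ˢ 1} {I} (ℚ⟦x⟧.*-identityʳ I) j
    sα≡β : s * α ≡ β
    sα≡β = begin
      s * α                                        ≡⟨ cong₂ _*_ (ι-^ -1ℤ j) (I^1 (ι (ℤ.- r))) ⟩
      (- 1ℚ) ^ j * (exp (ι (ℤ.- r)) ⊛ I) j         ≡⟨ exp-⊛I-reflection (ι (ℤ.- r)) j ⟩
      (exp (1ℚ - ι (ℤ.- r)) ⊛ I) j                 ≡⟨ cong (λ t → (exp t ⊛ I) j) (trans (cong (_-_ 1ℚ) (ι-neg r)) (trans (solve 1 (λ r → con 1ℚ :- :- r := r :+ con 1ℚ) refl (ι r)) (sym (ι-+ r 1ℤ)))) ⟩
      (exp (ι (r ℤ.+ 1ℤ)) ⊛ I) j                   ≡⟨ I^1 (ι (r ℤ.+ 1ℤ)) ⟨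
      β                                            ∎
    sβ≡α : s * β ≡ α
    sβ≡α = trans (cong (s *_) (sym sα≡β)) (trans (sym (ℚ.*-assoc s s α)) (trans (cong (_* α) (sign-square j)) (ℚ.*-identityˡ α)))

  -- The binomial congruence modulo p³

  δ-self : ∀ r → δ (r ℤ.- r) ≡ 1ℚ
  δ-self r = cong ι (⟦⟧-yes (+ p ∣? ℤ.- (r ℤ.- r)) (subst (λ z → + p ∣ℤ ℤ.- z) (sym (ℤ.+-inverseʳ r)) (ℤ∣.∣ᵤ⇒∣ {+ p} {0ℤ} (p ∣.∣0))))

  δ-distinct : ∀ r k → r ℕ.< p → k ℕ.< p → k ≢ r → δ (+ r ℤ.- + k) ≡ 0ℚ
  δ-distinct r k r<p k<p k≢r = cong ι (⟦⟧-no (+ p ∣? ℤ.- (+ r ℤ.- + k)) (λ h → absurd (subst (p ∣_) (trans (ℤ.∣-i∣≡∣i∣ (+ r ℤ.- + k)) (cong ℤ.∣_∣ (ℤ.[+m]-[+n]≡m⊖n r k))) (ℤ∣.∣⇒∣ᵤ h))))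
    where
    close : ∀ {m n} → m ℕ.≤ n → n ℕ.< p → p ∣ n ∸ m → m ≡ n
    close {m} {n} m≤n n<p p∣ with n ∸ m in eq
    ... | zero  = ℕ.≤-antisym m≤n (ℕ.m∸n≡0⇒m≤n eq)
    ... | suc d = ⊥-elim (ℕ.<⇒≱ n<p (ℕ.≤-trans (∣.∣⇒≤ p∣) (subst (ℕ._≤ n) eq (ℕ.m∸n≤m n m))))
    absurd : ¬ p ∣ ℤ.∣ r ℤ.⊖ k ∣
    absurd h with ℕ.≤-total r k
    ... | inj₁ r≤k = k≢r (sym (close r≤k k<p (subst (p ∣_) (ℤ.∣⊖∣-≤ r≤k) h)))
    ... | inj₂ k≤r = k≢r (close k≤r r<p (subst (p ∣_) (trans (ℤ.∣m⊖n∣≡∣n⊖m∣ r k) (ℤ.∣⊖∣-≤ k≤r)) h))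

  -- The indices 0, ..., 2p - 1 form two full periods, each of which meets the class of r once, at r
  -- and at p + r.
  ∇^δ-two-terms : ∀ n → suc n ≡ p ℕ.+ p → ∀ r → r ℕ.< p → ∇^ n δ (+ r) ≡ ι (w n r) + ι (w n (p ℕ.+ r))
  ∇^δ-two-terms n 1+n≡2p r r<p = begin
    ∇^ n δ (+ r)                                          ≡⟨ ∇^-expansion n δ (+ r) ⟩
    ∑ℚ (suc n) a                                          ≡⟨ cong (λ q → ∑ℚ q a) 1+n≡2p ⟩
    ∑ℚ (p ℕ.+ p) a                                        ≡⟨ ∑-++ p p a ⟩
    ∑ℚ p a + ∑ℚ p (λ k → a (p ℕ.+ k))                     ≡⟨ cong (_+_ (∑ℚ p a)) (∑-cong p (λ k _ → cong (ι (w n (p ℕ.+ k)) *_) (shift k))) ⟩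
    ∑ℚ p a + ∑ℚ p b                                       ≡⟨ cong₂ _+_ (single (w n)) (single (λ k → w n (p ℕ.+ k))) ⟩
    a r + b r                                             ≡⟨ cong₂ _+_ (value (w n r)) (value (w n (p ℕ.+ r))) ⟩
    ι (w n r) + ι (w n (p ℕ.+ r))                         ∎
    where
    open ≡-Reasoning
    a b : ℕ → ℚ
    a k = ι (w n k) * δ (+ r ℤ.- + k)
    b k = ι (w n (p ℕ.+ k)) * δ (+ r ℤ.- + k)
    shift : ∀ k → δ (+ r ℤ.- + (p ℕ.+ k)) ≡ δ (+ r ℤ.- + k)
    shift k = trans (cong δ (Z.solve 3 (λ r p k → r Z.:- (p Z.:+ k) Z.:= r Z.:- k Z.:- p) refl (+ r) (+ p) (+ k))) (δ-periodic (+ r ℤ.- + k))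
    single : ∀ (c : ℕ → ℤ) → ∑ℚ p (λ k → ι (c k) * δ (+ r ℤ.- + k)) ≡ ι (c r) * δ (+ r ℤ.- + r)
    single c = ∑-single p r (λ k → ι (c k) * δ (+ r ℤ.- + k)) r<p
      (λ k k<p k≢r → trans (cong (ι (c k) *_) (δ-distinct r k r<p k<p k≢r)) (ℚ.*-zeroʳ (ι (c k))))
    value : ∀ c → ι c * δ (+ r ℤ.- + r) ≡ ι c
    value c = trans (cong (ι c *_) (δ-self (+ r))) (ℚ.*-identityʳ (ι c))

  -- 2p - 1 = 1 + 0 + 2N, so the main congruence applies with a = 2 and b = 0: precision p³, factor
  -- p² and degree N - 1 = p - 2. The exponent 2p - 1 of E is -1 modulo p.
  binomial≡B : ∀ r → r ℕ.< p →
    ι (+ ((2 ℕ.* p ∸ 1) C (p ℕ.+ r))) + ι (-1ℤ ℤ.^ p) * ι (+ ((2 ℕ.* p ∸ 1) C r))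
      ≡ ι (-1ℤ ℤ.^ r) * ι (+ p) ^ 2 * B (p ∸ 2) (ι (ℤ.- + r)) [mod p ^ 3 ]
  binomial≡B r r<p = 𝔭⇒≡ (L (2 ℕ.* p ∸ 1)) (s * π ^ 2 * b) (subst (λ n → 𝔭 3 (L n - s * π ^ 2 * b)) 1+2N≡2p∸1 (subst (𝔭 3) (begin
    -- The errors of the main congruence, of replacing the coefficient `G` by the Bernoulli value
    -- `b`, and of replacing `e` by 1; the last two are multiples of p carrying the factor p².
    s * e * (∇^ n δ (+ r) - (- π) ^ 2 * G) + s * e * ((- π) ^ 2 * (G - b)) - s * b * ((- π) ^ 2 * (1ℚ - e))
      ≡⟨ solve 6 (λ s e d p G b → s :* e :* (d :- :- p :* (:- p :* con 1ℚ) :* G) :+ s :* e :* (:- p :* (:- p :* con 1ℚ) :* (G :- b)) :- s :* b :* (:- p :* (:- p :* con 1ℚ) :* (con 1ℚ :- e))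
           := s :* e :* d :- s :* (p :* (p :* con 1ℚ)) :* b) refl s e (∇^ n δ (+ r)) π G b ⟩
    s * e * ∇^ n δ (+ r) - s * π ^ 2 * b
      ≡⟨ cong (_- s * π ^ 2 * b) left ⟩
    L n - s * π ^ 2 * b ∎)
    (𝔭-- (𝔭-+ (𝔭-* se∈ key) (𝔭-* se∈ (𝔭-[-π]^ 2 G≡b))) (𝔭-* (integral-* (integral-ι (-1ℤ ℤ.^ r)) b∈) (𝔭-[-π]^ 2 e≡1)))))
    where
    open ≡-Reasoning
    n j : ℕ
    n = suc (0 ℕ.+ 2 ℕ.* N)
    j = N ∸ 1
    L : ℕ → ℚ
    L n = ι (+ (n C (p ℕ.+ r))) + ι (-1ℤ ℤ.^ p) * ι (+ (n C r))
    s G b β : ℚ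
    s = ι (-1ℤ ℤ.^ r)
    G = χ-∇ (E ^ˢ n) j (+ r)
    β = χ-∇ (I ^ˢ 1) j (+ r)
    b = B (p ∸ 2) (ι (ℤ.- + r))
    1+n≡p+p : suc n ≡ p ℕ.+ p
    1+n≡p+p = begin
      suc (suc (N ℕ.+ (N ℕ.+ 0)))   ≡⟨ cong (λ x → suc (suc (N ℕ.+ x))) (ℕ.+-identityʳ N) ⟩
      suc (suc (N ℕ.+ N))           ≡⟨ cong suc (ℕ.+-suc N N) ⟨
      suc N ℕ.+ suc N               ≡⟨ cong₂ ℕ._+_ p≡1+N p≡1+N ⟨
      p ℕ.+ p                       ∎
    1+2N≡2p∸1 : n ≡ 2 ℕ.* p ∸ 1
    1+2N≡2p∸1 = cong (_∸ 1) (trans 1+n≡p+p (cong (p ℕ.+_) (sym (ℕ.+-identityʳ p))))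
    j<N : j ℕ.< N
    j<N = ℕ.∸-monoʳ-< {N} {1} {0} ℕ.z<s 0<N
    p∸2≡j : p ∸ 2 ≡ j
    p∸2≡j = sym (ℕ.∸-+-assoc p 1 1)
    se∈ : Integral (s * e)
    se∈ = integral-* (integral-ι (-1ℤ ℤ.^ r)) integral-e
    key : 𝔭 3 (∇^ n δ (+ r) - (- π) ^ 2 * G)
    key = ∇^δ≡χ 2 0 0<N (+ r)
    β∈ : Integral β
    β∈ = integral-χ 1 j (+ r) j<N
    b≡βj! : b ≡ β * ι (+ (j !))
    b≡βj! = trans (cong (λ i → B i (ι (ℤ.- + r))) p∸2≡j) (B-def 1 j (ι (ℤ.- + r)))
    b∈ : Integral b
    b∈ = subst Integral (sym b≡βj!) (integral-* β∈ (integral-ι (+ (j !))))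
    -- (p - 2)! ≡ 1 by Wilson, since N! = N (p - 2)! and N ≡ -1; this is why the final formula
    -- contains no factorial.
    j!≡1 : 𝔭 1 (1ℚ - ι (+ (j !)))
    j!≡1 = 𝔭-sym f 1ℚ (subst (𝔭 1) (begin
      f * π - (ι (+ (N !)) + 1ℚ)         ≡⟨ cong₂ (λ x y → f * x - (y + 1ℚ)) (trans (cong (ι ∘ +_) p≡1+N) (ι-suc N)) N!≡ ⟩
      f * (1ℚ + N′) - (N′ * f + 1ℚ)      ≡⟨ solve 2 (λ n f → f :* (con 1ℚ :+ n) :- (n :* f :+ con 1ℚ) := f :- con 1ℚ) refl N′ f ⟩
      f - 1ℚ                             ∎)
      (𝔭-- (𝔭-* (integral-ι (+ (j !))) (∣⇒𝔭 (+ p) ∣.∣-refl)) wilson))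
      where
      f N′ : ℚ
      f = ι (+ (j !))
      N′ = ι (+ N)
      1+j≡N : suc j ≡ N
      1+j≡N = ℕ.suc-pred N
      N!≡ : ι (+ (N !)) ≡ N′ * f
      N!≡ = begin
        ι (+ (N !))                 ≡⟨ cong (λ x → ι (+ (x !))) 1+j≡N ⟨
        ι (+ (suc j ℕ.* j !))       ≡⟨ cong ι (ℤ.pos-* (suc j) (j !)) ⟩
        ι (+ suc j ℤ.* + (j !))     ≡⟨ ι-* (+ suc j) (+ (j !)) ⟩
        ι (+ suc j) * f             ≡⟨ cong (λ x → ι (+ x) * f) 1+j≡N ⟩
        N′ * f                      ∎
    p∣1+n : p ∣ 1 ℕ.+ n
    p∣1+n = subst (p ∣_) (sym 1+n≡p+p) (∣.∣m∣n⇒∣m+n ∣.∣-refl ∣.∣-refl)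
    G≡b : 𝔭 1 (G - b)
    G≡b = subst (λ x → 𝔭 1 (G - x)) (sym b≡βj!) (𝔭-trans G β (β * ι (+ (j !))) (χE≡χI 1 n p∣1+n j (+ r) j<N)
      (subst (𝔭 1) (solve 2 (λ β f → β :* (con 1ℚ :- f) := β :- β :* f) refl β (ι (+ (j !)))) (𝔭-* β∈ j!≡1)))
    left : s * e * ∇^ n δ (+ r) ≡ L n
    left = begin
      s * e * ∇^ n δ (+ r)
        ≡⟨ cong (s * e *_) (trans (∇^δ-two-terms n 1+n≡p+p r r<p) (cong₂ _+_ (ι-w r) (trans (ι-w (p ℕ.+ r)) (cong (λ x → t * (c′ * x)) (sign-+ p r))))) ⟩
      s * e * (t * (c * s) + t * (c′ * (u * s)))
        ≡⟨ solve 6 (λ s e t c d u → s :* e :* (t :* (c :* s) :+ t :* (d :* (u :* s))) := s :* s :* (e :* t :* c :+ e :* t :* u :* d)) refl s e t c c′ u ⟩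
      s * s * (e * t * c + e * t * u * c′)
        ≡⟨ cong₂ (λ x y → x * (y * c + y * u * c′)) (sign-square r) et≡u ⟩
      1ℚ * (u * c + u * u * c′)
        ≡⟨ cong (λ x → 1ℚ * (u * c + x * c′)) (sign-square p) ⟩
      1ℚ * (u * c + 1ℚ * c′)
        ≡⟨ solve 3 (λ u c d → con 1ℚ :* (u :* c :+ con 1ℚ :* d) := d :+ u :* c) refl u c c′ ⟩
      c′ + u * c ∎
      where
      t u c c′ : ℚ
      t = ι (-1ℤ ℤ.^ n)
      u = ι (-1ℤ ℤ.^ p)
      c = ι (+ (n C r))
      c′ = ι (+ (n C (p ℕ.+ r)))
      ι-w : ∀ k → ι (w n k) ≡ t * (ι (+ (n C k)) * ι (-1ℤ ℤ.^ k))
      ι-w k = trans (cong ι (w-def n k)) (trans (ι-* (-1ℤ ℤ.^ n) (+ (n C k) ℤ.* -1ℤ ℤ.^ k)) (cong (t *_) (ι-* (+ (n C k)) (-1ℤ ℤ.^ k))))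
      t≡eu : t ≡ e * u
      t≡eu = trans (cong (λ x → ι (-1ℤ ℤ.^ x)) (cong (_∸ 1) (trans 1+n≡p+p (cong (ℕ._+ p) p≡1+N)))) (sign-+ N p)
      et≡u : e * t ≡ u
      et≡u = trans (cong (e *_) t≡eu) (trans (sym (ℚ.*-assoc e e u)) (trans (cong (_* u) (sign-square N)) (ℚ.*-identityˡ u)))

corollary1p4 : (p : ℕ) {{pr : Prime p}} → let open Fleck p in
    ((n : ℕ) →
    (ι (-1ℤ ℤ.^ n) * F n 0ℤ ≡ S̄ (n ⋆ ℕ.+ n % p) (n % p) [mod p ^ 1 ]) ×
    ((m : ℕ) → p ∣ m ℕ.+ n →
    S̄ (n ⋆ ℕ.+ n % p) (n % p) ≡ B⟨ m ⟩ (n ⋆) 0ℚ /! (n ⋆) [mod p ^ 1 ]) ×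
    ((r : ℤ) →
    (ι (-1ℤ ℤ.^ n) * F (p ℕ.* n ℕ.+ p ∸ 1) r ≡ B (n ⋆) (ι (ℤ.- r)) /! (n ⋆) [mod p ^ 1 ]) ×
    (B (n ⋆) (ι (ℤ.- r)) /! (n ⋆)
    ≡ - ι (+ ((p ∸ 1 ∸ n ⋆) !)) * B (n ⋆) (ι (r ℤ.+ 1ℤ)) [mod p ^ 1 ]))) ×
    ((r : ℕ) → r ℕ.< p →
    ι (+ ((2 ℕ.* p ∸ 1) C (p ℕ.+ r))) + ι (-1ℤ ℤ.^ p) * ι (+ ((2 ℕ.* p ∸ 1) C r))
    ≡ ι (-1ℤ ℤ.^ r) * ι (+ p) ^ 2 * B (p ∸ 2) (ι (ℤ.- + r)) [mod p ^ 3 ])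
corollary1p4 p {{pr}} =
  (λ n → F≡S̄ n , S̄≡B n , λ r → F≡B n r , B-reflection (n ⋆) r (⋆<N n)) , binomial≡B
  where
  open Fleck p
  open Congruences p pr
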